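{- Let $q$ be a prime power and let $m\ge 2$, $\ell>0$ be integers such that $\ell\mid m$ and $m/\ell$ is even. Then the spectrum of $\Gamma_{q,m}(\ell)$ consists of integers and is as follows. (a) If $\ell\neq \frac m2$, the distinct eigenvalues are $$k_\ell=\frac{q^m-1}{q^\ell+1},\qquad \upsilon_\ell=\frac{\varepsilon_\ell\, q^{m/2}-1}{q^\ell+1},\qquad \mu_\ell=\frac{ -\varepsilon_\ell\, q^{\frac m2+\ell}-1}{q^\ell+1},$$ where $\varepsilon_\ell=(-1)^{\frac12 (m/\ell)}$, with multiplicities $1$, $q^\ell k_\ell$ and $k_\ell$ respectively. (b) If $\ell=\frac m2$, the distinct eigenvalues are $k_{m/2}=q^{m/2}-1$ and $-1$, with multiplicities $q^{m/2}$ and $q^{m/2}(q^{m/2}-1)$ respectively.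
   Context: For a prime power $q$ and integers $m\ge1$, $\ell\ge 0$, let $S_{q,m}(\ell)=\{x^{q^\ell+1}: x\in\mathbb{F}_{q^m}^*\}$. The graph $\Gamma_{q,m}(\ell)$ is the Cayley graph with vertex set $\mathbb{F}_{q^m}$ (as additive group) in which there is an edge from $x$ to $y$ iff $y-x\in S_{q,m}(\ell)$. Eigenvalues and spectrum of a graph are those of its adjacency matrix, counted with multiplicity. -}

module Defs where

open import Level using (Level; _⊔_) renaming (suc to lsuc)
open import Data.Nat as ℕ using (ℕ; zero; suc; ⌊_/2⌋)
open import Data.Nat.Primality using (Prime)
open import Data.Integer as ℤ using (ℤ; +_; -[1+_])
open import Data.List using (List; []; _∷_; map)
open import Data.Fin using (Fin; punchIn; _≟_) renaming (zero to fzero; suc to fsuc)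
open import Data.Fin.Properties using (any?)
open import Data.Product using (Σ; ∃; ∃₂; _×_; _,_)
open import Data.Bool using (Bool; true; false; if_then_else_)
open import Algebra.Bundles using (CommutativeRing)
open import Relation.Nullary using (¬_; Dec; yes; no; ⌊_⌋)
open import Relation.Nullary.Decidable using (_×-dec_; ¬?)
open import Relation.Binary using (Decidable)
open import Relation.Binary.PropositionalEquality using (_≡_)

IsPrimePower : ℕ → Set
IsPrimePower q = ∃₂ λ p k → Prime p × (1 ℕ.≤ k) × (q ≡ p ℕ.^ k)

record FiniteField (c ℓ : Level) : Set (lsuc (c ⊔ ℓ)) where
  field
    commRing : CommutativeRing c ℓ
  open CommutativeRing commRing public
  field
    0≉1       : ¬ (0# ≈ 1#)
    inverse   : ∀ x → ¬ (x ≈ 0#) → ∃ λ y → (x * y) ≈ 1#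
    _≈?_      : Decidable _≈_
    size      : ℕ
    enum      : Fin size → Carrier
    enum-inj  : ∀ i j → enum i ≈ enum j → i ≡ j
    enum-surj : ∀ x → ∃ λ i → enum i ≈ x

  pow : Carrier → ℕ → Carrier
  pow x zero    = 1#
  pow x (suc n) = x * pow x n

-- The Cayley graph Γ_{q,m}(ℓ) on the field F (of order q^m), with
-- vertices indexed by Fin (size F) through the enumeration.
-- Connection set S(ℓ) = { x^(q^ℓ+1) : x ∈ F^* }.

module _ {c ℓ' : Level} (F : FiniteField c ℓ') where
  open FiniteField F

  inS? : (q ℓ : ℕ) (y : Carrier) →
         Dec (∃ λ (k : Fin size) → ¬ (enum k ≈ 0#) × (y ≈ pow (enum k) (q ℕ.^ ℓ ℕ.+ 1)))
  inS? q ℓ y = any? (λ k → ¬? (enum k ≈? 0#) ×-dec (y ≈? pow (enum k) (q ℕ.^ ℓ ℕ.+ 1)))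

  adjacency : (q ℓ : ℕ) → Fin size → Fin size → ℤ
  adjacency q ℓ i j =
    if ⌊ inS? q ℓ (enum j + (- enum i)) ⌋ then + 1 else + 0

-- Polynomials over ℤ: coefficient lists, lowest degree first.
-- Equality is equality after removing trailing zero coefficients.

Poly : Set
Poly = List ℤ

normalize : Poly → Poly
normalize [] = []
normalize (a ∷ p) with normalize p
normalize (+ 0 ∷ p)      | [] = []
normalize (+ suc n ∷ p)  | [] = + suc n ∷ []
normalize (-[1+ n ] ∷ p) | [] = -[1+ n ] ∷ []
normalize (a ∷ p)        | r ∷ rs = a ∷ r ∷ rs

infix 4 _≈P_
_≈P_ : Poly → Poly → Set
p ≈P q = normalize p ≡ normalize q

infixl 6 _+P_ _-P_
infixl 7 _*P_

_+P_ : Poly → Poly → Poly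
[] +P q = q
(a ∷ p) +P [] = a ∷ p
(a ∷ p) +P (b ∷ q) = (a ℤ.+ b) ∷ (p +P q)

negP : Poly → Poly
negP = map (λ a → ℤ.- a)

_-P_ : Poly → Poly → Poly
p -P q = p +P negP q

_*P_ : Poly → Poly → Poly
[] *P q = []
(a ∷ p) *P q = map (a ℤ.*_) q +P (+ 0 ∷ (p *P q))

constP : ℤ → Poly
constP a = a ∷ []

X : Poly
X = + 0 ∷ + 1 ∷ []

_^P_ : Poly → ℕ → Poly
p ^P zero  = constP (+ 1)
p ^P suc n = p *P (p ^P n)

minor : ∀ {n} → (Fin (suc n) → Fin (suc n) → Poly) → Fin (suc n) →
        Fin n → Fin n → Poly
minor M j i k = M (fsuc i) (punchIn j k)

signP : ∀ {n} → Fin n → Poly → Poly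
signP fzero    p = p
signP (fsuc j) p = negP (signP j p)

det : ∀ n → (Fin n → Fin n → Poly) → Poly
det zero    M = constP (+ 1)
det (suc n) M = sumRow (λ j → signP j (M fzero j *P det n (minor M j)))
  where
  sumRow : ∀ {k} → (Fin k → Poly) → Poly
  sumRow {zero}  f = []
  sumRow {suc k} f = f fzero +P sumRow (λ j → f (fsuc j))

charPoly : ∀ n → (Fin n → Fin n → ℤ) → Poly
charPoly n A = det n (λ i j → (if ⌊ i ≟ j ⌋ then X else []) -P constP (A i j))

lin : ℤ → Poly
lin a = X -P constP a

{-# OPTIONS --safe #-}
module Submission where

-- Put L = q^ℓ, K = L + 1, n = q^m = L^(2s) and B = (-1)^s L^s. The number of (x, y) with x^K - y^K = a is
-- expressed, by the substitution x = y + u, through the numbers of u with Λ(a u^K) = v, where Λ is the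
-- alternating trace v - v^L + v^(L²) - ⋯. A second moment computation gives the square of
-- D(a) = #{u : Λ(a u^K) = 0} - #{u : Λ(a u^K) = v₁}, namely n L² or n according as a is a K-th power or not, and
-- D(a) ≡ 1 (mod K) fixes the sign. (This replaces Gauss sums, so that no characters are needed.)
-- Hence the adjacency matrix A satisfies (A - υ)(A - μ) = c J, and N = B(υI - A) + υJ satisfies N² = nN,
-- NJ = 0, tr N = kn. For a matrix with N² = eN the function y ↦ det((eI - N) + yN) is multiplicative up to
-- a factor eⁿ, hence a monomial eⁿ y^d, where d = tr N / e by first-order expansion at y = 1. Applying this to N and J
-- yields det(zI - A) for all large integers z, and so the characteristic polynomial.

-- The form of Λ is dictated by the substitution: for u ≠ 0 and y = uw, the difference (y + u)^K -
-- y^K is u^K (1 + w + w^L). The map w ↦ w + w^L is additive, its image is exactly the kernel of Λ,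
-- and Λ(1) = 0 absorbs the summand 1; hence a given u contributes L solutions or none, according as
-- Λ(a u^(-K)) vanishes or not. Evenness of m/ℓ = 2s makes the signs of Λ close up along the
-- Frobenius orbit and makes K divide n - 1. Kernels, images and the set of K-th powers are never
-- constructed. Each is bounded by the number of roots of a polynomial, and since the product of two
-- such bounds is n or n - 1, both bounds are attained. The linear algebra stays over ℤ:
-- multiplicities are read off exponents of determinants instead of dimensions of eigenspaces,
-- divisions are avoided by carrying the factors K, n and B along, and polynomial identities are
-- tested at infinitely many integers. Case (b) is the same factorisation at s = 1, where B = -L and
-- the eigenvalues k and μ coincide.

-- Integer determinants: alternating multilinear maps and multiplicativity.

module Determinants where

  open import Data.Nat as ℕ using (ℕ; zero; suc)
  import Data.Nat.Properties as ℕₚ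
  open import Data.Integer hiding (suc)
  open import Data.Integer.Properties
  open import Data.Integer.Tactic.RingSolver using (solve-∀)
  open import Data.Fin as F using (Fin; zero; suc; punchIn; punchOut)
  open import Data.Fin.Properties using (punchIn-punchOut; suc-injective; toℕ-injective; toℕ-fromℕ<; toℕ<n)
  open import Data.Vec.Functional using (insertAt)
  open import Data.Vec.Functional.Properties using (insertAt-lookup; insertAt-punchIn)
  open import Function using (_∘_)
  open import Relation.Nullary using (yes; no; contradiction)
  open import Relation.Binary.PropositionalEquality
  open import Algebra.Properties.Semiring.Sum +-*-semiring public
    using (sum; sum-cong-≗; ∑-distrib-+; ∑-comm; *-distribˡ-sum; *-distribʳ-sum; sum-replicate-zero)
  open ≡-Reasoning

  Matrix : ℕ → Set
  Matrix n = Fin n → Fin n → ℤ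

  -- Recursion on both indices, instead of a test for equality, lets the entries of
  -- `cofactor δ zero` reduce to those of the smaller `δ`.
  δ : ∀ {n} → Matrix n
  δ zero    zero    = 1ℤ
  δ zero    (suc j) = 0ℤ
  δ (suc i) zero    = 0ℤ
  δ (suc i) (suc j) = δ i j

  δ-refl : ∀ {n} (i : Fin n) → δ i i ≡ 1ℤ
  δ-refl zero    = refl
  δ-refl (suc i) = δ-refl i

  δ-≢ : ∀ {n} {i j : Fin n} → i ≢ j → δ i j ≡ 0ℤ
  δ-≢ {i = zero}  {zero}  i≢j = contradiction refl i≢j
  δ-≢ {i = zero}  {suc j} i≢j = refl
  δ-≢ {i = suc i} {zero}  i≢j = refl
  δ-≢ {i = suc i} {suc j} i≢j = δ-≢ (i≢j ∘ cong suc)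

  δ-sym : ∀ {n} (i j : Fin n) → δ i j ≡ δ j i
  δ-sym zero    zero    = refl
  δ-sym zero    (suc j) = refl
  δ-sym (suc i) zero    = refl
  δ-sym (suc i) (suc j) = δ-sym i j

  sum-zero : ∀ {n} {f : Fin n → ℤ} → (∀ i → f i ≡ 0ℤ) → sum f ≡ 0ℤ
  sum-zero {n} f≗0 = trans (sum-cong-≗ f≗0) (sum-replicate-zero n)

  sum-lincomb : ∀ {n} a b (f g : Fin n → ℤ) →
                sum (λ i → a * f i + b * g i) ≡ a * sum f + b * sum g
  sum-lincomb a b f g = begin
    sum (λ i → a * f i + b * g i)                 ≡⟨ ∑-distrib-+ (λ i → a * f i) (λ i → b * g i) ⟩
    sum (λ i → a * f i) + sum (λ i → b * g i)     ≡⟨ cong₂ _+_ (*-distribˡ-sum a f) (*-distribˡ-sum b g) ⟨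
    a * sum f + b * sum g                         ∎

  sum-δˡ : ∀ {n} (i : Fin n) (f : Fin n → ℤ) → sum (λ j → δ i j * f j) ≡ f i
  sum-δˡ zero f = begin
    1ℤ * f zero + sum (λ j → 0ℤ * f (suc j))  ≡⟨ cong₂ _+_ (*-identityˡ (f zero)) (sum-zero (λ j → *-zeroˡ (f (suc j)))) ⟩
    f zero + 0ℤ                               ≡⟨ +-identityʳ _ ⟩
    f zero                                    ∎
  sum-δˡ (suc i) f = trans (+-identityˡ _) (sum-δˡ i (f ∘ suc))

  sum-δʳ : ∀ {n} (i : Fin n) (f : Fin n → ℤ) → sum (λ j → f j * δ j i) ≡ f i
  sum-δʳ i f = trans (sum-cong-≗ λ j → trans (*-comm (f j) _) (cong (_* f j) (δ-sym j i))) (sum-δˡ i f)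

  sgn : ∀ {n} → Fin n → ℤ
  sgn zero    = 1ℤ
  sgn (suc j) = - sgn j

  cofactor : ∀ {n} → Matrix (suc n) → Fin (suc n) → Matrix n
  cofactor M j i k = M (suc i) (punchIn j k)

  det : ∀ n → Matrix n → ℤ
  det zero    M = 1ℤ
  det (suc n) M = sum λ j → sgn j * (M zero j * det n (cofactor M j))

  infix 4 _≑_
  _≑_ : ∀ {n} → Matrix n → Matrix n → Set
  M ≑ N = ∀ i j → M i j ≡ N i j

  -- A relation between three matrices, free of row replacement, so that it passes entrywise to
  -- cofactors, bordered matrices and products.
  record IsRowCombination {n} (r : Fin n) (a b : ℤ) (M N P : Matrix n) : Set where
    field
      offˡ : ∀ i → i ≢ r → ∀ j → M i j ≡ P i j
      offʳ : ∀ i → i ≢ r → ∀ j → N i j ≡ P i j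
      atʳ  : ∀ j → P r j ≡ a * M r j + b * N r j

  record IsMultilinear {n} (Φ : Matrix n → ℤ) : Set where
    field
      Φ-cong   : ∀ {M N} → M ≑ N → Φ M ≡ Φ N
      Φ-linear : ∀ r a b {M N P} → IsRowCombination r a b M N P → Φ P ≡ a * Φ M + b * Φ N

  record IsAlternating {n} (Φ : Matrix n → ℤ) : Set where
    field
      isMultilinear : IsMultilinear Φ
      Φ-alternating : ∀ {r s} → r ≢ s → ∀ M → (∀ j → M r j ≡ M s j) → Φ M ≡ 0ℤ
    open IsMultilinear isMultilinear public

  infixl 10 _[_≔_]
  _[_≔_] : ∀ {n} → Matrix n → Fin n → (Fin n → ℤ) → Matrix n
  (M [ r ≔ v ]) i with i F.≟ r
  ... | yes _ = v
  ... | no  _ = M i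

  ≔-at : ∀ {n} (M : Matrix n) r v j → (M [ r ≔ v ]) r j ≡ v j
  ≔-at M r v j with r F.≟ r
  ... | yes _  = refl
  ... | no r≢r = contradiction refl r≢r

  ≔-off : ∀ {n} (M : Matrix n) {r i} v → i ≢ r → ∀ j → (M [ r ≔ v ]) i j ≡ M i j
  ≔-off M {r} {i} v i≢r j with i F.≟ r
  ... | yes i≡r = contradiction i≡r i≢r
  ... | no  _   = refl

  ≔-combination : ∀ {n} (P : Matrix n) r a b v w → (∀ j → P r j ≡ a * v j + b * w j) →
                  IsRowCombination r a b (P [ r ≔ v ]) (P [ r ≔ w ]) P
  ≔-combination P r a b v w eq = record
    { offˡ = λ i i≢r → ≔-off P v i≢r
    ; offʳ = λ i i≢r → ≔-off P w i≢r
    ; atʳ  = λ j → trans (eq j) (cong₂ (λ x y → a * x + b * y) (sym (≔-at P r v j)) (sym (≔-at P r w j)))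
    }

  module Multilinear {n} {Φ : Matrix n → ℤ} (Φ-ml : IsMultilinear Φ) where
    open IsMultilinear Φ-ml

    Φ-at : ∀ (P : Matrix n) r a b v w → (∀ j → P r j ≡ a * v j + b * w j) →
           Φ P ≡ a * Φ (P [ r ≔ v ]) + b * Φ (P [ r ≔ w ])
    Φ-at P r a b v w eq = Φ-linear r a b (≔-combination P r a b v w eq)

    Φ-zero-row : ∀ P r → (∀ j → P r j ≡ 0ℤ) → Φ P ≡ 0ℤ
    -- With both coefficients 0 the combination computes to 0, whatever rows are put in.
    Φ-zero-row P r eq = Φ-at P r 0ℤ 0ℤ (P r) (P r) eq

    Φ-scale-row : ∀ P r a v → (∀ j → P r j ≡ a * v j) → Φ P ≡ a * Φ (P [ r ≔ v ])
    Φ-scale-row P r a v eq = trans (Φ-at P r a 0ℤ v v (λ j → trans (eq j) (sym (+-identityʳ _)))) (+-identityʳ _)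

    ≔-twice : ∀ (P : Matrix n) r v w → (P [ r ≔ v ]) [ r ≔ w ] ≑ P [ r ≔ w ]
    ≔-twice P r v w i j with i F.≟ r
    ... | yes _   = refl
    ... | no  i≢r = ≔-off P v i≢r j

    Φ-row-sum : ∀ {m} P r (c : Fin m → ℤ) (v : Fin m → Fin n → ℤ) →
                (∀ j → P r j ≡ sum (λ k → c k * v k j)) →
                Φ P ≡ sum (λ k → c k * Φ (P [ r ≔ v k ]))
    Φ-row-sum {zero}  P r c v eq = Φ-zero-row P r eq
    Φ-row-sum {suc m} P r c v eq = begin
      Φ P
        ≡⟨ Φ-at P r (c zero) 1ℤ (v zero) w (λ j → trans (eq j) (cong (_+_ (c zero * v zero j)) (sym (*-identityˡ (w j))))) ⟩
      c zero * Φ (P [ r ≔ v zero ]) + 1ℤ * Φ (P [ r ≔ w ])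
        ≡⟨ cong (_+_ Φ₀) (*-identityˡ (Φ (P [ r ≔ w ]))) ⟩
      c zero * Φ (P [ r ≔ v zero ]) + Φ (P [ r ≔ w ])
        ≡⟨ cong (_+_ Φ₀) (Φ-row-sum (P [ r ≔ w ]) r (c ∘ suc) (v ∘ suc) (≔-at P r w)) ⟩
      c zero * Φ (P [ r ≔ v zero ]) + sum (λ k → c (suc k) * Φ ((P [ r ≔ w ]) [ r ≔ v (suc k) ]))
        ≡⟨ cong (_+_ Φ₀) (sum-cong-≗ λ k → cong (c (suc k) *_) (Φ-cong (≔-twice P r w (v (suc k))))) ⟩
      c zero * Φ (P [ r ≔ v zero ]) + sum (λ k → c (suc k) * Φ (P [ r ≔ v (suc k) ]))
        ∎
      where
      w : Fin n → ℤ
      w j = sum (λ k → c (suc k) * v (suc k) j)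

      Φ₀ : ℤ
      Φ₀ = c zero * Φ (P [ r ≔ v zero ])

    -- Polarisation: with `u + v` in both rows Φ vanishes, and so do two of the four terms of its
    -- expansion. Alternation is assumed only for this pair of rows, because `det-alternates` gains
    -- the pairs one by one and swaps a pair already settled in order to reach the next.
    Φ-swap : ∀ r s → r ≢ s → (∀ M → (∀ j → M r j ≡ M s j) → Φ M ≡ 0ℤ) →
             ∀ M → Φ M ≡ - Φ (M [ r ≔ M s ] [ s ≔ M r ])
    Φ-swap r s r≢s alt M = begin
      Φ M                                       ≡⟨ Φ-cong M≑uv ⟩
      Φ (D u v)                                 ≡⟨ rearrange (Φ (D u u)) (Φ (D u v)) (Φ (D v u)) (Φ (D v v)) ⟩
      (1ℤ * (1ℤ * Φ (D u u) + 1ℤ * Φ (D u v)) + 1ℤ * (1ℤ * Φ (D v u) + 1ℤ * Φ (D v v)))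
        - Φ (D u u) - Φ (D v v) - Φ (D v u)
        ≡⟨ cong₂ (λ x y → x - y - Φ (D v v) - Φ (D v u)) (sym expand) (diag u) ⟩
      Φ (D t t) - 0ℤ - Φ (D v v) - Φ (D v u)    ≡⟨ cong₂ (λ x y → x - 0ℤ - y - Φ (D v u)) (diag t) (diag v) ⟩
      0ℤ - 0ℤ - 0ℤ - Φ (D v u)                  ≡⟨ +-identityˡ _ ⟩
      - Φ (D v u)                               ∎
      where
      u v t : Fin n → ℤ
      u = M r
      v = M s
      t j = 1ℤ * u j + 1ℤ * v j

      D : (Fin n → ℤ) → (Fin n → ℤ) → Matrix n
      D x y = M [ r ≔ x ] [ s ≔ y ]

      Dr : ∀ x y j → D x y r j ≡ x j
      Dr x y j = trans (≔-off (M [ r ≔ x ]) y r≢s j) (≔-at M r x j)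

      Ds : ∀ x y j → D x y s j ≡ y j
      Ds x y j = ≔-at (M [ r ≔ x ]) s y j

      diag : ∀ x → Φ (D x x) ≡ 0ℤ
      diag x = alt (D x x) (λ j → trans (Dr x x j) (sym (Ds x x j)))

      M≑uv : M ≑ D u v
      M≑uv i j with i F.≟ s
      ... | yes refl = refl
      ... | no i≢s with i F.≟ r
      ...   | yes refl = refl
      ...   | no  _    = refl

      linʳ : ∀ x → IsRowCombination s 1ℤ 1ℤ (D x u) (D x v) (D x t)
      linʳ x = record
        { offˡ = λ i i≢s j → trans (≔-off _ u i≢s j) (sym (≔-off _ t i≢s j))
        ; offʳ = λ i i≢s j → trans (≔-off _ v i≢s j) (sym (≔-off _ t i≢s j))
        ; atʳ  = λ j → trans (Ds x t j) (sym (cong₂ (λ p q → 1ℤ * p + 1ℤ * q) (Ds x u j) (Ds x v j)))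
        }

      Dcol : ∀ x x′ y i → i ≢ r → ∀ j → D x y i j ≡ D x′ y i j
      Dcol x x′ y i i≢r j with i F.≟ s
      ... | yes _ = refl
      ... | no  _ = trans (≔-off M x i≢r j) (sym (≔-off M x′ i≢r j))

      linˡ : IsRowCombination r 1ℤ 1ℤ (D u t) (D v t) (D t t)
      linˡ = record
        { offˡ = Dcol u t t
        ; offʳ = Dcol v t t
        ; atʳ  = λ j → trans (Dr t t j) (sym (cong₂ (λ p q → 1ℤ * p + 1ℤ * q) (Dr u t j) (Dr v t j)))
        }

      expand : Φ (D t t) ≡ 1ℤ * (1ℤ * Φ (D u u) + 1ℤ * Φ (D u v)) + 1ℤ * (1ℤ * Φ (D v u) + 1ℤ * Φ (D v v))
      expand = trans (Φ-linear r 1ℤ 1ℤ linˡ)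
        (cong₂ (λ x y → 1ℤ * x + 1ℤ * y) (Φ-linear s 1ℤ 1ℤ (linʳ u)) (Φ-linear s 1ℤ 1ℤ (linʳ v)))

      rearrange : ∀ a b c d → b ≡ (1ℤ * (1ℤ * a + 1ℤ * b) + 1ℤ * (1ℤ * c + 1ℤ * d)) - a - d - c
      rearrange = solve-∀

  det-cong : ∀ n {M N : Matrix n} → M ≑ N → det n M ≡ det n N
  det-cong zero    M≑N = refl
  det-cong (suc n) M≑N = sum-cong-≗ λ j →
    cong (sgn j *_) (cong₂ _*_ (M≑N zero j) (det-cong n λ i k → M≑N (suc i) (punchIn j k)))

  det-linear : ∀ n r a b {M N P : Matrix n} → IsRowCombination r a b M N P →
               det n P ≡ a * det n M + b * det n N
  det-linear (suc n) zero a b {M} {N} {P} rc = begin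
    sum (λ j → sgn j * (P zero j * det n (cofactor P j)))
      ≡⟨ sum-cong-≗ (λ j → trans
           (cong (λ x → sgn j * (x * det n (cofactor P j))) (atʳ j))
           (split (sgn j) a b (M zero j) (N zero j) (det n (cofactor P j)))) ⟩
    sum (λ j → a * (sgn j * (M zero j * det n (cofactor P j))) + b * (sgn j * (N zero j * det n (cofactor P j))))
      ≡⟨ sum-cong-≗ (λ j → cong₂ (λ x y → a * (sgn j * (M zero j * x)) + b * (sgn j * (N zero j * y)))
           (det-cong n λ i k → sym (offˡ (suc i) (λ ()) (punchIn j k)))
           (det-cong n λ i k → sym (offʳ (suc i) (λ ()) (punchIn j k)))) ⟩
    sum (λ j → a * (sgn j * (M zero j * det n (cofactor M j))) + b * (sgn j * (N zero j * det n (cofactor N j))))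
      ≡⟨ sum-lincomb a b (λ j → sgn j * (M zero j * det n (cofactor M j))) (λ j → sgn j * (N zero j * det n (cofactor N j))) ⟩
    a * det (suc n) M + b * det (suc n) N ∎
    where
    open IsRowCombination rc
    split : ∀ s a b x y d → s * ((a * x + b * y) * d) ≡ a * (s * (x * d)) + b * (s * (y * d))
    split = solve-∀
  det-linear (suc n) (suc r) a b {M} {N} {P} rc = begin
    sum (λ j → sgn j * (P zero j * det n (cofactor P j)))
      ≡⟨ sum-cong-≗ (λ j → trans
           (cong (λ x → sgn j * (P zero j * x)) (det-linear n r a b (rc′ j)))
           (split (sgn j) a b (P zero j) (det n (cofactor M j)) (det n (cofactor N j)))) ⟩
    sum (λ j → a * (sgn j * (P zero j * det n (cofactor M j))) + b * (sgn j * (P zero j * det n (cofactor N j))))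
      ≡⟨ sum-cong-≗ (λ j → cong₂ (λ x y → a * (sgn j * (x * det n (cofactor M j))) + b * (sgn j * (y * det n (cofactor N j))))
           (sym (offˡ zero (λ ()) j)) (sym (offʳ zero (λ ()) j))) ⟩
    sum (λ j → a * (sgn j * (M zero j * det n (cofactor M j))) + b * (sgn j * (N zero j * det n (cofactor N j))))
      ≡⟨ sum-lincomb a b (λ j → sgn j * (M zero j * det n (cofactor M j))) (λ j → sgn j * (N zero j * det n (cofactor N j))) ⟩
    a * det (suc n) M + b * det (suc n) N ∎
    where
    open IsRowCombination rc
    split : ∀ s a b p x y → s * (p * (a * x + b * y)) ≡ a * (s * (p * x)) + b * (s * (p * y))
    split = solve-∀
    rc′ : ∀ j → IsRowCombination r a b (cofactor M j) (cofactor N j) (cofactor P j)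
    rc′ j = record
      { offˡ = λ i i≢r k → offˡ (suc i) (i≢r ∘ suc-injective) (punchIn j k)
      ; offʳ = λ i i≢r k → offʳ (suc i) (i≢r ∘ suc-injective) (punchIn j k)
      ; atʳ  = λ k → atʳ (punchIn j k)
      }

  det-isMultilinear : ∀ n → IsMultilinear (det n)
  det-isMultilinear n = record { Φ-cong = det-cong n ; Φ-linear = det-linear n }

  -- Extends a selection of columns by column 0; the selections left over in `pairs-cancel` all have
  -- this form.
  lift : ∀ {m n} → (Fin m → Fin n) → Fin (suc m) → Fin (suc n)
  lift e zero    = zero
  lift e (suc i) = suc (e i)

  -- In the double Laplace expansion of a matrix with equal first two rows v, the pairs of columns
  -- (0, 1+k) and (1+k, 0) cancel, and the remaining pairs form the same sum with one column fewer.
  pairs-cancel : ∀ n (v : Fin (suc (suc n)) → ℤ) (H : (Fin n → Fin (suc (suc n))) → ℤ) →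
    (∀ {e f} → (∀ i → e i ≡ f i) → H e ≡ H f) →
    sum (λ j → sum λ k → sgn j * (v j * (sgn k * (v (punchIn j k) * H (punchIn j ∘ punchIn k))))) ≡ 0ℤ
  pairs-cancel n v H H-cong = begin
    sum (λ k → T zero k) + sum (λ j → T (suc j) zero + sum (λ k → T (suc j) (suc k)))
      ≡⟨ cong (_+_ (sum (T zero))) (∑-distrib-+ (λ j → T (suc j) zero) (λ j → sum (λ k → T (suc j) (suc k)))) ⟩
    sum (T zero) + (sum (λ j → T (suc j) zero) + sum (λ j → sum (λ k → T (suc j) (suc k))))
      ≡⟨ cong (λ x → sum (T zero) + (sum (λ j → T (suc j) zero) + x)) (rest n v H H-cong) ⟩
    sum (T zero) + (sum (λ j → T (suc j) zero) + 0ℤ)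
      ≡⟨ cong (_+_ (sum (T zero))) (+-identityʳ _) ⟩
    sum (T zero) + sum (λ j → T (suc j) zero)
      ≡⟨ ∑-distrib-+ (T zero) (λ j → T (suc j) zero) ⟨
    sum (λ j → T zero j + T (suc j) zero)
      ≡⟨ sum-zero (λ j → trans
           (cong (λ x → T zero j + sgn (suc j) * (v (suc j) * (1ℤ * (v zero * x)))) (H-cong (same j)))
           (opposite (sgn j) (v zero) (v (suc j)) (H (punchIn zero ∘ punchIn j)))) ⟩
    0ℤ ∎
    where
    T : Fin (suc (suc n)) → Fin (suc n) → ℤ
    T j k = sgn j * (v j * (sgn k * (v (punchIn j k) * H (punchIn j ∘ punchIn k))))

    same : ∀ j i → punchIn (suc j) (punchIn zero i) ≡ punchIn zero (punchIn j i)
    same j i = refl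

    opposite : ∀ s a b h → 1ℤ * (a * (s * (b * h))) + - s * (b * (1ℤ * (a * h))) ≡ 0ℤ
    opposite = solve-∀

    rest : ∀ n (v : Fin (suc (suc n)) → ℤ) (H : (Fin n → Fin (suc (suc n))) → ℤ) →
      (∀ {e f} → (∀ i → e i ≡ f i) → H e ≡ H f) →
      sum (λ (j : Fin (suc n)) → sum λ (k : Fin n) → sgn (suc j) * (v (suc j) *
        (sgn (suc k) * (v (punchIn (suc j) (suc k)) * H (punchIn (suc j) ∘ punchIn (suc k)))))) ≡ 0ℤ
    rest zero    v H H-cong = refl
    rest (suc n) v H H-cong = trans
      (sum-cong-≗ λ j → sum-cong-≗ λ k → trans
        (signs (sgn j) (v (suc j)) (sgn k) (v (suc (punchIn j k))) _)
        (cong (λ x → sgn j * (v (suc j) * (sgn k * (v (suc (punchIn j k)) * x)))) (H-cong (lifted j k))))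
      (pairs-cancel n (v ∘ suc) (λ e → H (lift e)) (λ e≗f → H-cong λ { zero → refl ; (suc i) → cong suc (e≗f i) }))
      where
      signs : ∀ s a t b h → - s * (a * (- t * (b * h))) ≡ s * (a * (t * (b * h)))
      signs = solve-∀
      lifted : ∀ j k i → punchIn (suc j) (punchIn (suc k) i) ≡ lift (punchIn j ∘ punchIn k) i
      lifted j k zero    = refl
      lifted j k (suc i) = refl

  det-equal-01 : ∀ n {M : Matrix (suc (suc n))} → (∀ j → M zero j ≡ M (suc zero) j) → det (suc (suc n)) M ≡ 0ℤ
  det-equal-01 n {M} eq = trans
    (sum-cong-≗ λ j → trans
      (cong (sgn j *_) (*-distribˡ-sum (M zero j) (row j)))
      (trans (*-distribˡ-sum (sgn j) (λ k → M zero j * row j k))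
        (sum-cong-≗ λ k → cong (λ x → sgn j * (M zero j * (sgn k * (x * H (punchIn j ∘ punchIn k)))))
          (sym (eq (punchIn j k))))))
    (pairs-cancel n (M zero) H (λ e≗f → det-cong n λ i c → cong (M (suc (suc i))) (e≗f c)))
    where
    H : (Fin n → Fin (suc (suc n))) → ℤ
    H e = det n (λ i c → M (suc (suc i)) (e c))
    row : Fin (suc (suc n)) → Fin (suc n) → ℤ
    row j k = sgn k * (M (suc zero) (punchIn j k) * H (punchIn j ∘ punchIn k))

  AlternatesOn : ∀ {n} → (Matrix n → ℤ) → Fin n → Fin n → Set
  AlternatesOn Φ r s = ∀ M → (∀ j → M r j ≡ M s j) → Φ M ≡ 0ℤ

  det-alternates-suc : ∀ n {r s} → AlternatesOn (det n) r s → AlternatesOn (det (suc n)) (suc r) (suc s)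
  det-alternates-suc n alt M eq = sum-zero λ j → trans
    (cong (λ x → sgn j * (M zero j * x)) (alt (cofactor M j) (eq ∘ punchIn j)))
    (trans (cong (sgn j *_) (*-zeroʳ (M zero j))) (*-zeroʳ (sgn j)))

  -- Swapping row 1 with the row equal to row 0 makes rows 0 and 1 equal. The swap involves only
  -- rows below the first, where alternation is known from the smaller size.
  alternates-via-swap : ∀ n s → AlternatesOn (det (suc n)) zero (suc s) →
                        AlternatesOn (det (suc (suc n))) zero (suc (suc s))
  alternates-via-swap n s alt M eq = begin
    det _ M    ≡⟨ Φ-swap (suc zero) (suc (suc s)) (λ ()) (det-alternates-suc (suc n) alt) M ⟩
    - det _ (M [ suc zero ≔ M (suc (suc s)) ] [ suc (suc s) ≔ M (suc zero) ])
               ≡⟨ cong -_ (det-equal-01 n {M [ suc zero ≔ M (suc (suc s)) ] [ suc (suc s) ≔ M (suc zero) ]} eq) ⟩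
    0ℤ         ∎
    where open Multilinear (det-isMultilinear (suc (suc n)))

  det-alternates : ∀ n {r s} → r ≢ s → AlternatesOn (det n) r s
  det-alternates n             {zero}  {zero}        r≢s = contradiction refl r≢s
  det-alternates (suc n)       {suc r} {suc s}       r≢s = det-alternates-suc n (det-alternates n (r≢s ∘ cong suc))
  det-alternates (suc (suc n)) {zero}  {suc zero}    r≢s M eq = det-equal-01 n {M} eq
  det-alternates (suc (suc n)) {suc zero} {zero}     r≢s M eq = det-equal-01 n {M} (sym ∘ eq)
  det-alternates (suc (suc n)) {zero}  {suc (suc s)} r≢s = alternates-via-swap n s (det-alternates (suc n) (λ ()))
  det-alternates (suc (suc n)) {suc (suc r)} {zero}  r≢s M eq =
    alternates-via-swap n r (det-alternates (suc n) (λ ())) M (sym ∘ eq)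

  module Alternating {n} {Φ : Matrix n → ℤ} (Φ-alt : IsAlternating Φ) where
    open IsAlternating Φ-alt
    open Multilinear isMultilinear public

    Φ-add-multiple : ∀ {M P r s} c → r ≢ s → (∀ i → i ≢ r → ∀ j → P i j ≡ M i j) →
                     (∀ j → P r j ≡ M r j + c * M s j) → Φ P ≡ Φ M
    Φ-add-multiple {M} {P} {r} {s} c r≢s off at = begin
      Φ P                                               ≡⟨ Φ-at P r 1ℤ c (M r) (M s) (λ j → trans (at j) (cong (_+ c * M s j) (sym (*-identityˡ (M r j))))) ⟩
      1ℤ * Φ (P [ r ≔ M r ]) + c * Φ (P [ r ≔ M s ])    ≡⟨ cong₂ (λ x y → 1ℤ * x + c * y) (Φ-cong P≑M) (Φ-alternating r≢s (P [ r ≔ M s ]) equal) ⟩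
      1ℤ * Φ M + c * 0ℤ                                 ≡⟨ simplify (Φ M) c ⟩
      Φ M                                               ∎
      where
      P≑M : P [ r ≔ M r ] ≑ M
      P≑M i j with i F.≟ r
      ... | yes refl = refl
      ... | no  i≢r  = off i i≢r j
      equal : ∀ j → (P [ r ≔ M s ]) r j ≡ (P [ r ≔ M s ]) s j
      equal j = trans (≔-at P r (M s) j) (sym (trans (≔-off P (M s) (r≢s ∘ sym) j) (off s (r≢s ∘ sym) j)))
      simplify : ∀ x c → 1ℤ * x + c * 0ℤ ≡ x
      simplify = solve-∀

  module _ {n} {Φ : Matrix (suc n) → ℤ} (Φ-alt : IsAlternating Φ) where
    open IsAlternating Φ-alt
    open Alternating Φ-alt

    -- Multiples of row 0 are added to one row at a time. The coefficients vanish from index `k` on,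
    -- so `k` bounds the rows still to be treated, and each step sets the last possibly nonzero
    -- coefficient to 0.
    Φ-clear-bounded : ∀ k → k ℕ.≤ n → (c : Fin n → ℤ) → (∀ i → k ℕ.≤ F.toℕ i → c i ≡ 0ℤ) →
      ∀ {M P} → (∀ j → P zero j ≡ M zero j) → (∀ i j → P (suc i) j ≡ M (suc i) j + c i * M zero j) → Φ P ≡ Φ M
    Φ-clear-bounded zero k≤n c c≡0 {M} eq₀ eq₊ = Φ-cong λ
      { zero j → eq₀ j
      ; (suc i) j → trans (eq₊ i j) (trans (cong (λ x → M (suc i) j + x * M zero j) (c≡0 i ℕ.z≤n)) (+-identityʳ (M (suc i) j)))
      }
    Φ-clear-bounded (suc k) k<n c c≡0 {M} {P} eq₀ eq₊ = trans
      (Φ-add-multiple {N} {P} {suc r} {zero} (c r) (λ ()) off at)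
      (Φ-clear-bounded k (ℕₚ.<⇒≤ k<n) c′ c′≡0 (λ _ → refl) (λ _ _ → refl))
      where
      r : Fin n
      r = F.fromℕ< k<n
      c′ : Fin n → ℤ
      c′ i with i F.≟ r
      ... | yes _ = 0ℤ
      ... | no  _ = c i
      c′-r : c′ r ≡ 0ℤ
      c′-r with r F.≟ r
      ... | yes _  = refl
      ... | no r≢r = contradiction refl r≢r
      c′≡0 : ∀ i → k ℕ.≤ F.toℕ i → c′ i ≡ 0ℤ
      c′≡0 i k≤i with i F.≟ r
      ... | yes _  = refl
      ... | no i≢r = c≡0 i (ℕₚ.≤∧≢⇒< k≤i λ k≡i → i≢r (toℕ-injective (trans (sym k≡i) (sym (toℕ-fromℕ< k<n)))))
      N : Matrix (suc n)
      N zero    j = M zero j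
      N (suc i) j = M (suc i) j + c′ i * M zero j
      off : ∀ i → i ≢ suc r → ∀ j → P i j ≡ N i j
      off zero    _   j = eq₀ j
      off (suc i) i≢r j with i F.≟ r
      ... | yes i≡r = contradiction (cong suc i≡r) i≢r
      ... | no  _   = eq₊ i j
      at : ∀ j → P (suc r) j ≡ N (suc r) j + c r * N zero j
      at j = trans (eq₊ r j) (cong (_+ c r * M zero j) (sym
        (trans (cong (λ x → M (suc r) j + x * M zero j) c′-r) (+-identityʳ (M (suc r) j)))))

    Φ-clear : (c : Fin n → ℤ) → ∀ {M P} → (∀ j → P zero j ≡ M zero j) →
              (∀ i j → P (suc i) j ≡ M (suc i) j + c i * M zero j) → Φ P ≡ Φ M
    Φ-clear c = Φ-clear-bounded n ℕₚ.≤-refl c (λ i n≤i → contradiction n≤i (ℕₚ.<⇒≱ (toℕ<n i)))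

  -- What a matrix with first row `δ j` becomes once column j is cleared below that row; the
  -- remaining block is then its cofactor at j.
  border : ∀ {n} → Fin (suc n) → Matrix n → Matrix (suc n)
  border j N zero    = δ j
  border j N (suc i) = insertAt (N i) j 0ℤ

  insertAt-linear : ∀ {n} (j : Fin (suc n)) a b {u v w : Fin n → ℤ} → (∀ k → w k ≡ a * u k + b * v k) →
    ∀ k → insertAt w j 0ℤ k ≡ a * insertAt u j 0ℤ k + b * insertAt v j 0ℤ k
  insertAt-linear zero a b eq zero    = sym (cong₂ _+_ (*-zeroʳ a) (*-zeroʳ b))
  insertAt-linear zero a b eq (suc k) = eq k
  insertAt-linear {suc n} (suc j) a b eq zero    = eq zero
  insertAt-linear {suc n} (suc j) a b eq (suc k) = insertAt-linear j a b (eq ∘ suc) k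

  insertAt-cong : ∀ {n} (j : Fin (suc n)) {u v : Fin n → ℤ} → (∀ k → u k ≡ v k) →
    ∀ k → insertAt u j 0ℤ k ≡ insertAt v j 0ℤ k
  insertAt-cong zero eq zero    = refl
  insertAt-cong zero eq (suc k) = eq k
  insertAt-cong {suc n} (suc j) eq zero    = eq zero
  insertAt-cong {suc n} (suc j) eq (suc k) = insertAt-cong j (eq ∘ suc) k

  border-isAlternating : ∀ {n} {Φ : Matrix (suc n) → ℤ} → IsAlternating Φ → ∀ j → IsAlternating (Φ ∘ border j)
  border-isAlternating {n} Φ-alt j = record
    { isMultilinear = record
      { Φ-cong   = λ M≑N → Φ-cong λ { zero k → refl ; (suc i) k → insertAt-cong j (M≑N i) k }
      ; Φ-linear = λ r a b rc → Φ-linear (suc r) a b (bordered r a b rc)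
      }
    ; Φ-alternating = λ r≢s M eq → Φ-alternating (r≢s ∘ suc-injective) (border j M) (insertAt-cong j eq)
    }
    where
    open IsAlternating Φ-alt
    bordered : ∀ r a b {M N P : Matrix n} → IsRowCombination r a b M N P →
               IsRowCombination (suc r) a b (border j M) (border j N) (border j P)
    bordered r a b rc = record
      { offˡ = λ { zero _ k → refl ; (suc i) i≢r k → insertAt-cong j (offˡ i (i≢r ∘ cong suc)) k }
      ; offʳ = λ { zero _ k → refl ; (suc i) i≢r k → insertAt-cong j (offʳ i (i≢r ∘ cong suc)) k }
      ; atʳ  = insertAt-linear j a b atʳ
      }
      where open IsRowCombination rc

  insertAt-zeros : ∀ {n} (j : Fin (suc n)) k → insertAt {n = n} (λ _ → 0ℤ) j 0ℤ k ≡ 0ℤ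
  insertAt-zeros zero zero    = refl
  insertAt-zeros zero (suc k) = refl
  insertAt-zeros {suc n} (suc j) zero    = refl
  insertAt-zeros {suc n} (suc j) (suc k) = insertAt-zeros j k

  border-zero-δ : ∀ {n} → border zero δ ≑ δ {suc n}
  border-zero-δ zero    j       = refl
  border-zero-δ (suc i) zero    = refl
  border-zero-δ (suc i) (suc j) = refl

  -- Swapping the first two rows turns `border (suc j) δ` into `border zero (border j δ)`, and the
  -- induction continues with Φ composed with `border zero`. Each swap contributes one sign, whence
  -- `sgn j`.
  Φ-border-δ : ∀ n {Φ : Matrix (suc n) → ℤ} → IsAlternating Φ → ∀ j → Φ (border j δ) ≡ sgn j * Φ δ
  Φ-border-δ n Φ-alt zero = trans (Φ-cong border-zero-δ) (sym (*-identityˡ _))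
    where open IsAlternating Φ-alt
  Φ-border-δ (suc n) {Φ} Φ-alt (suc j) = begin
    Φ X                             ≡⟨ Φ-swap zero (suc zero) (λ ()) (Φ-alternating (λ ())) X ⟩
    - Φ (X [ zero ≔ X (suc zero) ] [ suc zero ≔ X zero ])
                                    ≡⟨ cong -_ (Φ-cong swapped) ⟩
    - Φ (border zero (border j δ))  ≡⟨ cong -_ (Φ-border-δ n (border-isAlternating Φ-alt zero) j) ⟩
    - (sgn j * Φ (border zero δ))   ≡⟨ cong (λ x → - (sgn j * x)) (Φ-cong border-zero-δ) ⟩
    - (sgn j * Φ δ)                 ≡⟨ neg-distribˡ-* (sgn j) (Φ δ) ⟩
    - sgn j * Φ δ                   ∎
    where
    open IsAlternating Φ-alt
    open Alternating Φ-alt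
    X : Matrix (suc (suc n))
    X = border (suc j) δ
    swapped : X [ zero ≔ X (suc zero) ] [ suc zero ≔ X zero ] ≑ border zero (border j δ)
    swapped zero          zero    = refl
    swapped zero          (suc k) = insertAt-zeros j k
    swapped (suc zero)    zero    = refl
    swapped (suc zero)    (suc k) = refl
    swapped (suc (suc i)) zero    = refl
    swapped (suc (suc i)) (suc k) = refl

  border-cofactor : ∀ {n} (M : Matrix (suc n)) j i k →
    M (suc i) k ≡ border j (cofactor M j) (suc i) k + M (suc i) j * δ j k
  border-cofactor M j i k with j F.≟ k
  ... | yes refl = sym (trans
          (cong₂ _+_ (insertAt-lookup (cofactor M j i) j 0ℤ) (cong (M (suc i) j *_) (δ-refl j)))
          (trans (+-identityˡ _) (*-identityʳ (M (suc i) j))))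
  ... | no j≢k = sym (trans
          (cong₂ _+_
            (trans (cong (insertAt (cofactor M j i) j 0ℤ) (sym (punchIn-punchOut j≢k)))
              (trans (insertAt-punchIn (cofactor M j i) j 0ℤ (punchOut j≢k)) (cong (M (suc i)) (punchIn-punchOut j≢k))))
            (trans (cong (M (suc i) j *_) (δ-≢ j≢k)) (*-zeroʳ (M (suc i) j))))
          (+-identityʳ (M (suc i) k)))

  -- The first row is expanded in unit vectors, the column below each unit is cleared, and the
  -- induction applies to Φ composed with `border j`. Multiplicativity follows by taking Φ to be A ↦
  -- det (A ⊗ B).
  alternating-unique : ∀ n {Φ : Matrix n → ℤ} → IsAlternating Φ → ∀ M → Φ M ≡ det n M * Φ δ
  alternating-unique zero    Φ-alt M = trans (Φ-cong λ ()) (sym (*-identityˡ _))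
    where open IsAlternating Φ-alt
  alternating-unique (suc n) {Φ} Φ-alt M = begin
    Φ M
      ≡⟨ Φ-row-sum M zero (M zero) δ (λ j → sym (sum-δʳ j (M zero))) ⟩
    sum (λ j → M zero j * Φ (M [ zero ≔ δ j ]))
      ≡⟨ sum-cong-≗ (λ j → begin
           M zero j * Φ (M [ zero ≔ δ j ])
             ≡⟨ cong (M zero j *_) (Φ-clear Φ-alt (λ i → M (suc i) j) (λ _ → refl) (border-cofactor M j)) ⟩
           M zero j * Φ (border j (cofactor M j))
             ≡⟨ cong (M zero j *_) (alternating-unique n (border-isAlternating Φ-alt j) (cofactor M j)) ⟩
           M zero j * (det n (cofactor M j) * Φ (border j δ))
             ≡⟨ cong (λ x → M zero j * (det n (cofactor M j) * x)) (Φ-border-δ n Φ-alt j) ⟩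
           M zero j * (det n (cofactor M j) * (sgn j * Φ δ))
             ≡⟨ regroup (M zero j) (det n (cofactor M j)) (sgn j) (Φ δ) ⟩
           sgn j * (M zero j * det n (cofactor M j)) * Φ δ ∎) ⟩
    sum (λ j → sgn j * (M zero j * det n (cofactor M j)) * Φ δ)
      ≡⟨ *-distribʳ-sum (Φ δ) (λ j → sgn j * (M zero j * det n (cofactor M j))) ⟨
    det (suc n) M * Φ δ ∎
    where
    open IsAlternating Φ-alt
    open Alternating Φ-alt
    regroup : ∀ m d s f → m * (d * (s * f)) ≡ s * (m * d) * f
    regroup = solve-∀

  infixl 7 _⊗_
  _⊗_ : ∀ {n} → Matrix n → Matrix n → Matrix n
  (A ⊗ B) i j = sum λ k → A i k * B k j

  det-⊗-isAlternating : ∀ n B → IsAlternating (λ A → det n (A ⊗ B))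
  det-⊗-isAlternating n B = record
    { isMultilinear = record
      { Φ-cong   = λ M≑N → det-cong n λ i j → sum-cong-≗ λ k → cong (_* B k j) (M≑N i k)
      ; Φ-linear = λ r a b rc → det-linear n r a b (multiplied r a b rc)
      }
    ; Φ-alternating = λ r≢s M eq → det-alternates n r≢s (M ⊗ B) λ j → sum-cong-≗ λ k → cong (_* B k j) (eq k)
    }
    where
    multiplied : ∀ r a b {M N P : Matrix n} → IsRowCombination r a b M N P →
                 IsRowCombination r a b (M ⊗ B) (N ⊗ B) (P ⊗ B)
    multiplied r a b {M} {N} rc = record
      { offˡ = λ i i≢r j → sum-cong-≗ λ k → cong (_* B k j) (offˡ i i≢r k)
      ; offʳ = λ i i≢r j → sum-cong-≗ λ k → cong (_* B k j) (offʳ i i≢r k)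
      ; atʳ  = λ j → trans
          (sum-cong-≗ λ k → trans (cong (_* B k j) (atʳ k)) (distribute a b (M r k) (N r k) (B k j)))
          (sum-lincomb a b (λ k → M r k * B k j) (λ k → N r k * B k j))
      }
      where
      open IsRowCombination rc
      distribute : ∀ a b x y z → (a * x + b * y) * z ≡ a * (x * z) + b * (y * z)
      distribute = solve-∀

  det-⊗ : ∀ n A B → det n (A ⊗ B) ≡ det n A * det n B
  det-⊗ n A B = trans (alternating-unique n (det-⊗-isAlternating n B) A)
    (cong (det n A *_) (det-cong n λ i j → sum-δˡ i (λ k → B k j)))

-- Evaluation of coefficient lists, and identities decided at large integers.

module IntegerPolynomials where

  open Determinants hiding (det)
  open import Defs
  open import Data.Nat as ℕ using (ℕ; zero; suc)
  import Data.Nat.Properties as ℕₚ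
  import Data.Nat.Divisibility as ℕ∣
  open import Data.Integer hiding (suc)
  open import Data.Integer.Properties
  open import Data.Integer.Tactic.RingSolver using (solve-∀)
  open import Data.List using ([]; _∷_; map)
  open import Data.Fin as F using (Fin; zero; suc)
  open import Data.Product using (∃₂; _,_)
  open import Data.Sum using (_⊎_; inj₁; inj₂)
  open import Relation.Nullary using (¬_; yes; no; ⌊_⌋; contradiction)
  open import Data.Bool using (if_then_else_)
  open import Relation.Binary.PropositionalEquality
  open ≡-Reasoning

  eval : Poly → ℤ → ℤ
  eval []      z = 0ℤ
  eval (a ∷ p) z = a + z * eval p z

  eval-+P : ∀ p q z → eval (p +P q) z ≡ eval p z + eval q z
  eval-+P []      q       z = sym (+-identityˡ _)
  eval-+P (a ∷ p) []      z = sym (+-identityʳ _)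
  eval-+P (a ∷ p) (b ∷ q) z = trans (cong (λ x → a + b + z * x) (eval-+P p q z)) (regroup a b z (eval p z) (eval q z))
    where
    regroup : ∀ a b z x y → a + b + z * (x + y) ≡ a + z * x + (b + z * y)
    regroup = solve-∀

  eval-negP : ∀ p z → eval (negP p) z ≡ - eval p z
  eval-negP []      z = refl
  eval-negP (a ∷ p) z = trans (cong (λ x → - a + z * x) (eval-negP p z)) (regroup a z (eval p z))
    where
    regroup : ∀ a z x → - a + z * - x ≡ - (a + z * x)
    regroup = solve-∀

  eval-scale : ∀ a p z → eval (map (a *_) p) z ≡ a * eval p z
  eval-scale a []      z = sym (*-zeroʳ a)
  eval-scale a (b ∷ p) z = trans (cong (λ x → a * b + z * x) (eval-scale a p z)) (regroup a b z (eval p z))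
    where
    regroup : ∀ a b z x → a * b + z * (a * x) ≡ a * (b + z * x)
    regroup = solve-∀

  eval-*P : ∀ p q z → eval (p *P q) z ≡ eval p z * eval q z
  eval-*P []      q z = refl
  eval-*P (a ∷ p) q z = begin
    eval (map (a *_) q +P (+ 0 ∷ (p *P q))) z    ≡⟨ eval-+P (map (a *_) q) (+ 0 ∷ (p *P q)) z ⟩
    eval (map (a *_) q) z + (+ 0 + z * eval (p *P q) z)
      ≡⟨ cong₂ (λ x y → x + (+ 0 + z * y)) (eval-scale a q z) (eval-*P p q z) ⟩
    a * eval q z + (+ 0 + z * (eval p z * eval q z))  ≡⟨ regroup a z (eval p z) (eval q z) ⟩
    (a + z * eval p z) * eval q z  ∎
    where
    regroup : ∀ a z x y → a * y + (+ 0 + z * (x * y)) ≡ (a + z * x) * y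
    regroup = solve-∀

  eval-constP : ∀ a z → eval (constP a) z ≡ a
  eval-constP a z = trans (cong (_+_ a) (*-zeroʳ z)) (+-identityʳ a)

  eval-^P : ∀ p n z → eval (p ^P n) z ≡ eval p z ^ n
  eval-^P p zero    z = eval-constP (+ 1) z
  eval-^P p (suc n) z = trans (eval-*P p (p ^P n) z) (cong (eval p z *_) (eval-^P p n z))

  eval-lin : ∀ a z → eval (lin a) z ≡ z - a
  eval-lin a z = simplify z a
    where
    simplify : ∀ z a → + 0 + - a + z * (+ 1 + z * + 0) ≡ z - a
    simplify = solve-∀

  eval-signP : ∀ {n} (j : Fin n) p z → eval (signP j p) z ≡ sgn j * eval p z
  eval-signP zero    p z = sym (*-identityˡ _)
  eval-signP (suc j) p z = trans (eval-negP (signP j p) z)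
    (trans (cong -_ (eval-signP j p z)) (neg-distribˡ-* (sgn j) (eval p z)))

  -- `rowTail n M` is solved by unification to the local function `sumRow` of `Defs.det`,
  -- which cannot be named from outside of its `where` block.
  mutual
    rowTail : ∀ n → (Fin (suc n) → Fin (suc n) → Poly) → (Fin n → Poly) → Poly
    rowTail = _

    det-unfold : ∀ n M → det (suc n) M ≡
      M zero zero *P det n (minor M zero) +P rowTail n M (λ j → signP (suc j) (M zero (suc j) *P det n (minor M (suc j))))
    det-unfold n M with (λ j → signP (suc j) (M zero (suc j) *P det n (minor M (suc j))))
    ... | w = refl

  eval-rowTail : ∀ n M w z → eval (rowTail n M w) z ≡ sum (λ j → eval (w j) z)
  eval-rowTail zero    M w z = refl
  eval-rowTail (suc n) M w z = trans (eval-+P (w zero) (rowTail n (λ _ _ → []) (λ j → w (suc j))) z)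
    (cong (_+_ (eval (w zero) z)) (eval-rowTail n (λ _ _ → []) (λ j → w (suc j)) z))

  eval-det : ∀ n M z → eval (det n M) z ≡ Determinants.det n (λ i j → eval (M i j) z)
  eval-det zero    M z = eval-constP (+ 1) z
  eval-det (suc n) M z = begin
    eval (det (suc n) M) z
      ≡⟨ cong (λ p → eval p z) (det-unfold n M) ⟩
    eval (term zero +P rowTail n M w) z
      ≡⟨ eval-+P (term zero) (rowTail n M w) z ⟩
    eval (term zero) z + eval (rowTail n M w) z
      ≡⟨ cong₂ _+_ (eval-term zero) (trans (eval-rowTail n M w z) (sum-cong-≗ λ j →
           trans (eval-signP (suc j) (term (suc j)) z) (cong (sgn (suc j) *_) (eval-term (suc j))))) ⟩
    value zero + sum (λ j → sgn (suc j) * value (suc j))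
      ≡⟨ cong (_+ sum (λ j → sgn (suc j) * value (suc j))) (sym (*-identityˡ (value zero))) ⟩
    Determinants.det (suc n) (λ i j → eval (M i j) z) ∎
    where
    term : Fin (suc n) → Poly
    term j = M zero j *P det n (minor M j)
    w : Fin n → Poly
    w j = signP (suc j) (term (suc j))
    value : Fin (suc n) → ℤ
    value j = eval (M zero j) z * Determinants.det n (λ i k → eval (minor M j i k) z)
    eval-term : ∀ j → eval (term j) z ≡ value j
    eval-term j = trans (eval-*P (M zero j) (det n (minor M j)) z) (cong (eval (M zero j) z *_) (eval-det n (minor M j) z))

  eval-charPoly : ∀ n A z → eval (charPoly n A) z ≡ Determinants.det n (λ i j → z * δ i j - A i j)
  eval-charPoly n A z = trans (eval-det n (λ i j → (if ⌊ i F.≟ j ⌋ then X else []) -P constP (A i j)) z) (det-cong n entry)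
    where
    onDiagonal : ∀ z a → + 0 + - a + z * (+ 1 + z * + 0) ≡ z * 1ℤ - a
    onDiagonal = solve-∀
    offDiagonal : ∀ z a → - a + z * + 0 ≡ z * 0ℤ - a
    offDiagonal = solve-∀
    entry : (λ i j → eval ((if ⌊ i F.≟ j ⌋ then X else []) -P constP (A i j)) z) ≑ (λ i j → z * δ i j - A i j)
    entry i j with i F.≟ j
    ... | yes refl = trans (onDiagonal z (A i i)) (cong (λ x → z * x - A i i) (sym (δ-refl i)))
    ... | no i≢j   = trans (offDiagonal z (A i j)) (cong (λ x → z * x - A i j) (sym (δ-≢ i≢j)))

  -- At k = |a| the divisor N + |a| + 1 exceeds |a|, which leaves only a = 0.
  divisible-by-all : ∀ N a (w : ℕ → ℤ) → (∀ k → a ≡ + (N ℕ.+ suc k) * w k) → a ≡ 0ℤ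
  divisible-by-all N a w eq = ∣i∣≡0⇒i≡0 (small ∣ a ∣ refl)
    where
    small : ∀ b → b ≡ ∣ a ∣ → b ≡ 0
    small zero    _  = refl
    small (suc b) eb = contradiction
      (ℕ∣.∣⇒≤ (ℕ∣.divides ∣ w (suc b) ∣ (trans eb (trans (cong ∣_∣ (eq (suc b)))
        (trans (∣i*j∣≡∣i∣*∣j∣ (+ (N ℕ.+ suc (suc b))) (w (suc b))) (ℕₚ.*-comm (N ℕ.+ suc (suc b)) ∣ w (suc b) ∣))))))
      (ℕₚ.<⇒≱ (ℕₚ.m≤n+m (suc (suc b)) N))

  normalize-cong : ∀ a {p q} → normalize p ≡ normalize q → normalize (a ∷ p) ≡ normalize (a ∷ q)
  normalize-cong a        {p} {q} eq with normalize p | normalize q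
  normalize-cong (+ 0)       refl | []     | .[]       = refl
  normalize-cong (+ suc n)   refl | []     | .[]       = refl
  normalize-cong -[1+ n ]    refl | []     | .[]       = refl
  normalize-cong (+ 0)       refl | r ∷ rs | .(r ∷ rs) = refl
  normalize-cong (+ suc n)   refl | r ∷ rs | .(r ∷ rs) = refl
  normalize-cong -[1+ n ]    refl | r ∷ rs | .(r ∷ rs) = refl

  -- The bound allows finitely many exceptional points: the characteristic determinant is evaluated
  -- only at z ≠ υ, and all z beyond |υ| qualify.
  _≗[>_]_ : Poly → ℕ → Poly → Set
  p ≗[> N ] q = ∀ k → eval p (+ (N ℕ.+ suc k)) ≡ eval q (+ (N ℕ.+ suc k))

  +suc≢0 : ∀ N k → + (N ℕ.+ suc k) ≢ 0ℤ
  +suc≢0 N k eq = ℕₚ.m+1+n≢0 N (+-injective eq)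

  *-cancelˡ : ∀ i {j k} → i ≢ 0ℤ → i * j ≡ i * k → j ≡ k
  *-cancelˡ i {j} {k} i≢0 = *-cancelˡ-≡ i j k {{≢-nonZero i≢0}}

  module _ (N : ℕ) (a b : ℤ) (p q : Poly) (eq : (a ∷ p) ≗[> N ] (b ∷ q)) where

    private
      move : ∀ z a b x y → a + z * x ≡ b + z * y → a - b ≡ z * (y - x)
      move z a b x y eq = begin
        a - b                  ≡⟨ lhs z a b x ⟩
        a + z * x - b - z * x  ≡⟨ cong (λ t → t - b - z * x) eq ⟩
        b + z * y - b - z * x  ≡⟨ rhs z b x y ⟩
        z * (y - x)            ∎
        where
        lhs : ∀ z a b x → a - b ≡ a + z * x - b - z * x
        lhs = solve-∀
        rhs : ∀ z b x y → b + z * y - b - z * x ≡ z * (y - x)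
        rhs = solve-∀

    heads-agree : a ≡ b
    heads-agree = i-j≡0⇒i≡j a b (divisible-by-all N (a - b) (λ k → eval q (+ (N ℕ.+ suc k)) - eval p (+ (N ℕ.+ suc k))) λ k →
      move (+ (N ℕ.+ suc k)) a b (eval p (+ (N ℕ.+ suc k))) (eval q (+ (N ℕ.+ suc k))) (eq k))

    tails-agree : p ≗[> N ] q
    tails-agree k = sym (i-j≡0⇒i≡j (eval q z) (eval p z) (*-cancelˡ z (+suc≢0 N k) (begin
      z * (eval q z - eval p z)  ≡⟨ move z a b (eval p z) (eval q z) (eq k) ⟨
      a - b                      ≡⟨ i≡j⇒i-j≡0 heads-agree ⟩
      0ℤ                         ≡⟨ *-zeroʳ z ⟨
      z * 0ℤ                     ∎)))
      where
      z : ℤ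
      z = + (N ℕ.+ suc k)

  private
    eval-0∷[] : ∀ k → 0ℤ ≡ eval (+ 0 ∷ []) (+ k)
    eval-0∷[] k = let z = + k in sym (trans (+-identityˡ (z * 0ℤ)) (*-zeroʳ z))

  -- A constant coefficient divisible by all large integers vanishes.
  eventually-equal : ∀ N p q → p ≗[> N ] q → p ≈P q
  eventually-equal N []      []      eq = refl
  eventually-equal N (a ∷ p) (b ∷ q) eq with heads-agree N a b p q eq
  ... | refl = normalize-cong a {p} {q} (eventually-equal N p q (tails-agree N a a p q eq))
  eventually-equal N []      (b ∷ q) eq with heads-agree N (+ 0) b [] q (λ k → trans (sym (eval-0∷[] (N ℕ.+ suc k))) (eq k))
  ... | refl = normalize-cong (+ 0) {[]} {q}
        (eventually-equal N [] q (tails-agree N (+ 0) (+ 0) [] q (λ k → trans (sym (eval-0∷[] (N ℕ.+ suc k))) (eq k))))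
  eventually-equal N (a ∷ p) []      eq with heads-agree N a (+ 0) p [] (λ k → trans (eq k) (eval-0∷[] (N ℕ.+ suc k)))
  ... | refl = normalize-cong (+ 0) {p} {[]}
        (eventually-equal N p [] (tails-agree N (+ 0) (+ 0) p [] (λ k → trans (eq k) (eval-0∷[] (N ℕ.+ suc k)))))

  -- If p(y) = 2^(j+1) p(2y) then the coefficients satisfy p_i = 2^(i+j+1) p_i, so they vanish.
  eval-zero : ∀ j p → (∀ k → eval p (+ suc k) ≡ (+ 2) ^ suc j * eval p (+ 2 * + suc k)) → ∀ y → eval p y ≡ 0ℤ
  eval-zero j []      eq y = refl
  eval-zero j (a ∷ p) eq y = trans (cong₂ (λ x t → x + y * t) a≡0 (eval-zero (suc j) p eq′ y)) (trans (+-identityˡ _) (*-zeroʳ y))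
    where
    c : ℤ
    c = (+ 2) ^ suc j
    split : ∀ a c z x t → a + z * x ≡ c * (a + + 2 * z * t) → (c - 1ℤ) * a ≡ z * (x - + 2 * c * t)
    split a c z x t eq = begin
      (c - 1ℤ) * a                                          ≡⟨ lhs a c z x t ⟩
      c * (a + + 2 * z * t) - a - + 2 * c * z * t           ≡⟨ cong (λ s → s - a - + 2 * c * z * t) (sym eq) ⟩
      a + z * x - a - + 2 * c * z * t                       ≡⟨ rhs a c z x t ⟩
      z * (x - + 2 * c * t)                                 ∎
      where
      lhs : ∀ a c z x t → (c - 1ℤ) * a ≡ c * (a + + 2 * z * t) - a - + 2 * c * z * t
      lhs = solve-∀
      rhs : ∀ a c z x t → a + z * x - a - + 2 * c * z * t ≡ z * (x - + 2 * c * t)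
      rhs = solve-∀
    split′ : ∀ k → (c - 1ℤ) * a ≡ + suc k * (eval p (+ suc k) - + 2 * c * eval p (+ 2 * + suc k))
    split′ k = split a c (+ suc k) (eval p (+ suc k)) (eval p (+ 2 * + suc k)) (eq k)
    ca≡0 : (c - 1ℤ) * a ≡ 0ℤ
    ca≡0 = divisible-by-all 0 ((c - 1ℤ) * a) (λ k → eval p (+ suc k) - + 2 * c * eval p (+ 2 * + suc k)) split′
    pos-^ : ∀ n → (+ 2) ^ n ≡ + (2 ℕ.^ n)
    pos-^ zero    = refl
    pos-^ (suc n) = trans (cong (+ 2 *_) (pos-^ n)) (sym (pos-* 2 (2 ℕ.^ n)))
    c≢1 : c - 1ℤ ≢ 0ℤ
    c≢1 c-1≡0 = ℕₚ.<⇒≢ (ℕₚ.m≤m*n 2 (2 ℕ.^ j) {{ℕₚ.m^n≢0 2 j}})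
      (sym (+-injective (trans (sym (pos-^ (suc j))) (i-j≡0⇒i≡j c 1ℤ c-1≡0))))
    a≡0 : a ≡ 0ℤ
    a≡0 = *-cancelˡ (c - 1ℤ) c≢1 (trans ca≡0 (sym (*-zeroʳ (c - 1ℤ))))
    eq′ : ∀ k → eval p (+ suc k) ≡ + 2 * c * eval p (+ 2 * + suc k)
    eq′ k = i-j≡0⇒i≡j (eval p (+ suc k)) (+ 2 * c * eval p (+ 2 * + suc k)) (*-cancelˡ (+ suc k) (+suc≢0 0 k) (trans (sym (split′ k)) (trans ca≡0 (sym (*-zeroʳ (+ suc k))))))

  -- The coefficients satisfy c p_i = 2^i g p_i, and the numbers 2^i g are distinct for g ≠ 0, so at
  -- most one p_i is nonzero. If c = g, the constant coefficient is that one and `eval-zero` removes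
  -- the others; otherwise it is 0, and division by y replaces g by 2g.
  eval-monomial : ∀ p c g → g ≢ 0ℤ → (∀ k → c * eval p (+ suc k) ≡ g * eval p (+ 2 * + suc k)) →
                  ∃₂ λ a d → ∀ y → eval p y ≡ a * y ^ d
  eval-monomial []      c g g≢0 eq = 0ℤ , 0 , λ y → refl
  eval-monomial (a ∷ p) c g g≢0 eq with i*j≡0⇒i≡0∨j≡0 (c - g) ca≡0
    where
    split : ∀ a c g z x t → c * (a + z * x) ≡ g * (a + + 2 * z * t) → (c - g) * a ≡ z * (+ 2 * g * t - c * x)
    split a c g z x t eq = begin
      (c - g) * a                                        ≡⟨ lhs a c g z x ⟩
      c * (a + z * x) - g * a - c * z * x                ≡⟨ cong (λ s → s - g * a - c * z * x) eq ⟩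
      g * (a + + 2 * z * t) - g * a - c * z * x          ≡⟨ rhs a c g z x t ⟩
      z * (+ 2 * g * t - c * x)                          ∎
      where
      lhs : ∀ a c g z x → (c - g) * a ≡ c * (a + z * x) - g * a - c * z * x
      lhs = solve-∀
      rhs : ∀ a c g z x t → g * (a + + 2 * z * t) - g * a - c * z * x ≡ z * (+ 2 * g * t - c * x)
      rhs = solve-∀
    split′ : ∀ k → (c - g) * a ≡ + suc k * (+ 2 * g * eval p (+ 2 * + suc k) - c * eval p (+ suc k))
    split′ k = split a c g (+ suc k) (eval p (+ suc k)) (eval p (+ 2 * + suc k)) (eq k)
    ca≡0 : (c - g) * a ≡ 0ℤ
    ca≡0 = divisible-by-all 0 ((c - g) * a) (λ k → + 2 * g * eval p (+ 2 * + suc k) - c * eval p (+ suc k)) split′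
  ... | inj₁ c-g≡0 = a , 0 , λ y → trans (cong (λ x → a + y * x) (eval-zero 0 p shifted y)) (constant a y)
    where
    constant : ∀ a y → a + y * 0ℤ ≡ a * 1ℤ
    constant = solve-∀
    lhs : ∀ g a z x → g * z * x ≡ g * (a + z * x) - g * a
    lhs = solve-∀
    rhs : ∀ g a z t → g * (a + + 2 * z * t) - g * a ≡ g * z * (+ 2 * t)
    rhs = solve-∀
    c≡g : c ≡ g
    c≡g = i-j≡0⇒i≡j c g c-g≡0
    shifted : ∀ k → eval p (+ suc k) ≡ (+ 2) ^ 1 * eval p (+ 2 * + suc k)
    shifted k = *-cancelˡ (g * z) (λ gz≡0 → gz≢0 (i*j≡0⇒i≡0∨j≡0 g gz≡0)) (begin
      g * z * x                   ≡⟨ lhs g a z x ⟩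
      g * (a + z * x) - g * a     ≡⟨ cong (λ s → s * (a + z * x) - g * a) (sym c≡g) ⟩
      c * (a + z * x) - g * a     ≡⟨ cong (λ s → s - g * a) (eq k) ⟩
      g * (a + + 2 * z * t) - g * a  ≡⟨ rhs g a z t ⟩
      g * z * (+ 2 * t)           ∎)
      where
      z x t : ℤ
      z = + suc k
      x = eval p z
      t = eval p (+ 2 * z)
      gz≢0 : ¬ (g ≡ 0ℤ ⊎ z ≡ 0ℤ)
      gz≢0 (inj₁ g≡0) = g≢0 g≡0
      gz≢0 (inj₂ z≡0) = +suc≢0 0 k z≡0
  ... | inj₂ refl = extend (eval-monomial p c (+ 2 * g) 2g≢0 shifted)
    where
    2g≢0 : + 2 * g ≢ 0ℤ
    2g≢0 eq with i*j≡0⇒i≡0∨j≡0 (+ 2) eq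
    ... | inj₂ g≡0 = g≢0 g≡0
    lhs : ∀ c z x → z * (c * x) ≡ c * (0ℤ + z * x)
    lhs = solve-∀
    rhs : ∀ g z t → g * (0ℤ + + 2 * z * t) ≡ z * (+ 2 * g * t)
    rhs = solve-∀
    shifted : ∀ k → c * eval p (+ suc k) ≡ + 2 * g * eval p (+ 2 * + suc k)
    shifted k = *-cancelˡ (+ suc k) (+suc≢0 0 k)
      (trans (lhs c (+ suc k) (eval p (+ suc k))) (trans (eq k) (rhs g (+ suc k) (eval p (+ 2 * + suc k)))))
    raise : ∀ a y w → 0ℤ + y * (a * w) ≡ a * (y * w)
    raise = solve-∀
    extend : (∃₂ λ a d → ∀ y → eval p y ≡ a * y ^ d) → ∃₂ λ a d → ∀ y → eval (0ℤ ∷ p) y ≡ a * y ^ d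
    extend (a , d , eq) = a , suc d , λ y → trans (cong (λ x → 0ℤ + y * x) (eq y)) (raise a y (y ^ d))

-- Determinants of pencils xI + yN with N² = eN.

module ScaledIdempotents where

  open Determinants
  open IntegerPolynomials
  import Defs
  open import Data.Nat as ℕ using (ℕ; zero; suc)
  open import Data.Integer hiding (suc)
  open import Data.Integer.Properties
  open import Data.Integer.Tactic.RingSolver using (solve-∀)
  open import Data.List using ([]; _∷_)
  open import Data.Fin as F using (Fin; zero; suc; punchIn)
  open import Data.Product using (∃; ∃₂; _×_; _,_; proj₁; proj₂)
  open import Relation.Binary.PropositionalEquality
  open ≡-Reasoning

  infixl 7 _*ₛ_
  _*ₛ_ : ∀ {n} → ℤ → Matrix n → Matrix n
  (a *ₛ M) i j = a * M i j

  det-scale : ∀ n a M → det n (a *ₛ M) ≡ a ^ n * det n M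
  det-scale zero    a M = refl
  det-scale (suc n) a M = trans
    (sum-cong-≗ λ j → trans
      (cong (λ x → sgn j * (a * M zero j * x)) (det-scale n a (cofactor M j)))
      (regroup (sgn j) a (M zero j) (a ^ n) (det n (cofactor M j))))
    (sym (*-distribˡ-sum (a * a ^ n) (λ j → sgn j * (M zero j * det n (cofactor M j)))))
    where
    regroup : ∀ s a m p d → s * (a * m * (p * d)) ≡ a * p * (s * (m * d))
    regroup = solve-∀

  det-δ : ∀ n → det n δ ≡ 1ℤ
  det-δ zero    = refl
  det-δ (suc n) = begin
    1ℤ * (1ℤ * det n (cofactor δ zero)) + sum (λ j → sgn (suc j) * (0ℤ * det n (cofactor δ (suc j))))
      ≡⟨ cong₂ _+_ (trans (*-identityˡ (1ℤ * det n (cofactor δ zero))) (*-identityˡ (det n (cofactor δ zero))))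
           (sum-zero {f = λ j → sgn (suc j) * (0ℤ * det n (cofactor δ (suc j)))} (λ j → *-zeroʳ (sgn (suc j)))) ⟩
    det n δ + 0ℤ  ≡⟨ +-identityʳ (det n δ) ⟩
    det n δ       ≡⟨ det-δ n ⟩
    1ℤ            ∎

  trace : ∀ {n} → Matrix n → ℤ
  trace M = sum λ i → M i i

  δ+ : ∀ {n} → ℤ → ℤ → Matrix n → Matrix n
  δ+ a b M i j = a * δ i j + b * M i j

  δ+-⊗-δ+ : ∀ {n} a b c d (M N : Matrix n) i j →
    (δ+ a b M ⊗ δ+ c d N) i j ≡ a * c * δ i j + a * d * N i j + b * c * M i j + b * d * (M ⊗ N) i j
  δ+-⊗-δ+ a b c d M N i j = begin
    sum (λ k → (a * δ i k + b * M i k) * (c * δ k j + d * N k j))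
      ≡⟨ sum-cong-≗ (λ k → expand a b c d (δ i k) (M i k) (δ k j) (N k j)) ⟩
    sum (λ k → (δ i k * (a * (c * δ k j + d * N k j))) + (b * (c * (M i k * δ k j) + d * (M i k * N k j))))
      ≡⟨ ∑-distrib-+ (λ k → δ i k * (a * (c * δ k j + d * N k j))) (λ k → b * (c * (M i k * δ k j) + d * (M i k * N k j))) ⟩
    sum (λ k → δ i k * (a * (c * δ k j + d * N k j))) + sum (λ k → b * (c * (M i k * δ k j) + d * (M i k * N k j)))
      ≡⟨ cong₂ _+_ (sum-δˡ i (λ k → a * (c * δ k j + d * N k j)))
           (trans (sym (*-distribˡ-sum b (λ k → c * (M i k * δ k j) + d * (M i k * N k j))))
             (cong (b *_) (trans (sum-lincomb c d (λ k → M i k * δ k j) (λ k → M i k * N k j))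
               (cong (λ x → c * x + d * (M ⊗ N) i j) (sum-δʳ j (M i)))))) ⟩
    a * (c * δ i j + d * N i j) + b * (c * M i j + d * (M ⊗ N) i j)
      ≡⟨ collect a b c d (δ i j) (N i j) (M i j) ((M ⊗ N) i j) ⟩
    a * c * δ i j + a * d * N i j + b * c * M i j + b * d * (M ⊗ N) i j ∎
    where
    expand : ∀ a b c d x m y n →
      (a * x + b * m) * (c * y + d * n) ≡ (x * (a * (c * y + d * n))) + (b * (c * (m * y) + d * (m * n)))
    expand = solve-∀
    collect : ∀ a b c d x n m p →
      a * (c * x + d * n) + b * (c * m + d * p) ≡ a * c * x + a * d * n + b * c * m + b * d * p
    collect = solve-∀

  det-divisible-row : ∀ n s (M : Matrix n) r v → (∀ j → M r j ≡ s * v j) → ∃ λ R → det n M ≡ s * R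
  det-divisible-row n s M r v eq = det n (M [ r ≔ v ]) , Φ-scale-row M r s v eq
    where open Multilinear (det-isMultilinear n)

  sum-divisible : ∀ {n} s (f : Fin n → ℤ) → (∀ i → ∃ λ R → f i ≡ s * R) → ∃ λ R → sum f ≡ s * R
  sum-divisible {zero}  s f h = 0ℤ , sym (*-zeroʳ s)
  sum-divisible {suc n} s f h =
    let R , eq = h zero
        R′ , eq′ = sum-divisible s (λ i → f (suc i)) (λ i → h (suc i))
    in R + R′ , trans (cong₂ _+_ eq eq′) (sym (*-distribˡ-+ s R R′))

  δ-punchIn : ∀ {n} (j k : Fin n) → δ (suc j) (punchIn (suc j) k) ≡ 0ℤ
  δ-punchIn j k = δ-≢ λ eq → punchInᵢ≢i (suc j) k (sym eq)
    where open import Data.Fin.Properties using (punchInᵢ≢i)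

  -- det(aI + sM) ≡ aⁿ + s aⁿ⁻¹ tr M modulo s², multiplied by a so as to make sense for n = 0.
  det-first-order : ∀ n a s (M : Matrix n) → ∃ λ R →
    a * det n (δ+ a s M) ≡ a ^ n * (a + s * trace M) + s * s * R
  det-first-order zero a s M = 0ℤ , simplify a s
    where
    simplify : ∀ a s → a * 1ℤ ≡ 1ℤ * (a + s * 0ℤ) + s * s * 0ℤ
    simplify = solve-∀
  det-first-order (suc n) a s M =
    M zero zero * a ^ n * T + (a + s * M zero zero) * R + a * R′ , (begin
    a * (1ℤ * ((a * 1ℤ + s * M zero zero) * D) + O)
      ≡⟨ factor a s (M zero zero) D O ⟩
    (a + s * M zero zero) * (a * D) + a * O
      ≡⟨ cong₂ (λ x y → (a + s * M zero zero) * x + a * y) (proj₂ minor₀) (proj₂ minors₊) ⟩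
    (a + s * M zero zero) * (a ^ n * (a + s * T) + s * s * R) + a * (s * s * R′)
      ≡⟨ collect a s (M zero zero) (a ^ n) T R R′ ⟩
    a * a ^ n * (a + s * (M zero zero + T))
      + s * s * (M zero zero * a ^ n * T + (a + s * M zero zero) * R + a * R′) ∎)
    where
    offTerm : Fin n → ℤ
    offTerm j = sgn (suc j) * ((a * 0ℤ + s * M zero (suc j)) * det n (cofactor (δ+ a s M) (suc j)))
    offTerm-divisible : ∀ j → ∃ λ R → offTerm j ≡ s * s * R
    offTerm-divisible j = sgn (suc j) * (M zero (suc j) * R) ,
      trans (cong (λ x → sgn (suc j) * ((a * 0ℤ + s * M zero (suc j)) * x)) (proj₂ row)) (regroup (sgn (suc j)) a s (M zero (suc j)) R)
      where
      dropZero : ∀ a x → a * 0ℤ + x ≡ x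
      dropZero = solve-∀
      -- Row j of this cofactor comes from row 1 + j of the matrix, whose diagonal entry lies in the
      -- deleted column. Only multiples of s remain in it, and the entry of the first row supplies
      -- the second factor s.
      row : ∃ λ R → det n (cofactor (δ+ a s M) (suc j)) ≡ s * R
      row = det-divisible-row n s (cofactor (δ+ a s M) (suc j)) j (λ k → M (suc j) (punchIn (suc j) k))
        (λ k → trans (cong (λ x → a * x + s * M (suc j) (punchIn (suc j) k)) (δ-punchIn j k)) (dropZero a (s * M (suc j) (punchIn (suc j) k))))
      R : ℤ
      R = proj₁ row
      regroup : ∀ g a s m r → g * ((a * 0ℤ + s * m) * (s * r)) ≡ s * s * (g * (m * r))
      regroup = solve-∀
    D O T R R′ : ℤ
    D = det n (δ+ a s (cofactor M zero))
    O = sum offTerm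
    T = trace (cofactor M zero)
    minor₀ : ∃ λ R → a * D ≡ a ^ n * (a + s * T) + s * s * R
    minor₀ = det-first-order n a s (cofactor M zero)
    minors₊ : ∃ λ R → O ≡ s * s * R
    minors₊ = sum-divisible (s * s) offTerm offTerm-divisible
    R = proj₁ minor₀
    R′ = proj₁ minors₊
    factor : ∀ a s m d o → a * (1ℤ * ((a * 1ℤ + s * m) * d) + o) ≡ (a + s * m) * (a * d) + a * o
    factor = solve-∀
    collect : ∀ a s m p t r r′ →
      (a + s * m) * (p * (a + s * t) + s * s * r) + a * (s * s * r′)
        ≡ a * p * (a + s * (m + t)) + s * s * (m * p * t + (a + s * m) * r + a * r′)
    collect = solve-∀

  binomial-first-order : ∀ d s → ∃ λ R → (1ℤ + s) ^ d ≡ 1ℤ + + d * s + s * s * R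
  binomial-first-order zero s = 0ℤ , simplify s
    where
    simplify : ∀ s → 1ℤ ≡ 1ℤ + + 0 * s + s * s * 0ℤ
    simplify = solve-∀
  binomial-first-order (suc d) s =
    let R , eq = binomial-first-order d s
    in + d + R + s * R , trans (cong ((1ℤ + s) *_) eq) (collect (+ d) s R)
    where
    collect : ∀ d s r → (1ℤ + s) * (1ℤ + d * s + s * s * r) ≡ 1ℤ + (1ℤ + d) * s + s * s * (d + r + s * r)
    collect = solve-∀

  private
    ^-≢0 : ∀ {e} n → e ≢ 0ℤ → e ^ n ≢ 0ℤ
    ^-≢0 {e} n e≢0 eq = e≢0 (i^n≡0⇒i≡0 e n eq)

  *-≢0 : ∀ {a b} → a ≢ 0ℤ → b ≢ 0ℤ → a * b ≢ 0ℤ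
  *-≢0 {a} {b} a≢0 b≢0 eq = b≢0 (*-cancelˡ a a≢0 (trans eq (sym (*-zeroʳ a))))

  -- f(y) = det((eI - N) + yN) satisfies f(y) f(z) = eⁿ f(yz), so it is a monomial eⁿ y^d,
  -- and the first-order expansion at y = 1 identifies d.
  module _ {n} (e : ℤ) (e≢0 : e ≢ 0ℤ) (N : Matrix n) (N²≡eN : N ⊗ N ≑ e *ₛ N) where

    private
      f : ℤ → ℤ
      f y = det n (δ+ e (y - 1ℤ) N)

      f-mult : ∀ y z → f y * f z ≡ e ^ n * f (y * z)
      f-mult y z = begin
        f y * f z                                               ≡⟨ det-⊗ n (δ+ e (y - 1ℤ) N) (δ+ e (z - 1ℤ) N) ⟨
        det n (δ+ e (y - 1ℤ) N ⊗ δ+ e (z - 1ℤ) N)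
          ≡⟨ det-cong n (λ i j → trans (δ+-⊗-δ+ e (y - 1ℤ) e (z - 1ℤ) N N i j)
               (trans (cong (_+_ (e * e * δ i j + e * (z - 1ℤ) * N i j + (y - 1ℤ) * e * N i j))
                 (cong ((y - 1ℤ) * (z - 1ℤ) *_) (N²≡eN i j))) (collect e y z (δ i j) (N i j)))) ⟩
        det n (e *ₛ δ+ e (y * z - 1ℤ) N)                        ≡⟨ det-scale n e (δ+ e (y * z - 1ℤ) N) ⟩
        e ^ n * f (y * z)                                       ∎
        where
        collect : ∀ e y z x m →
          e * e * x + e * (z - 1ℤ) * m + (y - 1ℤ) * e * m + (y - 1ℤ) * (z - 1ℤ) * (e * m)
            ≡ e * (e * x + (y * z - 1ℤ) * m)
        collect = solve-∀

      f-one : f 1ℤ ≡ e ^ n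
      f-one = begin
        det n (δ+ e 0ℤ N)   ≡⟨ det-cong n (λ i j → +-identityʳ (e * δ i j)) ⟩
        det n (e *ₛ δ)      ≡⟨ det-scale n e δ ⟩
        e ^ n * det n δ     ≡⟨ cong (e ^ n *_) (det-δ n) ⟩
        e ^ n * 1ℤ          ≡⟨ *-identityʳ (e ^ n) ⟩
        e ^ n               ∎

      -- `eval-monomial` compares coefficients, so `f` has to be presented as the value of a
      -- polynomial and not only as a function.
      p : Defs.Poly
      p = Defs.det n (λ i j → (e * δ i j - N i j) ∷ N i j ∷ [])

      eval-p : ∀ y → eval p y ≡ f y
      eval-p y = trans (eval-det n _ y) (det-cong n λ i j → collect e y (δ i j) (N i j))
        where
        collect : ∀ e y x m → e * x - m + y * (m + y * 0ℤ) ≡ e * x + (y - 1ℤ) * m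
        collect = solve-∀

      f-monomial : ∃₂ λ a d → ∀ y → f y ≡ a * y ^ d
      f-monomial =
        let a , d , eq = eval-monomial p (f (+ 2)) (e ^ n) (^-≢0 n e≢0) λ k →
              trans (cong (f (+ 2) *_) (eval-p (+ suc k)))
                (trans (f-mult (+ 2) (+ suc k)) (cong (e ^ n *_) (sym (eval-p (+ 2 * + suc k)))))
        in a , d , λ y → trans (sym (eval-p y)) (eq y)

    det-eigenvalues : ∃ λ d → + d * e ≡ trace N × (∀ y → det n (δ+ e (y - 1ℤ) N) ≡ e ^ n * y ^ d)
    det-eigenvalues = d , de≡tr , f≡
      where
      a : ℤ
      a = proj₁ f-monomial
      d : ℕ
      d = proj₁ (proj₂ f-monomial)
      eq : ∀ y → f y ≡ a * y ^ d
      eq = proj₂ (proj₂ f-monomial)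
      a≡eⁿ : a ≡ e ^ n
      a≡eⁿ = begin
        a               ≡⟨ *-identityʳ a ⟨
        a * 1ℤ          ≡⟨ cong (a *_) (^-zeroˡ d) ⟨
        a * 1ℤ ^ d      ≡⟨ eq 1ℤ ⟨
        f 1ℤ            ≡⟨ f-one ⟩
        e ^ n           ∎
      f≡ : ∀ y → f y ≡ e ^ n * y ^ d
      f≡ y = trans (eq y) (cong (_* y ^ d) a≡eⁿ)
      E T : ℤ
      E = e ^ n
      T = trace N
      -- The monomial and the determinant are both expanded to first order in s = 1 + k. Their
      -- difference makes s E (de - T) a multiple of s², so E (de - T) is a multiple of every
      -- positive integer and vanishes.
      remainder : ∀ k → ∃ λ w → E * (+ d * e - T) ≡ + suc k * w
      remainder k = R - e * E * R′ , *-cancelˡ s (+suc≢0 0 k) (begin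
        s * (E * (+ d * e - T))
          ≡⟨ lhs e s E (+ d) T R′ ⟩
        e * (E * (1ℤ + + d * s + s * s * R′)) - E * (e + s * T) - e * (E * (s * s * R′))
          ≡⟨ cong (λ x → x - E * (e + s * T) - e * (E * (s * s * R′))) (trans (sym expansion) (proj₂ order₁)) ⟩
        E * (e + s * T) + s * s * R - E * (e + s * T) - e * (E * (s * s * R′))
          ≡⟨ rhs e s E T R R′ ⟩
        s * (s * (R - e * E * R′)) ∎)
        where
        s R R′ : ℤ
        s = + suc k
        order₁ : ∃ λ R → e * det n (δ+ e s N) ≡ E * (e + s * T) + s * s * R
        order₁ = det-first-order n e s N
        order₁′ : ∃ λ R → (1ℤ + s) ^ d ≡ 1ℤ + + d * s + s * s * R
        order₁′ = binomial-first-order d s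
        R = proj₁ order₁
        R′ = proj₁ order₁′
        shift : ∀ s → s ≡ 1ℤ + s - 1ℤ
        shift = solve-∀
        expansion : e * det n (δ+ e s N) ≡ e * (E * (1ℤ + + d * s + s * s * R′))
        expansion = cong (e *_) (trans (cong (λ t → det n (δ+ e t N)) (shift s))
          (trans (f≡ (1ℤ + s)) (cong (E *_) (proj₂ order₁′))))
        lhs : ∀ e s E d T r → s * (E * (d * e - T)) ≡
          e * (E * (1ℤ + d * s + s * s * r)) - E * (e + s * T) - e * (E * (s * s * r))
        lhs = solve-∀
        rhs : ∀ e s E T r r′ →
          E * (e + s * T) + s * s * r - E * (e + s * T) - e * (E * (s * s * r′)) ≡ s * (s * (r - e * E * r′))
        rhs = solve-∀
      de≡tr : + d * e ≡ T
      de≡tr = i-j≡0⇒i≡j (+ d * e) T (*-cancelˡ E (^-≢0 n e≢0)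
        (trans (divisible-by-all 0 (E * (+ d * e - T)) (λ k → proj₁ (remainder k)) (λ k → proj₂ (remainder k)))
          (sym (*-zeroʳ E))))

  sum-replicate-ℤ : ∀ n a → sum {n} (λ _ → a) ≡ + n * a
  sum-replicate-ℤ zero    a = refl
  sum-replicate-ℤ (suc n) a = trans (cong (_+_ a) (sum-replicate-ℤ n a)) (sym (suc-* (+ n) a))

  -- `det-eigenvalues` is applied both to `N` and to the complement eI - N, another scaled
  -- idempotent. Their traces add up to ne, whence d + d′ = n, and a product of the two families
  -- gives every combination of I and N up to the factor e².
  det-pencil : ∀ {n} (e : ℤ) → e ≢ 0ℤ → (N : Matrix n) → N ⊗ N ≑ e *ₛ N →
    ∃₂ λ d d′ → + d * e ≡ trace N × d ℕ.+ d′ ≡ n ×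
      (∀ x y → det n (δ+ x y N) ≡ (x + e * y) ^ d * x ^ d′)
  det-pencil {n} e e≢0 N N²≡eN = combine (det-eigenvalues e e≢0 N N²≡eN) (det-eigenvalues e e≢0 M M²≡eM)
    where
    M : Matrix n
    M = δ+ e -1ℤ N
    M²≡eM : M ⊗ M ≑ e *ₛ M
    M²≡eM i j = trans (δ+-⊗-δ+ e -1ℤ e -1ℤ N N i j)
      (trans (cong (λ x → e * e * δ i j + e * -1ℤ * N i j + -1ℤ * e * N i j + -1ℤ * -1ℤ * x) (N²≡eN i j))
        (collect e (δ i j) (N i j)))
      where
      collect : ∀ e x m → e * e * x + e * -1ℤ * m + -1ℤ * e * m + -1ℤ * -1ℤ * (e * m) ≡ e * (e * x + -1ℤ * m)
      collect = solve-∀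
    trace-M : trace M ≡ + n * e - trace N
    trace-M = begin
      sum (λ i → e * δ i i + -1ℤ * N i i)        ≡⟨ sum-cong-≗ (λ i → cong (λ x → e * x + -1ℤ * N i i) (δ-refl i)) ⟩
      sum (λ i → e * 1ℤ + -1ℤ * N i i)           ≡⟨ sum-lincomb e -1ℤ (λ _ → 1ℤ) (λ i → N i i) ⟩
      e * sum {n} (λ _ → 1ℤ) + -1ℤ * trace N     ≡⟨ cong (λ x → e * x + -1ℤ * trace N) (sum-replicate-ℤ n 1ℤ) ⟩
      e * (+ n * 1ℤ) + -1ℤ * trace N             ≡⟨ collect e (+ n) (trace N) ⟩
      + n * e - trace N                          ∎
      where
      collect : ∀ e n t → e * (n * 1ℤ) + -1ℤ * t ≡ n * e - t
      collect = solve-∀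
    combine :
      (∃ λ d → + d * e ≡ trace N × (∀ y → det n (δ+ e (y - 1ℤ) N) ≡ e ^ n * y ^ d)) →
      (∃ λ d → + d * e ≡ trace M × (∀ y → det n (δ+ e (y - 1ℤ) M) ≡ e ^ n * y ^ d)) →
      ∃₂ λ d d′ → + d * e ≡ trace N × d ℕ.+ d′ ≡ n ×
        (∀ x y → det n (δ+ x y N) ≡ (x + e * y) ^ d * x ^ d′)
    combine (d , de≡tr , eq) (d′ , d′e≡tr , eq′) = d , d′ , de≡tr , +-injective d+d′≡n , pencil
      where
      d+d′≡n : + (d ℕ.+ d′) ≡ + n
      d+d′≡n = *-cancelʳ-≡ (+ (d ℕ.+ d′)) (+ n) e {{≢-nonZero e≢0}} (begin
        + (d ℕ.+ d′) * e               ≡⟨ *-distribʳ-+ e (+ d) (+ d′) ⟩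
        + d * e + + d′ * e             ≡⟨ cong₂ _+_ de≡tr (trans d′e≡tr trace-M) ⟩
        trace N + (+ n * e - trace N)  ≡⟨ cancel (trace N) (+ n * e) ⟩
        + n * e                        ∎)
        where
        cancel : ∀ t x → t + (x - t) ≡ x
        cancel = solve-∀
      -- (M + (x + ey)N)(xM + N) = e² (xI + yN), where M = eI - N.
      pencil : ∀ x y → det n (δ+ x y N) ≡ (x + e * y) ^ d * x ^ d′
      pencil x y = *-cancelˡ (E * E) (*-≢0 (^-≢0 n e≢0) (^-≢0 n e≢0)) (begin
        E * E * det n (δ+ x y N)
          ≡⟨ trans (cong (E *_) (det-scale n e (δ+ x y N))) (sym (*-assoc E E _)) ⟨
        E * det n (e *ₛ δ+ x y N)
          ≡⟨ det-scale n e (e *ₛ δ+ x y N) ⟨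
        det n (e *ₛ (e *ₛ δ+ x y N))
          ≡⟨ det-cong n product ⟩
        det n (δ+ e (z - 1ℤ) N ⊗ δ+ e (x - 1ℤ) M)
          ≡⟨ det-⊗ n (δ+ e (z - 1ℤ) N) (δ+ e (x - 1ℤ) M) ⟩
        det n (δ+ e (z - 1ℤ) N) * det n (δ+ e (x - 1ℤ) M)
          ≡⟨ cong₂ _*_ (eq z) (eq′ x) ⟩
        E * z ^ d * (E * x ^ d′)
          ≡⟨ collect E (z ^ d) (x ^ d′) ⟩
        E * E * (z ^ d * x ^ d′) ∎)
        where
        E z : ℤ
        E = e ^ n
        z = x + e * y
        collect : ∀ E a b → E * a * (E * b) ≡ E * E * (a * b)
        collect = solve-∀
        N⊗M≡0 : ∀ i j → (N ⊗ M) i j ≡ 0ℤ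
        N⊗M≡0 i j = begin
          (N ⊗ M) i j    ≡⟨ sum-cong-≗ (λ k → cong (_* M k j) (unfoldN (N i k) (δ i k))) ⟩
          (δ+ 0ℤ 1ℤ N ⊗ δ+ e -1ℤ N) i j   ≡⟨ δ+-⊗-δ+ 0ℤ 1ℤ e -1ℤ N N i j ⟩
          0ℤ * e * δ i j + 0ℤ * -1ℤ * N i j + 1ℤ * e * N i j + 1ℤ * -1ℤ * (N ⊗ N) i j
            ≡⟨ cong (λ t → 0ℤ * e * δ i j + 0ℤ * -1ℤ * N i j + 1ℤ * e * N i j + 1ℤ * -1ℤ * t) (N²≡eN i j) ⟩
          0ℤ * e * δ i j + 0ℤ * -1ℤ * N i j + 1ℤ * e * N i j + 1ℤ * -1ℤ * (e * N i j)
            ≡⟨ vanish e (δ i j) (N i j) ⟩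
          0ℤ ∎
          where
          unfoldN : ∀ m x → m ≡ 0ℤ * x + 1ℤ * m
          unfoldN = solve-∀
          vanish : ∀ e x m → 0ℤ * e * x + 0ℤ * -1ℤ * m + 1ℤ * e * m + 1ℤ * -1ℤ * (e * m) ≡ 0ℤ
          vanish = solve-∀
        product : e *ₛ (e *ₛ δ+ x y N) ≑ δ+ e (z - 1ℤ) N ⊗ δ+ e (x - 1ℤ) M
        product i j = sym (begin
          (δ+ e (z - 1ℤ) N ⊗ δ+ e (x - 1ℤ) M) i j
            ≡⟨ δ+-⊗-δ+ e (z - 1ℤ) e (x - 1ℤ) N M i j ⟩
          e * e * δ i j + e * (x - 1ℤ) * M i j + (z - 1ℤ) * e * N i j + (z - 1ℤ) * (x - 1ℤ) * (N ⊗ M) i j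
            ≡⟨ cong (λ t → e * e * δ i j + e * (x - 1ℤ) * M i j + (z - 1ℤ) * e * N i j + (z - 1ℤ) * (x - 1ℤ) * t) (N⊗M≡0 i j) ⟩
          e * e * δ i j + e * (x - 1ℤ) * M i j + (z - 1ℤ) * e * N i j + (z - 1ℤ) * (x - 1ℤ) * 0ℤ
            ≡⟨ cong (λ t → e * e * δ i j + e * (x - 1ℤ) * t + (z - 1ℤ) * e * N i j + (z - 1ℤ) * (x - 1ℤ) * 0ℤ) M-entry ⟩
          e * e * δ i j + e * (x - 1ℤ) * (e * δ i j + -1ℤ * N i j) + (z - 1ℤ) * e * N i j + (z - 1ℤ) * (x - 1ℤ) * 0ℤ
            ≡⟨ simplify e x y (δ i j) (N i j) ⟩
          e * (e * (x * δ i j + y * N i j)) ∎)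
          where
          M-entry : M i j ≡ e * δ i j + -1ℤ * N i j
          M-entry = refl
          simplify : ∀ e x y t m →
            e * e * t + e * (x - 1ℤ) * (e * t + -1ℤ * m) + (x + e * y - 1ℤ) * e * m + (x + e * y - 1ℤ) * (x - 1ℤ) * 0ℤ
              ≡ e * (e * (x * t + y * m))
          simplify = solve-∀

-- Characteristic polynomial from a projector commuting with the all-ones matrix.

module StronglyRegularSpectrum where

  open Determinants
  open IntegerPolynomials
  open ScaledIdempotents
  open import Defs using (charPoly; lin; _*P_; _^P_; _≈P_)
  open import Data.Nat as ℕ using (ℕ; zero; suc)
  import Data.Nat.Properties as ℕₚ
  open import Data.Integer hiding (suc)
  open import Data.Integer.Properties
  open import Data.Integer.Tactic.RingSolver using (solve-∀)
  open import Data.Product using (∃₂; _×_; _,_; proj₁; proj₂)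
  open import Relation.Binary.PropositionalEquality hiding (J)
  open ≡-Reasoning

  J : ∀ {n} → Matrix n
  J i j = 1ℤ

  ^-distribʳ-* : ∀ a b n → (a * b) ^ n ≡ a ^ n * b ^ n
  ^-distribʳ-* a b zero    = refl
  ^-distribʳ-* a b (suc n) = trans (cong (a * b *_) (^-distribʳ-* a b n)) (regroup a b (a ^ n) (b ^ n))
    where
    regroup : ∀ a b x y → a * b * (x * y) ≡ a * x * (b * y)
    regroup = solve-∀

  -- N = n E, where E is the projection to the eigenspace of υ - B.
  projector : ∀ {n} → ℤ → ℤ → Matrix n → Matrix n
  projector B υ A i j = B * (υ * δ i j - A i j) + υ

  -- The splitting n = k + (1 + Lk) is that of the space under A: rank k for the projector, one
  -- dimension for the constant vector, which it annihilates, and Lk dimensions for the eigenvalue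
  -- υ.
  module _ {n} (A : Matrix n) (B υ : ℤ) (k L : ℕ) (n≡ : n ≡ k ℕ.+ suc (L ℕ.* k)) (B²≡n : B * B ≡ + n)
    (k≡ : + k ≡ υ + B * υ)
    (N²≡nN : projector B υ A ⊗ projector B υ A ≑ (+ n) *ₛ projector B υ A)
    (NJ≡0 : ∀ i j → (projector B υ A ⊗ J) i j ≡ 0ℤ)
    (trace≡ : trace (projector B υ A) ≡ + k * + n) where

    private
      N : Matrix n
      N = projector B υ A

      n≢0 : + n ≢ 0ℤ
      n≢0 eq = ℕₚ.m+1+n≢0 k (trans (sym n≡) (+-injective eq))

      B≢0 : B ≢ 0ℤ
      B≢0 B≡0 = n≢0 (trans (sym B²≡n) (cong (_* B) B≡0))

      *-cancelʳ-n : ∀ {i j} → i * + n ≡ j * + n → i ≡ j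
      *-cancelʳ-n {i} {j} = *-cancelʳ-≡ i j (+ n) {{≢-nonZero n≢0}}

      det-N : ∀ x → det n (δ+ x 1ℤ N) ≡ (x + + n) ^ k * x ^ suc (L ℕ.* k)
      det-N x = subst₂ (λ e f → det n (δ+ x 1ℤ N) ≡ (x + + n) ^ e * x ^ f) d≡k d′≡
        (trans (pencil x 1ℤ) (cong (λ t → (x + t) ^ d * x ^ d′) (*-identityʳ (+ n))))
        where
        result : ∃₂ λ d d′ → + d * + n ≡ trace N × d ℕ.+ d′ ≡ n × (∀ x y → det n (δ+ x y N) ≡ (x + + n * y) ^ d * x ^ d′)
        result = det-pencil (+ n) n≢0 N N²≡nN
        d d′ : ℕ
        d = proj₁ result
        d′ = proj₁ (proj₂ result)
        pencil : ∀ x y → det n (δ+ x y N) ≡ (x + + n * y) ^ d * x ^ d′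
        pencil = proj₂ (proj₂ (proj₂ (proj₂ result)))
        d≡k : d ≡ k
        d≡k = +-injective (*-cancelʳ-n (trans (proj₁ (proj₂ (proj₂ result))) trace≡))
        d′≡ : d′ ≡ suc (L ℕ.* k)
        d′≡ = ℕₚ.+-cancelˡ-≡ k d′ (suc (L ℕ.* k)) (trans (cong (ℕ._+ d′) (sym d≡k)) (trans (proj₁ (proj₂ (proj₂ (proj₂ result)))) n≡))

      J²≡nJ : J {n} ⊗ J ≑ (+ n) *ₛ J
      J²≡nJ i j = sum-replicate-ℤ n 1ℤ

      det-J : ∃₂ λ d d′ → d ≡ 1 × suc d′ ≡ n × (∀ x y → det n (δ+ x y (J {n})) ≡ (x + + n * y) ^ d * x ^ d′)
      det-J = d , d′ , d≡1 , trans (cong (ℕ._+ d′) (sym d≡1)) (proj₁ (proj₂ (proj₂ (proj₂ result)))) , proj₂ (proj₂ (proj₂ (proj₂ result)))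
        where
        result : ∃₂ λ d d′ → + d * + n ≡ trace (J {n}) × d ℕ.+ d′ ≡ n × (∀ x y → det n (δ+ x y (J {n})) ≡ (x + + n * y) ^ d * x ^ d′)
        result = det-pencil (+ n) n≢0 (J {n}) J²≡nJ
        d d′ : ℕ
        d = proj₁ result
        d′ = proj₁ (proj₂ result)
        d≡1 : d ≡ 1
        d≡1 = +-injective (*-cancelʳ-n (trans (proj₁ (proj₂ (proj₂ result)))
          (trans (sum-replicate-ℤ n 1ℤ) (*-comm (+ n) 1ℤ))))

    -- With x = B(z - υ), (xI + N)(xI - υJ) = xB(zI - A) and both factors are pencils of scaled idempotents.
    det-characteristic : ∀ z → z ≢ υ →
      det n (λ i j → z * δ i j - A i j) ≡ (z - + k) * (z - υ) ^ (L ℕ.* k) * (z - (υ - B)) ^ k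
    -- The factor x^n B^n is cancellable because B² = n ≠ 0 and x = B(z - υ) with z ≠ υ.
    det-characteristic z z≢υ = *-cancelˡ (x ^ n * B ^ n) (*-≢0 (^n≢0 x≢0) (^n≢0 B≢0)) (begin
      x ^ n * B ^ n * P
        ≡⟨ cong (_* P) (^-distribʳ-* x B n) ⟨
      (x * B) ^ n * P
        ≡⟨ det-scale n (x * B) (λ i j → z * δ i j - A i j) ⟨
      det n ((x * B) *ₛ (λ i j → z * δ i j - A i j))
        ≡⟨ det-cong n product ⟩
      det n (δ+ x 1ℤ N ⊗ δ+ x (- υ) J)
        ≡⟨ det-⊗ n (δ+ x 1ℤ N) (δ+ x (- υ) J) ⟩
      det n (δ+ x 1ℤ N) * det n (δ+ x (- υ) J)
        ≡⟨ cong₂ _*_ (det-N x) detJ ⟩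
      (x + + n) ^ k * (x * x ^ (L ℕ.* k)) * ((x + + n * - υ) * x ^ d′)
        ≡⟨ cong₂ (λ s t → s ^ k * (x * x ^ (L ℕ.* k)) * (t * x ^ d′)) x+n x-nυ ⟩
      (B * W) ^ k * (x * x ^ (L ℕ.* k)) * (B * U * x ^ d′)
        ≡⟨ cong₂ (λ s t → s * (x * t) * (B * U * x ^ d′)) (^-distribʳ-* B W k) (^-distribʳ-* B V (L ℕ.* k)) ⟩
      B ^ k * W ^ k * (x * (B ^ (L ℕ.* k) * V ^ (L ℕ.* k))) * (B * U * x ^ d′)
        ≡⟨ regroup (B ^ k) (W ^ k) x (B ^ (L ℕ.* k)) (V ^ (L ℕ.* k)) B U (x ^ d′) ⟩
      x * x ^ d′ * (B ^ k * (B * B ^ (L ℕ.* k))) * (U * V ^ (L ℕ.* k) * W ^ k)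
        ≡⟨ cong₂ (λ s t → s * t * (U * V ^ (L ℕ.* k) * W ^ k)) (cong (x ^_) 1+d′≡n) (trans (sym (^-distribˡ-+-* B k (suc (L ℕ.* k)))) (cong (B ^_) (sym n≡))) ⟩
      x ^ n * B ^ n * (U * V ^ (L ℕ.* k) * W ^ k) ∎)
      where
      U V W x P : ℤ
      U = z - + k
      V = z - υ
      W = z - (υ - B)
      x = B * V
      P = det n (λ i j → z * δ i j - A i j)
      d′ : ℕ
      d′ = proj₁ (proj₂ det-J)
      1+d′≡n : suc d′ ≡ n
      1+d′≡n = proj₁ (proj₂ (proj₂ (proj₂ det-J)))
      ^n≢0 : ∀ {a} → a ≢ 0ℤ → a ^ n ≢ 0ℤ
      ^n≢0 {a} a≢0 eq = a≢0 (i^n≡0⇒i≡0 a n eq)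
      x≢0 : x ≢ 0ℤ
      x≢0 = *-≢0 B≢0 (λ V≡0 → z≢υ (i-j≡0⇒i≡j z υ V≡0))
      detJ : det n (δ+ x (- υ) J) ≡ (x + + n * - υ) * x ^ d′
      detJ = trans (proj₂ (proj₂ (proj₂ (proj₂ det-J))) x (- υ))
        (cong (_* x ^ d′) (trans (cong ((x + + n * - υ) ^_) (proj₁ (proj₂ (proj₂ det-J)))) (^-identityʳ (x + + n * - υ))))
      x+n : x + + n ≡ B * W
      x+n = trans (cong (_+_ x) (sym B²≡n)) (collect B z υ)
        where
        collect : ∀ B z υ → B * (z - υ) + B * B ≡ B * (z - (υ - B))
        collect = solve-∀
      x-nυ : x + + n * - υ ≡ B * U
      x-nυ = trans (cong (λ t → x + t * - υ) (sym B²≡n)) (trans (collect B z υ) (cong (λ t → B * (z - t)) (sym k≡)))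
        where
        collect : ∀ B z υ → B * (z - υ) + B * B * - υ ≡ B * (z - (υ + B * υ))
        collect = solve-∀
      regroup : ∀ bk wk x bl vl b u xd →
        bk * wk * (x * (bl * vl)) * (b * u * xd) ≡ x * xd * (bk * (b * bl)) * (u * vl * wk)
      regroup = solve-∀
      product : (x * B) *ₛ (λ i j → z * δ i j - A i j) ≑ δ+ x 1ℤ N ⊗ δ+ x (- υ) J
      product i j = sym (begin
        (δ+ x 1ℤ N ⊗ δ+ x (- υ) J) i j
          ≡⟨ δ+-⊗-δ+ x 1ℤ x (- υ) N J i j ⟩
        x * x * δ i j + x * - υ * 1ℤ + 1ℤ * x * N i j + 1ℤ * - υ * (N ⊗ J) i j
          ≡⟨ cong (λ t → x * x * δ i j + x * - υ * 1ℤ + 1ℤ * x * N i j + 1ℤ * - υ * t) (NJ≡0 i j) ⟩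
        x * x * δ i j + x * - υ * 1ℤ + 1ℤ * x * N i j + 1ℤ * - υ * 0ℤ
          ≡⟨ cong (λ t → x * x * δ i j + x * - υ * 1ℤ + 1ℤ * x * t + 1ℤ * - υ * 0ℤ) N-entry ⟩
        x * x * δ i j + x * - υ * 1ℤ + 1ℤ * x * (B * (υ * δ i j - A i j) + υ) + 1ℤ * - υ * 0ℤ
          ≡⟨ simplify B z υ (δ i j) (A i j) ⟩
        x * B * (z * δ i j - A i j) ∎)
        where
        N-entry : N i j ≡ B * (υ * δ i j - A i j) + υ
        N-entry = refl
        simplify : ∀ B z υ t a →
          B * (z - υ) * (B * (z - υ)) * t + B * (z - υ) * - υ * 1ℤ + 1ℤ * (B * (z - υ)) * (B * (υ * t - a) + υ) + 1ℤ * - υ * 0ℤ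
            ≡ B * (z - υ) * B * (z * t - a)
        simplify = solve-∀

    charPoly-factors : charPoly n A ≈P (lin (+ k) *P (lin υ ^P (L ℕ.* k))) *P (lin (υ - B) ^P k)
    charPoly-factors = eventually-equal ∣ υ ∣ (charPoly n A) ((lin (+ k) *P (lin υ ^P (L ℕ.* k))) *P (lin (υ - B) ^P k)) λ j →
      let z = + (∣ υ ∣ ℕ.+ suc j) in begin
      eval (charPoly n A) z
        ≡⟨ eval-charPoly n A z ⟩
      det n (λ i j → z * δ i j - A i j)
        ≡⟨ det-characteristic z (λ z≡υ → ℕₚ.m+1+n≢m ∣ υ ∣ (cong ∣_∣ z≡υ)) ⟩
      (z - + k) * (z - υ) ^ (L ℕ.* k) * (z - (υ - B)) ^ k
        ≡⟨ cong₂ _*_ (cong₂ _*_ (eval-lin (+ k) z) (trans (eval-^P (lin υ) (L ℕ.* k) z) (cong (_^ (L ℕ.* k)) (eval-lin υ z))))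
             (trans (eval-^P (lin (υ - B)) k z) (cong (_^ k) (eval-lin (υ - B) z))) ⟨
      eval (lin (+ k)) z * eval (lin υ ^P (L ℕ.* k)) z * eval (lin (υ - B) ^P k) z
        ≡⟨ cong (_* eval (lin (υ - B) ^P k) z) (eval-*P (lin (+ k)) (lin υ ^P (L ℕ.* k)) z) ⟨
      eval (lin (+ k) *P (lin υ ^P (L ℕ.* k))) z * eval (lin (υ - B) ^P k) z
        ≡⟨ eval-*P (lin (+ k) *P (lin υ ^P (L ℕ.* k))) (lin (υ - B) ^P k) z ⟨
      eval ((lin (+ k) *P (lin υ ^P (L ℕ.* k))) *P (lin (υ - B) ^P k)) z ∎

-- Counting by sums of indicators: fibers, reindexing and tight inequalities.

module Counting where

  open import Data.Nat
  open import Data.Nat.Properties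
  open import Data.Fin as F using (Fin; zero; suc)
  import Data.Fin.Properties as Fₚ
  open import Data.Fin.Permutation using (permutation)
  open import Data.Product using (∃; _×_; _,_)
  open import Function using (_∘_)
  open import Relation.Nullary using (Dec; yes; no; ¬_; contradiction)
  open import Relation.Unary using (Decidable)
  open import Relation.Binary.PropositionalEquality
  open import Algebra.Properties.Semiring.Sum +-*-semiring public
    using (sum; sum-cong-≗; ∑-distrib-+; ∑-comm; *-distribˡ-sum; *-distribʳ-sum)
  open import Algebra.Properties.Semiring.Sum +-*-semiring using (sum-replicate-zero; sum-permute)

  𝟙 : ∀ {p} {P : Set p} → Dec P → ℕ
  𝟙 (yes _) = 1
  𝟙 (no  _) = 0

  𝟙-yes : ∀ {p} {P : Set p} (P? : Dec P) → P → 𝟙 P? ≡ 1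
  𝟙-yes (yes _) _ = refl
  𝟙-yes (no ¬p) p = contradiction p ¬p

  𝟙-no : ∀ {p} {P : Set p} (P? : Dec P) → ¬ P → 𝟙 P? ≡ 0
  𝟙-no (yes p) ¬p = contradiction p ¬p
  𝟙-no (no _)  _  = refl

  𝟙-mono : ∀ {p q} {P : Set p} {Q : Set q} (P? : Dec P) (Q? : Dec Q) → (P → Q) → 𝟙 P? ≤ 𝟙 Q?
  𝟙-mono (yes p) Q? f = ≤-reflexive (sym (𝟙-yes Q? (f p)))
  𝟙-mono (no _)  Q? f = z≤n

  𝟙-cong : ∀ {p q} {P : Set p} {Q : Set q} (P? : Dec P) (Q? : Dec Q) → (P → Q) → (Q → P) → 𝟙 P? ≡ 𝟙 Q?
  𝟙-cong P? Q? f g = ≤-antisym (𝟙-mono P? Q? f) (𝟙-mono Q? P? g)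

  𝟙≡1⇒ : ∀ {p} {P : Set p} (P? : Dec P) → 𝟙 P? ≡ 1 → P
  𝟙≡1⇒ (yes p) _ = p

  sum-zero : ∀ {n} {f : Fin n → ℕ} → (∀ i → f i ≡ 0) → sum f ≡ 0
  sum-zero {n} f≗0 = trans (sum-cong-≗ f≗0) (sum-replicate-zero n)

  sum-const : ∀ n a → sum {n} (λ _ → a) ≡ n * a
  sum-const zero    a = refl
  sum-const (suc n) a = cong (a +_) (sum-const n a)

  sum-mono : ∀ {n} {f g : Fin n → ℕ} → (∀ i → f i ≤ g i) → sum f ≤ sum g
  sum-mono {zero}  f≤g = z≤n
  sum-mono {suc n} f≤g = +-mono-≤ (f≤g zero) (sum-mono (f≤g ∘ suc))

  -- Stands in for comparing cardinalities: applied to indicators, it turns an inclusion into an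
  -- equality as soon as the larger set is shown to have no more elements.
  sum-mono-tight : ∀ {n} {f g : Fin n → ℕ} → (∀ i → f i ≤ g i) → sum g ≤ sum f → ∀ i → f i ≡ g i
  sum-mono-tight {suc n} {f} {g} f≤g Σg≤Σf zero = ≤-antisym (f≤g zero)
    (+-cancelʳ-≤ (sum (f ∘ suc)) (g zero) (f zero)
      (≤-trans (+-monoʳ-≤ (g zero) (sum-mono (f≤g ∘ suc))) Σg≤Σf))
  sum-mono-tight {suc n} {f} {g} f≤g Σg≤Σf (suc i) = sum-mono-tight (f≤g ∘ suc)
    (+-cancelˡ-≤ (f zero) (sum (g ∘ suc)) (sum (f ∘ suc))
      (≤-trans (+-monoˡ-≤ (sum (g ∘ suc)) (f≤g zero)) Σg≤Σf)) i

  sum-pick : ∀ {n} (a : Fin n) (g : Fin n → ℕ) → sum (λ x → 𝟙 (a F.≟ x) * g x) ≡ g a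
  sum-pick zero g = trans (cong₂ _+_ (*-identityˡ (g zero)) (sum-zero {f = λ x → 𝟙 (zero F.≟ suc x) * g (suc x)} λ x → refl)) (+-identityʳ (g zero))
  sum-pick (suc a) g = trans (sum-cong-≗ λ x → cong (_* g (suc x)) (𝟙-cong (suc a F.≟ suc x) (a F.≟ x) Fₚ.suc-injective (cong suc)))
    (sum-pick a (g ∘ suc))

  sum-pick-one : ∀ {n} (a : Fin n) → sum (λ x → 𝟙 (a F.≟ x)) ≡ 1
  sum-pick-one a = trans (sum-cong-≗ λ x → sym (*-identityʳ (𝟙 (a F.≟ x)))) (sum-pick a (λ _ → 1))

  sum-reindex : ∀ {n} (f : Fin n → ℕ) (σ τ : Fin n → Fin n) → (∀ x → σ (τ x) ≡ x) → (∀ x → τ (σ x) ≡ x) →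
                sum f ≡ sum (f ∘ σ)
  sum-reindex f σ τ στ τσ = sum-permute f (permutation σ τ στ τσ)

  fiber : ∀ {m n} → (Fin m → Fin n) → Fin n → ℕ
  fiber φ y = sum λ x → 𝟙 (φ x F.≟ y)

  sum-fibers : ∀ {m n} (φ : Fin m → Fin n) (g : Fin n → ℕ) → sum (g ∘ φ) ≡ sum (λ y → fiber φ y * g y)
  sum-fibers φ g = trans
    (sum-cong-≗ λ x → sym (sum-pick (φ x) g))
    (trans (∑-comm (λ x y → 𝟙 (φ x F.≟ y) * g y))
      (sum-cong-≗ λ y → sym (*-distribʳ-sum (g y) (λ x → 𝟙 (φ x F.≟ y)))))

  fiber-total : ∀ {m n} (φ : Fin m → Fin n) → sum (fiber φ) ≡ m
  fiber-total {m} φ = trans (sum-cong-≗ λ y → sym (*-identityʳ (fiber φ y)))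
    (trans (sym (sum-fibers φ (λ _ → 1))) (trans (sum-const m 1) (*-identityʳ m)))

  image? : ∀ {m n} (φ : Fin m → Fin n) → Decidable (λ y → ∃ λ x → φ x ≡ y)
  image? φ y = Fₚ.any? (λ x → φ x F.≟ y)

  fiber-empty : ∀ {m n} (φ : Fin m → Fin n) {y} → ¬ (∃ λ x → φ x ≡ y) → fiber φ y ≡ 0
  fiber-empty φ {y} ¬im = sum-zero λ x → 𝟙-no (φ x F.≟ y) (λ eq → ¬im (x , eq))

  fiber-image : ∀ {m n} (φ : Fin m → Fin n) κ → (∀ x → fiber φ (φ x) ≡ κ) →
                ∀ y → fiber φ y ≡ κ * 𝟙 (image? φ y)
  fiber-image φ κ eq y with image? φ y
  ... | yes (x , refl) = trans (eq x) (sym (*-identityʳ κ))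
  ... | no ¬im         = trans (fiber-empty φ ¬im) (sym (*-zeroʳ κ))

  -- Used when a product of two cardinalities is known and each factor has an upper bound: kernel
  -- and image of an additive map, or roots of unity and powers.
  product-tight : ∀ {a b c d} → a * b ≡ c * d → a ≤ c → b ≤ d → 0 < c → 0 < d → a ≡ c × b ≡ d
  product-tight {a} {b} {c} {d} ab≡cd a≤c b≤d 0<c 0<d = a≡c , b≡d
    where
    instance
      c≢0 : NonZero c
      c≢0 = >-nonZero 0<c
      d≢0 : NonZero d
      d≢0 = >-nonZero 0<d
    c≤a : c ≤ a
    c≤a = *-cancelʳ-≤ c a d (≤-trans (≤-reflexive (sym ab≡cd)) (*-monoʳ-≤ a b≤d))
    a≡c : a ≡ c
    a≡c = ≤-antisym a≤c c≤a
    b≡d : b ≡ d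
    b≡d = *-cancelˡ-≡ b d c (trans (cong (_* b) (sym a≡c)) ab≡cd)

-- Finite fields: x^n = x, the Frobenius map, and the number of roots of a polynomial.

module FiniteFields where

  open Counting
  open import Level using (0ℓ)
  open import Data.Nat as ℕ using (ℕ; zero; suc; _≤_; _<_; z≤n; s≤s; _!)
  import Data.Nat.Properties as ℕₚ
  import Data.Nat.Divisibility as ℕ∣
  open import Data.Nat.Primality using (Prime; euclidsLemma; ¬prime[0]; ¬prime[1])
  open import Data.Nat.Combinatorics using (_C_; nCn≡1; nCk≡n!/k![n-k]!; k![n∸k]!∣n!)
  open import Data.Nat.DivMod using (m/n*n≡m)
  open import Data.Fin as F using (Fin; zero; suc)
  import Data.Fin.Properties as Fₚ
  open import Data.Product using (∃; _×_; _,_; proj₁; proj₂)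
  open import Data.Sum using (inj₁; inj₂)
  open import Function using (_∘_)
  open import Relation.Nullary using (Dec; yes; no; contradiction)
  open import Relation.Binary.PropositionalEquality
  open import Algebra.Structures using (IsCommutativeRing)
  open import Algebra.Bundles using (CommutativeRing; CommutativeMonoid)
  open ≡-Reasoning

  -- Carried by `Fin n` itself with propositional equality, so that sums over the field are sums
  -- over indices and bijections of the field reindex them.
  record FieldOn (n : ℕ) : Set where
    infixl 6 _+_
    infixl 7 _*_
    infix 8 -_
    field
      _+_ _*_           : Fin n → Fin n → Fin n
      -_                : Fin n → Fin n
      0# 1#             : Fin n
      isCommutativeRing : IsCommutativeRing _≡_ _+_ _*_ -_ 0# 1#
      1≢0               : 1# ≢ 0#
      inverse           : ∀ x → x ≢ 0# → ∃ λ y → x * y ≡ 1#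

    commutativeRing : CommutativeRing 0ℓ 0ℓ
    commutativeRing = record { isCommutativeRing = isCommutativeRing }

    open CommutativeRing commutativeRing public
      using ( _-_; +-assoc; +-comm; +-identityˡ; +-identityʳ; -‿inverseˡ; -‿inverseʳ; *-assoc; *-comm; *-identityˡ
            ; *-identityʳ; distribˡ; distribʳ; zeroˡ; zeroʳ; semiring; commutativeSemiring; ring; +-group
            ; +-commutativeMonoid; *-commutativeMonoid)

  prime∣n!⇒≤ : ∀ {p} n → Prime p → p ℕ∣.∣ n ! → p ≤ n
  prime∣n!⇒≤ {p} zero    pr p∣1 = contradiction (ℕ∣.∣1⇒≡1 p∣1) (λ { refl → ¬prime[1] pr })
  prime∣n!⇒≤ (suc n) pr p∣ with euclidsLemma (suc n) (n !) pr p∣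
  ... | inj₁ p∣1+n = ℕ∣.∣⇒≤ p∣1+n
  ... | inj₂ p∣n!  = ℕₚ.m≤n⇒m≤1+n (prime∣n!⇒≤ n pr p∣n!)

  n∣n! : ∀ n → 0 < n → n ℕ∣.∣ n !
  n∣n! (suc n) _ = ℕ∣.m∣m*n (n !)

  prime∣binomial : ∀ {p k} → Prime p → 0 < k → k < p → p ℕ∣.∣ p C k
  prime∣binomial {p} {k} pr 0<k k<p with euclidsLemma (p C k) (k ! ℕ.* (p ℕ.∸ k) !) pr p∣product
    where
    instance _ = (k ℕₚ.!* (p ℕ.∸ k) !≢0)
    k≤p : k ≤ p
    k≤p = ℕₚ.<⇒≤ k<p
    product≡p! : (p C k) ℕ.* (k ! ℕ.* (p ℕ.∸ k) !) ≡ p !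
    product≡p! = trans (cong (ℕ._* (k ! ℕ.* (p ℕ.∸ k) !)) (nCk≡n!/k![n-k]! k≤p)) (m/n*n≡m (k![n∸k]!∣n! k≤p))
    p∣product : p ℕ∣.∣ (p C k) ℕ.* (k ! ℕ.* (p ℕ.∸ k) !)
    p∣product = subst (p ℕ∣.∣_) (sym product≡p!) (n∣n! p (ℕₚ.<-trans 0<k k<p))
  ... | inj₁ p∣C = p∣C
  ... | inj₂ p∣k!* with euclidsLemma (k !) ((p ℕ.∸ k) !) pr p∣k!*
  ...   | inj₁ p∣k!     = contradiction (prime∣n!⇒≤ k pr p∣k!) (ℕₚ.<⇒≱ k<p)
  ...   | inj₂ p∣[p∸k]! = contradiction (prime∣n!⇒≤ (p ℕ.∸ k) pr p∣[p∸k]!) (ℕₚ.<⇒≱ (p∸k<p k p 0<k (ℕₚ.<⇒≤ k<p)))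
    where
    p∸k<p : ∀ k p → 0 < k → k ≤ p → p ℕ.∸ k < p
    p∸k<p (suc k) (suc p) _ _ = s≤s (ℕₚ.m∸n≤m p k)

  module _ {c ℓ} (M : CommutativeMonoid c ℓ) where
    open CommutativeMonoid M renaming (refl to ≈-refl; trans to ≈-trans)
    open import Algebra.Properties.CommutativeMonoid.Sum M using (sum-remove; sum-cong-≋; sum-replicate-zero) renaming (sum to ∑)

    sum-single : ∀ {n} (i : Fin n) (t : Fin n → Carrier) → (∀ j → j ≢ i → t j ≈ ε) → ∑ t ≈ t i
    sum-single {suc n} i t off = ≈-trans (sum-remove {i = i} t)
      (≈-trans (∙-congˡ (≈-trans (sum-cong-≋ λ j → off (F.punchIn i j) (Fₚ.punchInᵢ≢i i j)) (sum-replicate-zero n)))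
        (identityʳ (t i)))

  module FieldTheory {n : ℕ} (𝔽 : FieldOn n) where

    open FieldOn 𝔽 public
    open import Algebra.Properties.Semiring.Exp semiring public using (_^_; ^-homo-*; ^-assocʳ)
    open import Algebra.Properties.CommutativeSemiring.Exp commutativeSemiring public using (^-distrib-*)
    open import Algebra.Properties.Semiring.Mult semiring using (×1-homo-*; ×-assoc-*; ×-assocˡ) renaming (_×_ to infixr 8 _·_)
    open import Algebra.Properties.Ring ring public using (-‿distribˡ-*; -‿distribʳ-*)
    open import Algebra.Properties.Group +-group public using ()
      renaming (⁻¹-involutive to neg-involutive; inverseʳ-unique to neg-unique; x∙y⁻¹≈ε⇒x≈y to x-y≡0⇒x≡y; ε⁻¹≈ε to -0≡0)
    open import Algebra.Properties.AbelianGroup (CommutativeRing.+-abelianGroup commutativeRing) public using ()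
      renaming (⁻¹-∙-comm to neg-distrib-+)

    open import Algebra.Solver.Ring.NaturalCoefficients.Default commutativeSemiring public using (solve; _:+_; _:*_; _:=_)

    infix 4 _≟_
    _≟_ : (x y : Fin n) → Dec (x ≡ y)
    _≟_ = F._≟_

    *-cancelˡ : ∀ {x y z} → x ≢ 0# → x * y ≡ x * z → y ≡ z
    *-cancelˡ {x} {y} {z} x≢0 eq = begin
      y              ≡⟨ undo y ⟨
      w * (x * y)    ≡⟨ cong (w *_) eq ⟩
      w * (x * z)    ≡⟨ undo z ⟩
      z              ∎
      where
      w : Fin n
      w = proj₁ (inverse x x≢0)
      undo : ∀ y → w * (x * y) ≡ y
      undo y = trans (sym (*-assoc w x y))
        (trans (cong (_* y) (trans (*-comm w x) (proj₂ (inverse x x≢0)))) (*-identityˡ y))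

    x*y≢0 : ∀ {x y} → x ≢ 0# → y ≢ 0# → x * y ≢ 0#
    x*y≢0 {x} x≢0 y≢0 eq = y≢0 (*-cancelˡ x≢0 (trans eq (sym (zeroʳ x))))

    x^m≢0 : ∀ {x} m → x ≢ 0# → x ^ m ≢ 0#
    x^m≢0 zero    x≢0 = 1≢0
    x^m≢0 (suc m) x≢0 = x*y≢0 x≢0 (x^m≢0 m x≢0)

    x^m≡0⇒x≡0 : ∀ {x} m → x ^ m ≡ 0# → x ≡ 0#
    x^m≡0⇒x≡0 {x} m eq with x ≟ 0#
    ... | yes x≡0 = x≡0
    ... | no x≢0  = contradiction eq (x^m≢0 m x≢0)

    1^m≡1 : ∀ m → 1# ^ m ≡ 1#
    1^m≡1 zero    = refl
    1^m≡1 (suc m) = trans (*-identityˡ (1# ^ m)) (1^m≡1 m)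

    0^m≡0 : ∀ {m} → 0 < m → 0# ^ m ≡ 0#
    0^m≡0 {suc m} _ = zeroˡ (0# ^ m)

    -- Made total by sending 0 to 0: inversion is then an involution of the whole field and can
    -- reindex the sum in `convolution`.
    infix 9 _⁻¹
    _⁻¹ : Fin n → Fin n
    x ⁻¹ with x ≟ 0#
    ... | yes _  = 0#
    ... | no x≢0 = proj₁ (inverse x x≢0)

    ⁻¹-inverseʳ : ∀ {x} → x ≢ 0# → x * x ⁻¹ ≡ 1#
    ⁻¹-inverseʳ {x} x≢0 with x ≟ 0#
    ... | yes x≡0 = contradiction x≡0 x≢0
    ... | no x≢0  = proj₂ (inverse x x≢0)

    ⁻¹-inverseˡ : ∀ {x} → x ≢ 0# → x ⁻¹ * x ≡ 1#
    ⁻¹-inverseˡ {x} x≢0 = trans (*-comm (x ⁻¹) x) (⁻¹-inverseʳ x≢0)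

    0⁻¹≡0 : 0# ⁻¹ ≡ 0#
    0⁻¹≡0 with 0# ≟ 0#
    ... | yes _  = refl
    ... | no 0≢0 = contradiction refl 0≢0

    ⁻¹-≢0 : ∀ {x} → x ≢ 0# → x ⁻¹ ≢ 0#
    ⁻¹-≢0 {x} x≢0 eq = 1≢0 (trans (sym (⁻¹-inverseʳ x≢0)) (trans (cong (x *_) eq) (zeroʳ x)))

    ⁻¹-involutive : ∀ x → x ⁻¹ ⁻¹ ≡ x
    ⁻¹-involutive x = by-cases (x ≟ 0#)
      where
      by-cases : Dec (x ≡ 0#) → x ⁻¹ ⁻¹ ≡ x
      by-cases (yes refl) = trans (cong _⁻¹ 0⁻¹≡0) 0⁻¹≡0
      by-cases (no x≢0)   = *-cancelˡ (⁻¹-≢0 x≢0) (trans (⁻¹-inverseʳ (⁻¹-≢0 x≢0)) (sym (⁻¹-inverseˡ x≢0)))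

    cancel-⁻¹ˡ : ∀ {x} → x ≢ 0# → ∀ y → x ⁻¹ * (x * y) ≡ y
    cancel-⁻¹ˡ {x} x≢0 y = trans (sym (*-assoc (x ⁻¹) x y)) (trans (cong (_* y) (⁻¹-inverseˡ x≢0)) (*-identityˡ y))

    cancel-⁻¹ʳ : ∀ {x} → x ≢ 0# → ∀ y → x * (x ⁻¹ * y) ≡ y
    cancel-⁻¹ʳ {x} x≢0 y = trans (sym (*-assoc x (x ⁻¹) y)) (trans (cong (_* y) (⁻¹-inverseʳ x≢0)) (*-identityˡ y))

    sum-scale : ∀ {x} → x ≢ 0# → (f : Fin n → ℕ) → sum f ≡ sum (λ y → f (x * y))
    sum-scale {x} x≢0 f = sum-reindex f (x *_) (x ⁻¹ *_) (cancel-⁻¹ʳ x≢0) (cancel-⁻¹ˡ x≢0)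

    neg-cancelˡ : ∀ x y → - x + (x + y) ≡ y
    neg-cancelˡ x y = trans (sym (+-assoc (- x) x y)) (trans (cong (_+ y) (-‿inverseˡ x)) (+-identityˡ y))

    neg-cancelʳ : ∀ x y → x + (- x + y) ≡ y
    neg-cancelʳ x y = trans (sym (+-assoc x (- x) y)) (trans (cong (_+ y) (-‿inverseʳ x)) (+-identityˡ y))

    +-cancelˡ : ∀ x {y z} → x + y ≡ x + z → y ≡ z
    +-cancelˡ x {y} {z} eq = trans (sym (neg-cancelˡ x y)) (trans (cong (- x +_) eq) (neg-cancelˡ x z))

    sum-translate : ∀ x (f : Fin n → ℕ) → sum f ≡ sum (λ y → f (x + y))
    sum-translate x f = sum-reindex f (x +_) (- x +_) (neg-cancelʳ x) (neg-cancelˡ x)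

    private
      module Σ+ where
        open import Algebra.Properties.CommutativeMonoid.Sum +-commutativeMonoid public
      module Π* where
        open import Algebra.Properties.CommutativeMonoid.Sum *-commutativeMonoid public
      open import Data.Fin.Permutation using (permutation)

    -- Comparing Σ_x (x + 1) with Σ_x x.
    order×1≡0 : n · 1# ≡ 0#
    order×1≡0 = +-cancelˡ (Σ+.sum (λ x → x)) (begin
      Σ+.sum (λ x → x) + n · 1#                   ≡⟨ cong (Σ+.sum (λ x → x) +_) (Σ+.sum-replicate n) ⟨
      Σ+.sum (λ x → x) + Σ+.sum {n} (λ _ → 1#)    ≡⟨ Σ+.∑-distrib-+ (λ x → x) (λ _ → 1#) ⟨
      Σ+.sum (λ x → x + 1#)                       ≡⟨ Σ+.sum-permute (λ x → x) (permutation (_+ 1#) (_+ - 1#) (shift (-‿inverseˡ 1#)) (shift (-‿inverseʳ 1#))) ⟨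
      Σ+.sum (λ x → x)                            ≡⟨ +-identityʳ _ ⟨
      Σ+.sum (λ x → x) + 0#                       ∎)
      where
      shift : ∀ {a b} → a + b ≡ 0# → ∀ x → x + a + b ≡ x
      shift {a} {b} eq x = trans (+-assoc x a b) (trans (cong (x +_) eq) (+-identityʳ x))

    -- Comparing the products of all nonzero x y and of all nonzero y.
    x^n≡x : ∀ x → x ^ n ≡ x
    x^n≡x x with x ≟ 0#
    ... | yes refl = 0^m≡0 (ℕₚ.≤-<-trans z≤n (Fₚ.toℕ<n 0#))
    ... | no x≢0   = begin
      x ^ n                              ≡⟨ Π*.sum-replicate n ⟨
      Π*.sum {n} (λ _ → x)               ≡⟨ Π*.sum-cong-≗ c*d ⟨
      Π*.sum (λ y → c y * d y)           ≡⟨ Π*.∑-distrib-+ c d ⟩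
      Π*.sum c * Π*.sum d                ≡⟨ cong₂ _*_ Πc≡1 Πd≡x ⟩
      1# * x                             ≡⟨ *-identityˡ x ⟩
      x                                  ∎
      where
      -- `h` replaces 0 by 1, so its product is that of the nonzero elements. `c` is the factor by
      -- which y ↦ xy changes `h`, and `d` supplies the single factor x that `c` omits at y = 0.
      h c d : Fin n → Fin n
      h y with y ≟ 0#
      ... | yes _ = 1#
      ... | no  _ = y
      c y with y ≟ 0#
      ... | yes _ = 1#
      ... | no  _ = x
      d y with y ≟ 0#
      ... | yes _ = x
      ... | no  _ = 1#
      c*d : ∀ y → c y * d y ≡ x
      c*d y with y ≟ 0#
      ... | yes _ = *-identityˡ x
      ... | no  _ = *-identityʳ x
      hx : ∀ y → h (x * y) ≡ c y * h y
      hx y with y ≟ 0# | x * y ≟ 0#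
      ... | yes _    | yes _    = sym (*-identityˡ 1#)
      ... | no  _    | no  _    = refl
      ... | yes refl | no xy≢0  = contradiction (zeroʳ x) xy≢0
      ... | no  y≢0  | yes xy≡0 = contradiction xy≡0 (x*y≢0 x≢0 y≢0)
      h≢0 : ∀ y → h y ≢ 0#
      h≢0 y with y ≟ 0#
      ... | yes _  = 1≢0
      ... | no y≢0 = y≢0
      Π≢0 : ∀ {m} (f : Fin m → Fin n) → (∀ i → f i ≢ 0#) → Π*.sum f ≢ 0#
      Π≢0 {zero}  f f≢0 = 1≢0
      Π≢0 {suc m} f f≢0 = x*y≢0 (f≢0 zero) (Π≢0 (f ∘ suc) (f≢0 ∘ suc))
      Πc≡1 : Π*.sum c ≡ 1#
      Πc≡1 = *-cancelˡ (Π≢0 h h≢0) (begin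
        Π*.sum h * Π*.sum c            ≡⟨ *-comm (Π*.sum h) (Π*.sum c) ⟩
        Π*.sum c * Π*.sum h            ≡⟨ Π*.∑-distrib-+ c h ⟨
        Π*.sum (λ y → c y * h y)       ≡⟨ Π*.sum-cong-≗ hx ⟨
        Π*.sum (λ y → h (x * y))       ≡⟨ Π*.sum-permute h (permutation (x *_) (x ⁻¹ *_) (cancel-⁻¹ʳ x≢0) (cancel-⁻¹ˡ x≢0)) ⟨
        Π*.sum h                       ≡⟨ *-identityʳ (Π*.sum h) ⟨
        Π*.sum h * 1#                  ∎)
      Πd≡x : Π*.sum d ≡ x
      Πd≡x = trans (sum-single *-commutativeMonoid 0# d off) at
        where
        off : ∀ y → y ≢ 0# → d y ≡ 1#
        off y y≢0 with y ≟ 0#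
        ... | yes y≡0 = contradiction y≡0 y≢0
        ... | no  _   = refl
        at : d 0# ≡ x
        at with 0# ≟ 0#
        ... | yes _  = refl
        ... | no 0≢0 = contradiction refl 0≢0

    private
      [p^e]×1 : ∀ p e → (p ℕ.^ e) · 1# ≡ (p · 1#) ^ e
      [p^e]×1 p zero    = +-identityʳ 1#
      [p^e]×1 p (suc e) = trans (×1-homo-* p (p ℕ.^ e)) (cong ((p · 1#) *_) ([p^e]×1 p e))

    module _ {p e} (pr : Prime p) (n≡p^e : n ≡ p ℕ.^ e) where

      characteristic : ∀ x → p · x ≡ 0#
      characteristic x = begin
        p · x            ≡⟨ cong (p ·_) (*-identityˡ x) ⟨
        p · (1# * x)     ≡⟨ ×-assoc-* p 1# x ⟨
        p · 1# * x       ≡⟨ cong (_* x) (x^m≡0⇒x≡0 e (trans (sym ([p^e]×1 p e)) (trans (cong (_· 1#) (sym n≡p^e)) order×1≡0))) ⟩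
        0# * x           ≡⟨ zeroˡ x ⟩
        0#               ∎

      multiple-vanishes : ∀ {m} → p ℕ∣.∣ m → ∀ x → m · x ≡ 0#
      multiple-vanishes (ℕ∣.divides k refl) x = trans (sym (×-assocˡ x k p))
        (trans (cong (k ·_) (characteristic x)) (trans (sym (Σ+.sum-replicate k)) (Σ+.sum-replicate-zero k)))

      frobenius₁ : ∀ x y → (x + y) ^ p ≡ x ^ p + y ^ p
      frobenius₁ x y = expand p refl
        where
        open import Algebra.Properties.CommutativeSemiring.Binomial commutativeSemiring using (theorem)
        open import Algebra.Properties.Semiring.Binomial semiring x y using (binomialTerm)
        expand : ∀ r → r ≡ p → (x + y) ^ r ≡ x ^ r + y ^ r
        expand zero 0≡p = contradiction (subst Prime (sym 0≡p) pr) ¬prime[0]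
        expand (suc r) refl = begin
          (x + y) ^ suc r                       ≡⟨ theorem (suc r) x y ⟩
          t zero + Σ+.sum (t ∘ suc)             ≡⟨ cong₂ _+_ first (sum-single +-commutativeMonoid (F.fromℕ r) (t ∘ suc) middle) ⟩
          y ^ suc r + t (suc (F.fromℕ r))       ≡⟨ cong (y ^ suc r +_) last ⟩
          y ^ suc r + x ^ suc r                 ≡⟨ +-comm (y ^ suc r) (x ^ suc r) ⟩
          x ^ suc r + y ^ suc r                 ∎
          where
          t : Fin (suc (suc r)) → Fin n
          t = binomialTerm (suc r)
          first : t zero ≡ y ^ suc r
          first = trans (+-identityʳ (1# * y ^ suc r)) (*-identityˡ (y ^ suc r))
          middle : ∀ j → j ≢ F.fromℕ r → t (suc j) ≡ 0#
          middle j j≢r = multiple-vanishes (prime∣binomial pr (s≤s z≤n) (s≤s j<r)) (x ^ suc (F.toℕ j) * y ^ (suc r ℕ.∸ suc (F.toℕ j)))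
            where
            j<r : F.toℕ j < r
            j<r = ℕₚ.≤∧≢⇒< (ℕₚ.≤-pred (Fₚ.toℕ<n j)) (λ eq → j≢r (Fₚ.toℕ-injective (trans eq (sym (Fₚ.toℕ-fromℕ r)))))
          last : t (suc (F.fromℕ r)) ≡ x ^ suc r
          last = subst (λ k → (suc r C suc k) · (x ^ suc k * y ^ (r ℕ.∸ k)) ≡ x ^ suc r) (sym (Fₚ.toℕ-fromℕ r)) (begin
            (suc r C suc r) · (x ^ suc r * y ^ (r ℕ.∸ r))   ≡⟨ cong₂ (λ a b → a · (x ^ suc r * y ^ b)) (nCn≡1 (suc r)) (ℕₚ.n∸n≡0 r) ⟩
            x ^ suc r * 1# + 0#                             ≡⟨ +-identityʳ (x ^ suc r * 1#) ⟩
            x ^ suc r * 1#                                  ≡⟨ *-identityʳ (x ^ suc r) ⟩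
            x ^ suc r                                       ∎)

      frobenius : ∀ j x y → (x + y) ^ (p ℕ.^ j) ≡ x ^ (p ℕ.^ j) + y ^ (p ℕ.^ j)
      frobenius zero    x y = trans (*-identityʳ (x + y)) (sym (cong₂ _+_ (*-identityʳ x) (*-identityʳ y)))
      frobenius (suc j) x y = begin
        (x + y) ^ (p ℕ.* p ℕ.^ j)                     ≡⟨ ^-assocʳ (x + y) p (p ℕ.^ j) ⟨
        ((x + y) ^ p) ^ (p ℕ.^ j)                     ≡⟨ cong (_^ (p ℕ.^ j)) (frobenius₁ x y) ⟩
        (x ^ p + y ^ p) ^ (p ℕ.^ j)                   ≡⟨ frobenius j (x ^ p) (y ^ p) ⟩
        (x ^ p) ^ (p ℕ.^ j) + (y ^ p) ^ (p ℕ.^ j)     ≡⟨ cong₂ _+_ (^-assocʳ x p (p ℕ.^ j)) (^-assocʳ y p (p ℕ.^ j)) ⟩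
        x ^ (p ℕ.* p ℕ.^ j) + y ^ (p ℕ.* p ℕ.^ j)     ∎

    -- Polynomial functions in Horner form: degree at most d, with coefficient b at x^d.
    data Polynomial (b : Fin n) : ℕ → (Fin n → Fin n) → Set where
      constant : ∀ {f} → (∀ x → f x ≡ b) → Polynomial b 0 f
      horner   : ∀ {d f g} c → Polynomial b d g → (∀ x → f x ≡ x * g x + c) → Polynomial b (suc d) f

    Polynomial-cong : ∀ {b d f g} → (∀ x → g x ≡ f x) → Polynomial b d f → Polynomial b d g
    Polynomial-cong g≗f (constant eq)   = constant λ x → trans (g≗f x) (eq x)
    Polynomial-cong g≗f (horner c P eq) = horner c P λ x → trans (g≗f x) (eq x)

    Polynomial-+ : ∀ {b b′ d f g} → Polynomial b d f → Polynomial b′ d g → Polynomial (b + b′) d (λ x → f x + g x)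
    Polynomial-+ (constant eq)   (constant eq′)    = constant λ x → cong₂ _+_ (eq x) (eq′ x)
    Polynomial-+ (horner {g = g} c P eq) (horner {g = g′} c′ P′ eq′) = horner (c + c′) (Polynomial-+ P P′) λ x →
      trans (cong₂ _+_ (eq x) (eq′ x)) (regroup x (g x) (g′ x) c c′)
      where
      regroup : ∀ x g g′ c c′ → x * g + c + (x * g′ + c′) ≡ x * (g + g′) + (c + c′)
      regroup = solve 5 (λ x g g′ c c′ → x :* g :+ c :+ (x :* g′ :+ c′) := x :* (g :+ g′) :+ (c :+ c′)) refl

    -- The degree is formal, with top coefficient 0 allowed. Raising a summand of lower degree makes
    -- `Polynomial-+` applicable and leaves the leading coefficient of the other summand unchanged
    -- up to adding 0.
    Polynomial-raise : ∀ {b d f} → Polynomial b d f → Polynomial 0# (suc d) f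
    Polynomial-raise {b} (constant eq) = horner b (constant λ _ → refl) λ x →
      trans (eq x) (sym (trans (cong (_+ b) (zeroʳ x)) (+-identityˡ b)))
    Polynomial-raise (horner c P eq) = horner c (Polynomial-raise P) eq

    Polynomial-weaken : ∀ {b d d′ f} → d < d′ → Polynomial b d f → Polynomial 0# d′ f
    Polynomial-weaken {d′ = suc d′} (s≤s d≤d′) P = go (ℕₚ.≤⇒≤′ d≤d′) P
      where
      go : ∀ {b d d′ f} → d ℕ.≤′ d′ → Polynomial b d f → Polynomial 0# (suc d′) f
      go ℕ.≤′-refl        P = Polynomial-raise P
      go (ℕ.≤′-step d≤d′) P = Polynomial-raise (go d≤d′ P)

    Polynomial-monomial : ∀ b d → Polynomial b d (λ x → b * x ^ d)
    Polynomial-monomial b zero    = constant λ x → *-identityʳ b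
    Polynomial-monomial b (suc d) = horner 0# (Polynomial-monomial b d) λ x →
      trans (regroup b x (x ^ d)) (sym (+-identityʳ (x * (b * x ^ d))))
      where
      regroup : ∀ b x y → b * (x * y) ≡ x * (b * y)
      regroup = solve 3 (λ b x y → b :* (x :* y) := x :* (b :* y)) refl

    x≡[x-a]+a : ∀ x a → x ≡ x - a + a
    x≡[x-a]+a x a = sym (trans (+-assoc x (- a) a) (trans (cong (x +_) (-‿inverseˡ a)) (+-identityʳ x)))

    divide-by-root : ∀ {b d f} → Polynomial b (suc d) f → ∀ a → ∃ λ g → Polynomial b d g × (∀ x → f x ≡ (x - a) * g x + f a)
    divide-by-root {b} {zero} {f} (horner {g = g} c (constant eqg) eq) a = g , constant eqg , λ x → begin
      f x                            ≡⟨ eq x ⟩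
      x * g x + c                    ≡⟨ cong (λ t → t * g x + c) (x≡[x-a]+a x a) ⟩
      (x - a + a) * g x + c          ≡⟨ regroup (x - a) a (g x) c ⟩
      (x - a) * g x + (a * g x + c)  ≡⟨ cong (λ t → (x - a) * g x + (a * t + c)) (trans (eqg x) (sym (eqg a))) ⟩
      (x - a) * g x + (a * g a + c)  ≡⟨ cong ((x - a) * g x +_) (eq a) ⟨
      (x - a) * g x + f a            ∎
      where
      regroup : ∀ u a g c → (u + a) * g + c ≡ u * g + (a * g + c)
      regroup = solve 4 (λ u a g c → (u :+ a) :* g :+ c := u :* g :+ (a :* g :+ c)) refl
    divide-by-root {b} {suc d} {f} (horner {g = g} c P eq) a =
      let h , Ph , eqh = divide-by-root P a in
      (λ x → x * h x + g a) , horner (g a) Ph (λ x → refl) , λ x → begin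
      f x                                                 ≡⟨ eq x ⟩
      x * g x + c                                         ≡⟨ cong (λ t → x * t + c) (eqh x) ⟩
      x * ((x - a) * h x + g a) + c                       ≡⟨ split x (x - a) (h x) (g a) c ⟩
      x * ((x - a) * h x) + (x * g a + c)                 ≡⟨ cong (λ t → x * ((x - a) * h x) + (t * g a + c)) (x≡[x-a]+a x a) ⟩
      x * ((x - a) * h x) + ((x - a + a) * g a + c)       ≡⟨ regroup x (x - a) a (h x) (g a) c ⟩
      (x - a) * (x * h x + g a) + (a * g a + c)           ≡⟨ cong ((x - a) * (x * h x + g a) +_) (eq a) ⟨
      (x - a) * (x * h x + g a) + f a                     ∎
      where
      split : ∀ x u h g c → x * (u * h + g) + c ≡ x * (u * h) + (x * g + c)
      split = solve 5 (λ x u h g c → x :* (u :* h :+ g) :+ c := x :* (u :* h) :+ (x :* g :+ c)) refl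
      regroup : ∀ x u a h g c → x * (u * h) + ((u + a) * g + c) ≡ u * (x * h + g) + (a * g + c)
      regroup = solve 6 (λ x u a h g c → x :* (u :* h) :+ ((u :+ a) :* g :+ c) := u :* (x :* h :+ g) :+ (a :* g :+ c)) refl

    roots≤degree : ∀ {b d f} → b ≢ 0# → Polynomial b d f → sum (λ x → 𝟙 (f x ≟ 0#)) ≤ d
    roots≤degree {f = f} b≢0 (constant eq) =
      ℕₚ.≤-reflexive (sum-zero {f = λ x → 𝟙 (f x ≟ 0#)} λ x → 𝟙-no (f x ≟ 0#) (λ fx≡0 → b≢0 (trans (sym (eq x)) fx≡0)))
    roots≤degree {b} {suc d} {f} b≢0 P@(horner _ _ _) with Fₚ.any? (λ x → f x ≟ 0#)
    ... | no ¬root = ℕₚ.≤-trans (ℕₚ.≤-reflexive (sum-zero {f = λ x → 𝟙 (f x ≟ 0#)} λ x → 𝟙-no (f x ≟ 0#) (λ fx≡0 → ¬root (x , fx≡0)))) z≤n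
    ... | yes (a , fa≡0) = split (divide-by-root P a)
      where
      split : (∃ λ g → Polynomial b d g × (∀ x → f x ≡ (x - a) * g x + f a)) → sum (λ x → 𝟙 (f x ≟ 0#)) ≤ suc d
      split (g , Pg , eq) = ℕₚ.≤-trans (sum-mono one-factor)
        (ℕₚ.≤-trans (ℕₚ.≤-reflexive (∑-distrib-+ (λ x → 𝟙 (a ≟ x)) (λ x → 𝟙 (g x ≟ 0#))))
          (ℕₚ.+-mono-≤ (ℕₚ.≤-reflexive (sum-pick-one a)) (roots≤degree b≢0 Pg)))
        where
        one-factor : ∀ x → 𝟙 (f x ≟ 0#) ≤ 𝟙 (a ≟ x) ℕ.+ 𝟙 (g x ≟ 0#)
        one-factor x with f x ≟ 0# | a ≟ x | g x ≟ 0#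
        ... | no _     | _       | _      = z≤n
        ... | yes _    | yes _   | _      = s≤s z≤n
        ... | yes _    | no _    | yes _  = s≤s z≤n
        ... | yes fx≡0 | no a≢x  | no gx≢0 = contradiction
              (trans (sym (trans (eq x) (trans (cong ((x - a) * g x +_) fa≡0) (+-identityʳ _)))) fx≡0)
              (x*y≢0 (λ x-a≡0 → a≢x (sym (x-y≡0⇒x≡y x a x-a≡0))) gx≢0)

  IsAdditivePower : ∀ {n} → FieldOn n → ℕ → Set
  IsAdditivePower 𝔽 q = ∀ x y → (x + y) ^ q ≡ x ^ q + y ^ q
    where open FieldTheory 𝔽

-- The alternating trace, K-th powers, and the moments of the distribution of Λ(a u^K).

module HermitianSums where

  open Counting
  open FiniteFields
  open import Data.Nat as ℕ using (ℕ; zero; suc; _≤_; _<_; z≤n; s≤s)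
  import Data.Nat.Properties as ℕₚ
  import Data.Nat.Tactic.RingSolver as ℕ-Solver
  open import Data.Fin as F using (Fin; zero; suc)
  import Data.Fin.Properties as Fₚ
  open import Data.Product using (∃; _×_; _,_; proj₁; proj₂)
  open import Relation.Nullary using (Dec; yes; no; ¬_; contradiction)
  open import Relation.Nullary.Decidable using (_×-dec_; ¬?; decidable-stable)
  open import Relation.Binary.PropositionalEquality
  open ≡-Reasoning

  -- Here L = 1 + L′ and s = 1 + s′. The successors make n = L · w₀ and the vanishing of 0^L and 0^K
  -- matters of computation, and L′ itself counts the nonzero elements fixed by x ↦ x^L. The number
  -- w₀ = n / L becomes the order of the kernel of Λ.
  module Hermitian {n : ℕ} (𝔽 : FieldOn n) (L′ s′ : ℕ) (0<L′ : 0 < L′)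
    (n≡ : n ≡ suc L′ ℕ.^ (suc s′ ℕ.+ suc s′))
    (frob-+ : IsAdditivePower 𝔽 (suc L′)) where

    open FieldTheory 𝔽

    L K s t t′ w₀ : ℕ
    L = suc L′
    K = suc L
    s = suc s′
    t = s ℕ.+ s
    t′ = s′ ℕ.+ s
    w₀ = L ℕ.^ t′

    n≡L*w₀ : n ≡ L ℕ.* w₀
    n≡L*w₀ = n≡

    0^L≡0 : 0# ^ L ≡ 0#
    0^L≡0 = zeroˡ (0# ^ L′)

    0^K≡0 : 0# ^ K ≡ 0#
    0^K≡0 = zeroˡ (0# ^ L)

    frob-neg : ∀ x → (- x) ^ L ≡ - (x ^ L)
    frob-neg x = neg-unique (x ^ L) ((- x) ^ L)
      (trans (sym (frob-+ x (- x))) (trans (cong (_^ L) (-‿inverseʳ x)) 0^L≡0))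

    -x*-y≡x*y : ∀ x y → - x * - y ≡ x * y
    -x*-y≡x*y x y = trans (sym (-‿distribˡ-* x (- y))) (trans (cong -_ (sym (-‿distribʳ-* x y))) (neg-involutive (x * y)))

    σ : ℕ → Fin n
    σ i = (- 1#) ^ i

    σ-suc : ∀ i → σ (suc i) ≡ - σ i
    σ-suc i = trans (sym (-‿distribˡ-* 1# (σ i))) (cong -_ (*-identityˡ (σ i)))

    σ-double : ∀ i → σ (i ℕ.+ i) ≡ 1#
    σ-double i = trans (^-homo-* (- 1#) i i) (trans (sym (^-distrib-* (- 1#) (- 1#) i))
      (trans (cong (_^ i) (trans (-x*-y≡x*y 1# 1#) (*-identityˡ 1#))) (1^m≡1 i)))

    σ-frob : ∀ i → σ i ^ L ≡ σ i
    σ-frob zero    = 1^m≡1 L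
    σ-frob (suc i) = trans (cong (_^ L) (σ-suc i)) (trans (frob-neg (σ i)) (trans (cong -_ (σ-frob i)) (sym (σ-suc i))))

    σ≢0 : ∀ i → σ i ≢ 0#
    σ≢0 i = x^m≢0 i λ -1≡0 → 1≢0 (trans (sym (neg-involutive 1#)) (trans (cong -_ -1≡0) -0≡0))

    iter : ℕ → Fin n → Fin n
    iter i x = x ^ (L ℕ.^ i)

    iter-suc : ∀ i x → iter (suc i) x ≡ iter i (x ^ L)
    iter-suc i x = sym (^-assocʳ x L (L ℕ.^ i))

    iter-frob : ∀ i x → iter i (x ^ L) ≡ iter i x ^ L
    iter-frob i x = trans (^-assocʳ x L (L ℕ.^ i))
      (trans (cong (x ^_) (ℕₚ.*-comm L (L ℕ.^ i))) (sym (^-assocʳ x (L ℕ.^ i) L)))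

    iter-+ : ∀ i x y → iter i (x + y) ≡ iter i x + iter i y
    iter-+ zero    x y = trans (*-identityʳ (x + y)) (sym (cong₂ _+_ (*-identityʳ x) (*-identityʳ y)))
    iter-+ (suc i) x y = begin
      iter (suc i) (x + y)             ≡⟨ iter-suc i (x + y) ⟩
      iter i ((x + y) ^ L)             ≡⟨ cong (iter i) (frob-+ x y) ⟩
      iter i (x ^ L + y ^ L)           ≡⟨ iter-+ i (x ^ L) (y ^ L) ⟩
      iter i (x ^ L) + iter i (y ^ L)  ≡⟨ cong₂ _+_ (iter-suc i x) (iter-suc i y) ⟨
      iter (suc i) x + iter (suc i) y  ∎

    iter-fixed : ∀ i {f} → f ^ L ≡ f → iter i f ≡ f
    iter-fixed zero    {f} fL≡f = *-identityʳ f
    iter-fixed (suc i) {f} fL≡f = trans (iter-suc i f) (trans (cong (iter i) fL≡f) (iter-fixed i fL≡f))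

    iter-t : ∀ x → iter t x ≡ x
    iter-t x = trans (cong (x ^_) (sym n≡)) (x^n≡x x)

    -- Λ v = v - v^L + v^(L²) - ⋯ ; counting shows that its kernel is the image of tr and its image the kernel of tr.
    altTrace : ℕ → Fin n → Fin n
    altTrace zero    v = 0#
    altTrace (suc i) v = altTrace i v + σ i * iter i v

    Λ : Fin n → Fin n
    Λ = altTrace t

    altTrace-+ : ∀ i v w → altTrace i (v + w) ≡ altTrace i v + altTrace i w
    altTrace-+ zero    v w = sym (+-identityˡ 0#)
    altTrace-+ (suc i) v w = trans
      (cong₂ (λ a b → a + σ i * b) (altTrace-+ i v w) (iter-+ i v w))
      (solve 5 (λ a b c d e → a :+ b :+ c :* (d :+ e) := a :+ c :* d :+ (b :+ c :* e)) refl
        (altTrace i v) (altTrace i w) (σ i) (iter i v) (iter i w))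

    altTrace-scale : ∀ i {f} → f ^ L ≡ f → ∀ v → altTrace i (f * v) ≡ f * altTrace i v
    altTrace-scale zero    {f} fL≡f v = sym (zeroʳ f)
    altTrace-scale (suc i) {f} fL≡f v = trans
      (cong₂ (λ a b → a + σ i * b) (altTrace-scale i fL≡f v)
        (trans (^-distrib-* f v (L ℕ.^ i)) (cong (_* iter i v) (iter-fixed i fL≡f))))
      (solve 4 (λ f a c d → f :* a :+ c :* (f :* d) := f :* (a :+ c :* d)) refl f (altTrace i v) (σ i) (iter i v))

    altTrace-frob : ∀ i v → altTrace i (v ^ L) ≡ altTrace i v ^ L
    altTrace-frob zero    v = sym 0^L≡0
    altTrace-frob (suc i) v = sym (trans (frob-+ (altTrace i v) (σ i * iter i v))
      (cong₂ _+_ (sym (altTrace-frob i v))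
        (trans (^-distrib-* (σ i) (iter i v) L) (cong₂ _*_ (σ-frob i) (sym (iter-frob i v))))))

    -- The power L is additive and shifts the summands by one place without changing their signs, so
    -- each meets its negative and only the first term survives.
    altTrace-telescope : ∀ i v → altTrace (suc i) v + altTrace i v ^ L ≡ v
    altTrace-telescope zero v = begin
      0# + 1# * (v * 1#) + 0# ^ L  ≡⟨ cong (0# + 1# * (v * 1#) +_) 0^L≡0 ⟩
      0# + 1# * (v * 1#) + 0#      ≡⟨ +-identityʳ _ ⟩
      0# + 1# * (v * 1#)           ≡⟨ +-identityˡ _ ⟩
      1# * (v * 1#)                ≡⟨ *-identityˡ _ ⟩
      v * 1#                       ≡⟨ *-identityʳ v ⟩
      v                            ∎
    altTrace-telescope (suc i) v = begin
      A + σ (suc i) * x + (altTrace i v + σ i * iter i v) ^ L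
        ≡⟨ cong (A + σ (suc i) * x +_) (trans (frob-+ (altTrace i v) (σ i * iter i v))
             (cong (altTrace i v ^ L +_) (trans (^-distrib-* (σ i) (iter i v) L)
               (cong₂ _*_ (σ-frob i) (trans (sym (iter-frob i v)) (sym (iter-suc i v))))))) ⟩
      A + σ (suc i) * x + (altTrace i v ^ L + σ i * x)
        ≡⟨ solve 5 (λ a b c d x → a :+ b :* x :+ (c :+ d :* x) := a :+ c :+ (b :+ d) :* x) refl A (σ (suc i)) (altTrace i v ^ L) (σ i) x ⟩
      A + altTrace i v ^ L + (σ (suc i) + σ i) * x
        ≡⟨ cong₂ (λ a b → a + b * x) (altTrace-telescope i v) (trans (cong (_+ σ i) (σ-suc i)) (-‿inverseˡ (σ i))) ⟩
      v + 0# * x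
        ≡⟨ trans (cong (v +_) (zeroˡ x)) (+-identityʳ v) ⟩
      v ∎
      where
      A x : Fin n
      A = altTrace (suc i) v
      x = iter (suc i) v

    altTrace-1 : ∀ i → altTrace (i ℕ.+ i) 1# ≡ 0#
    altTrace-1 zero    = refl
    altTrace-1 (suc i) = subst (λ j → altTrace (suc j) 1# ≡ 0#) (sym (ℕₚ.+-suc i i)) (begin
      altTrace (i ℕ.+ i) 1# + σ (i ℕ.+ i) * iter (i ℕ.+ i) 1# + σ (suc (i ℕ.+ i)) * iter (suc (i ℕ.+ i)) 1#
        ≡⟨ cong₂ (λ a b → altTrace (i ℕ.+ i) 1# + σ (i ℕ.+ i) * a + σ (suc (i ℕ.+ i)) * b) (1^m≡1 (L ℕ.^ (i ℕ.+ i))) (1^m≡1 (L ℕ.^ suc (i ℕ.+ i))) ⟩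
      altTrace (i ℕ.+ i) 1# + σ (i ℕ.+ i) * 1# + σ (suc (i ℕ.+ i)) * 1#
        ≡⟨ cong₂ _+_ (cong₂ _+_ (altTrace-1 i) (*-identityʳ (σ (i ℕ.+ i)))) (trans (*-identityʳ (σ (suc (i ℕ.+ i)))) (σ-suc (i ℕ.+ i))) ⟩
      0# + σ (i ℕ.+ i) + - σ (i ℕ.+ i)
        ≡⟨ cong (_+ - σ (i ℕ.+ i)) (+-identityˡ (σ (i ℕ.+ i))) ⟩
      σ (i ℕ.+ i) + - σ (i ℕ.+ i)
        ≡⟨ -‿inverseʳ (σ (i ℕ.+ i)) ⟩
      0# ∎)

    tr : Fin n → Fin n
    tr w = w + w ^ L

    tr-+ : ∀ v w → tr (v + w) ≡ tr v + tr w
    tr-+ v w = trans (cong (v + w +_) (frob-+ v w))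
      (solve 4 (λ a b c d → a :+ b :+ (c :+ d) := a :+ c :+ (b :+ d)) refl v w (v ^ L) (w ^ L))

    -- At i = t the telescope contains the extra summand σ(t) v^(L^t). It equals v, because t = 2s
    -- is even and v^n = v, and cancels against the right-hand side.
    tr-Λ : ∀ v → tr (Λ v) ≡ 0#
    tr-Λ v = +-cancelˡ v (begin
      v + (Λ v + Λ v ^ L)    ≡⟨ solve 3 (λ a b c → a :+ (b :+ c) := b :+ a :+ c) refl v (Λ v) (Λ v ^ L) ⟩
      Λ v + v + Λ v ^ L      ≡⟨ cong (λ a → Λ v + a + Λ v ^ L) (trans (sym (*-identityˡ v)) (cong₂ _*_ (sym (σ-double s)) (sym (iter-t v)))) ⟩
      Λ v + σ t * iter t v + Λ v ^ L  ≡⟨ altTrace-telescope t v ⟩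
      v                      ≡⟨ +-identityʳ v ⟨
      v + 0#                 ∎)

    Λ-+ : ∀ v w → Λ (v + w) ≡ Λ v + Λ w
    Λ-+ = altTrace-+ t

    Λ-scale : ∀ {f} → f ^ L ≡ f → ∀ v → Λ (f * v) ≡ f * Λ v
    Λ-scale = altTrace-scale t

    Λ-tr : ∀ w → Λ (tr w) ≡ 0#
    Λ-tr w = trans (Λ-+ w (w ^ L)) (trans (cong (Λ w +_) (altTrace-frob t w)) (tr-Λ w))

    Λ-1 : Λ 1# ≡ 0#
    Λ-1 = altTrace-1 s

    additive-0 : ∀ (ψ : Fin n → Fin n) → (∀ x y → ψ (x + y) ≡ ψ x + ψ y) → ψ 0# ≡ 0#
    additive-0 ψ ψ-+ = +-cancelˡ (ψ 0#) (trans (sym (ψ-+ 0# 0#)) (trans (cong ψ (+-identityˡ 0#)) (sym (+-identityʳ (ψ 0#)))))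

    Λ-0 : Λ 0# ≡ 0#
    Λ-0 = additive-0 Λ Λ-+

    additive-fiber : ∀ (ψ : Fin n → Fin n) → (∀ x y → ψ (x + y) ≡ ψ x + ψ y) → ∀ a → fiber ψ (ψ a) ≡ fiber ψ 0#
    additive-fiber ψ ψ-+ a = trans (sum-translate a (λ x → 𝟙 (ψ x ≟ ψ a)))
      (sum-cong-≗ λ x → 𝟙-cong (ψ (a + x) ≟ ψ a) (ψ x ≟ 0#)
        (λ eq → +-cancelˡ (ψ a) (trans (sym (ψ-+ a x)) (trans eq (sym (+-identityʳ (ψ a))))))
        (λ eq → trans (ψ-+ a x) (trans (cong (ψ a +_) eq) (+-identityʳ (ψ a)))))

    additive-image : ∀ (ψ : Fin n → Fin n) → (∀ x y → ψ (x + y) ≡ ψ x + ψ y) →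
      fiber ψ 0# ℕ.* sum (λ y → 𝟙 (image? ψ y)) ≡ n
    additive-image ψ ψ-+ = trans (*-distribˡ-sum (fiber ψ 0#) (λ y → 𝟙 (image? ψ y)))
      (trans (sum-cong-≗ λ y → sym (fiber-image ψ (fiber ψ 0#) (additive-fiber ψ ψ-+) y)) (fiber-total ψ))

    1<L : 1 < L
    1<L = s≤s 0<L′

    1≤L^ : ∀ i → 1 ≤ L ℕ.^ i
    1≤L^ i = ℕ.>-nonZero⁻¹ (L ℕ.^ i) {{ℕₚ.m^n≢0 L i}}

    kernel-tr≤ : fiber tr 0# ≤ L
    kernel-tr≤ = roots≤degree (λ 0+1≡0 → 1≢0 (trans (sym (+-identityˡ 1#)) 0+1≡0))
      (Polynomial-cong (λ x → cong₂ _+_ (trans (sym (*-identityʳ x)) (sym (*-identityˡ (x * 1#)))) (sym (*-identityˡ (x ^ L))))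
        (Polynomial-+ (Polynomial-weaken 1<L (Polynomial-monomial 1# 1)) (Polynomial-monomial 1# L)))

    altTrace-Polynomial : ∀ i d → (∀ j → j < i → L ℕ.^ j < d) → 0 < d → Polynomial 0# d (altTrace i)
    altTrace-Polynomial zero    d bound 0<d = Polynomial-weaken 0<d (constant λ x → refl)
    altTrace-Polynomial (suc i) d bound 0<d = subst (λ b → Polynomial b d (altTrace (suc i))) (+-identityˡ 0#)
      (Polynomial-+ (altTrace-Polynomial i d (λ j j<i → bound j (ℕₚ.m<n⇒m<1+n j<i)) 0<d)
        (Polynomial-weaken (bound i (ℕₚ.n<1+n i)) (Polynomial-monomial (σ i) (L ℕ.^ i))))

    kernel-Λ≤ : fiber Λ 0# ≤ w₀
    kernel-Λ≤ = roots≤degree (λ 0+σ≡0 → σ≢0 t′ (trans (sym (+-identityˡ (σ t′))) 0+σ≡0))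
      (Polynomial-+ (altTrace-Polynomial t′ w₀ (λ j j<t′ → ℕₚ.^-monoʳ-< L 1<L j<t′) (1≤L^ t′))
        (Polynomial-monomial (σ t′) w₀))

    image-tr≤kernel-Λ : ∀ y → 𝟙 (image? tr y) ≤ 𝟙 (Λ y ≟ 0#)
    image-tr≤kernel-Λ y = 𝟙-mono (image? tr y) (Λ y ≟ 0#) λ { (w , refl) → Λ-tr w }

    private
      -- The kernel has at most L elements, as the roots of x + x^L, and the image has at most w₀,
      -- as part of the kernel of Λ. Their product is n = L w₀, so both bounds are attained.
      tr-tight : fiber tr 0# ≡ L × sum (λ y → 𝟙 (image? tr y)) ≡ w₀
      tr-tight = product-tight (trans (additive-image tr tr-+) n≡L*w₀) kernel-tr≤
        (ℕₚ.≤-trans (sum-mono image-tr≤kernel-Λ) kernel-Λ≤) (s≤s z≤n) (1≤L^ t′)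

    kernel-tr : fiber tr 0# ≡ L
    kernel-tr = proj₁ tr-tight

    kernel-Λ : fiber Λ 0# ≡ w₀
    kernel-Λ = ℕₚ.≤-antisym kernel-Λ≤ (ℕₚ.≤-trans (ℕₚ.≤-reflexive (sym (proj₂ tr-tight))) (sum-mono image-tr≤kernel-Λ))

    fiber-tr : ∀ y → fiber tr y ≡ L ℕ.* 𝟙 (Λ y ≟ 0#)
    fiber-tr y = trans (fiber-image tr L (λ x → trans (additive-fiber tr tr-+ x) kernel-tr) y)
      (cong (L ℕ.*_) (sum-mono-tight image-tr≤kernel-Λ (ℕₚ.≤-trans kernel-Λ≤ (ℕₚ.≤-reflexive (sym (proj₂ tr-tight)))) y))

    image-Λ≤kernel-tr : ∀ y → 𝟙 (image? Λ y) ≤ 𝟙 (tr y ≟ 0#)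
    image-Λ≤kernel-tr y = 𝟙-mono (image? Λ y) (tr y ≟ 0#) λ { (v , refl) → tr-Λ v }

    image-Λ : ∀ y → 𝟙 (image? Λ y) ≡ 𝟙 (tr y ≟ 0#)
    image-Λ = sum-mono-tight image-Λ≤kernel-tr (ℕₚ.≤-reflexive (trans kernel-tr (sym size)))
      where
      size : sum (λ y → 𝟙 (image? Λ y)) ≡ L
      size = ℕₚ.*-cancelˡ-≡ _ L w₀ {{ℕₚ.m^n≢0 L t′}}
        (trans (cong (ℕ._* sum (λ y → 𝟙 (image? Λ y))) (sym kernel-Λ))
          (trans (additive-image Λ Λ-+) (trans n≡L*w₀ (ℕₚ.*-comm L w₀))))

    -- The nonzero elements of the kernel of `tr` are the nonzero values of Λ. By `ratio` they form
    -- a single orbit under multiplication by the nonzero fixed elements of x ↦ x^L, so one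
    -- representative `v₁` is enough.
    isV*? : ∀ v → Dec (v ≢ 0# × tr v ≡ 0#)
    isV*? v = ¬? (v ≟ 0#) ×-dec (tr v ≟ 0#)

    tr-0 : tr 0# ≡ 0#
    tr-0 = additive-0 tr tr-+

    kernel-tr-split : ∀ v → 𝟙 (tr v ≟ 0#) ≡ 𝟙 (0# ≟ v) ℕ.+ 𝟙 (isV*? v)
    kernel-tr-split v = by-cases (0# ≟ v)
      where
      by-cases : Dec (0# ≡ v) → _
      by-cases (yes 0≡v) = trans (𝟙-yes (tr v ≟ 0#) (trans (cong tr (sym 0≡v)) tr-0))
        (sym (cong₂ ℕ._+_ (𝟙-yes (0# ≟ v) 0≡v) (𝟙-no (isV*? v) (λ h → proj₁ h (sym 0≡v)))))
      by-cases (no 0≢v) = trans (𝟙-cong (tr v ≟ 0#) (isV*? v) (λ h → (λ v≡0 → 0≢v (sym v≡0)) , h) proj₂)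
        (cong (ℕ._+ 𝟙 (isV*? v)) (sym (𝟙-no (0# ≟ v) 0≢v)))

    #V* : sum (λ v → 𝟙 (isV*? v)) ≡ L′
    #V* = ℕₚ.suc-injective (begin
      suc (sum (λ v → 𝟙 (isV*? v)))
        ≡⟨ cong (ℕ._+ sum (λ v → 𝟙 (isV*? v))) (sum-pick-one 0#) ⟨
      sum (λ v → 𝟙 (0# ≟ v)) ℕ.+ sum (λ v → 𝟙 (isV*? v))
        ≡⟨ ∑-distrib-+ (λ v → 𝟙 (0# ≟ v)) (λ v → 𝟙 (isV*? v)) ⟨
      sum (λ v → 𝟙 (0# ≟ v) ℕ.+ 𝟙 (isV*? v))
        ≡⟨ sum-cong-≗ kernel-tr-split ⟨
      fiber tr 0#
        ≡⟨ kernel-tr ⟩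
      suc L′ ∎)

    V*-inhabited : ∃ λ v → v ≢ 0# × tr v ≡ 0#
    V*-inhabited with Fₚ.any? isV*?
    ... | yes h = h
    ... | no ¬h = contradiction (trans (sym #V*) (sum-zero {f = λ v → 𝟙 (isV*? v)} λ v → 𝟙-no (isV*? v) (λ h → ¬h (v , h)))) (ℕₚ.m<n⇒n≢0 0<L′)

    v₁ : Fin n
    v₁ = proj₁ V*-inhabited

    v₁≢0 : v₁ ≢ 0#
    v₁≢0 = proj₁ (proj₂ V*-inhabited)

    tr-v₁ : tr v₁ ≡ 0#
    tr-v₁ = proj₂ (proj₂ V*-inhabited)

    Λ-surjective : ∀ {v} → tr v ≡ 0# → ∃ λ y → Λ y ≡ v
    Λ-surjective {v} h = 𝟙≡1⇒ (image? Λ v) (trans (image-Λ v) (𝟙-yes (tr v ≟ 0#) h))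

    tr≡0⇒frob : ∀ {v} → tr v ≡ 0# → v ^ L ≡ - v
    tr≡0⇒frob {v} = neg-unique v (v ^ L)

    -- The power L negates both z and fz, hence fixes f: the kernel of `tr` is a line over the fixed
    -- elements.
    ratio-fixed : ∀ {f z} → z ≢ 0# → tr z ≡ 0# → tr (f * z) ≡ 0# → f ^ L ≡ f
    ratio-fixed {f} {z} z≢0 hz hfz = *-cancelˡ -z≢0 (begin
      - z * f ^ L     ≡⟨ *-comm (- z) (f ^ L) ⟩
      f ^ L * - z     ≡⟨ cong (f ^ L *_) (tr≡0⇒frob hz) ⟨
      f ^ L * z ^ L   ≡⟨ ^-distrib-* f z L ⟨
      (f * z) ^ L     ≡⟨ tr≡0⇒frob hfz ⟩
      - (f * z)       ≡⟨ -‿distribʳ-* f z ⟩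
      f * - z         ≡⟨ *-comm f (- z) ⟩
      - z * f         ∎)
      where
      -z≢0 : - z ≢ 0#
      -z≢0 -z≡0 = z≢0 (trans (sym (neg-involutive z)) (trans (cong -_ -z≡0) -0≡0))

    ratio : ∀ {v z} → z ≢ 0# → tr z ≡ 0# → tr v ≡ 0# → ∃ λ f → f ^ L ≡ f × f * z ≡ v
    ratio {v} {z} z≢0 hz hv = v * z ⁻¹ , ratio-fixed z≢0 hz (trans (cong tr fz≡v) hv) , fz≡v
      where
      fz≡v : v * z ⁻¹ * z ≡ v
      fz≡v = trans (*-assoc v (z ⁻¹) z) (trans (cong (v *_) (⁻¹-inverseˡ z≢0)) (*-identityʳ v))

    fixed-tr : ∀ {f z} → f ^ L ≡ f → tr z ≡ 0# → tr (f * z) ≡ 0#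
    fixed-tr {f} {z} fL≡f hz = begin
      f * z + (f * z) ^ L   ≡⟨ cong (f * z +_) (trans (^-distrib-* f z L) (cong (_* z ^ L) fL≡f)) ⟩
      f * z + f * z ^ L     ≡⟨ distribˡ f z (z ^ L) ⟨
      f * tr z              ≡⟨ cong (f *_) hz ⟩
      f * 0#                ≡⟨ zeroʳ f ⟩
      0#                    ∎

    ≢0? : ∀ u → Dec (u ≢ 0#)
    ≢0? u = ¬? (u ≟ 0#)

    zero-or-not : ∀ u → 𝟙 (0# ≟ u) ℕ.+ 𝟙 (≢0? u) ≡ 1
    zero-or-not u = by-cases (0# ≟ u)
      where
      by-cases : Dec (0# ≡ u) → _
      by-cases (yes 0≡u) = cong₂ ℕ._+_ (𝟙-yes (0# ≟ u) 0≡u) (𝟙-no (≢0? u) (λ u≢0 → u≢0 (sym 0≡u)))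
      by-cases (no 0≢u)  = cong₂ ℕ._+_ (𝟙-no (0# ≟ u) 0≢u) (𝟙-yes (≢0? u) (λ u≡0 → 0≢u (sym u≡0)))

    sum-split-0 : ∀ (f : Fin n → ℕ) → sum f ≡ f 0# ℕ.+ sum (λ u → 𝟙 (≢0? u) ℕ.* f u)
    sum-split-0 f = begin
      sum f
        ≡⟨ sum-cong-≗ (λ u → trans (sym (ℕₚ.*-identityˡ (f u))) (trans (cong (ℕ._* f u) (sym (zero-or-not u))) (ℕₚ.*-distribʳ-+ (f u) (𝟙 (0# ≟ u)) (𝟙 (≢0? u))))) ⟩
      sum (λ u → 𝟙 (0# ≟ u) ℕ.* f u ℕ.+ 𝟙 (≢0? u) ℕ.* f u)
        ≡⟨ ∑-distrib-+ (λ u → 𝟙 (0# ≟ u) ℕ.* f u) (λ u → 𝟙 (≢0? u) ℕ.* f u) ⟩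
      sum (λ u → 𝟙 (0# ≟ u) ℕ.* f u) ℕ.+ sum (λ u → 𝟙 (≢0? u) ℕ.* f u)
        ≡⟨ cong (ℕ._+ sum (λ u → 𝟙 (≢0? u) ℕ.* f u)) (sum-pick 0# f) ⟩
      f 0# ℕ.+ sum (λ u → 𝟙 (≢0? u) ℕ.* f u) ∎

    sum-on-nonzero : ∀ {f g : Fin n → ℕ} → (∀ u → u ≢ 0# → f u ≡ g u) →
      sum (λ u → 𝟙 (≢0? u) ℕ.* f u) ≡ sum (λ u → 𝟙 (≢0? u) ℕ.* g u)
    sum-on-nonzero {f} {g} eq = sum-cong-≗ λ u → by-cases u (u ≟ 0#)
      where
      by-cases : ∀ u → Dec (u ≡ 0#) → 𝟙 (≢0? u) ℕ.* f u ≡ 𝟙 (≢0? u) ℕ.* g u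
      by-cases u (yes u≡0) = trans (cong (ℕ._* f u) (𝟙-no (≢0? u) (λ u≢0 → u≢0 u≡0))) (cong (ℕ._* g u) (sym (𝟙-no (≢0? u) (λ u≢0 → u≢0 u≡0))))
      by-cases u (no u≢0)  = cong (𝟙 (≢0? u) ℕ.*_) (eq u u≢0)

    #nonzero : suc (sum (λ u → 𝟙 (≢0? u))) ≡ n
    #nonzero = trans (cong (ℕ._+ sum (λ u → 𝟙 (≢0? u))) (sym (sum-pick-one 0#)))
      (trans (sym (∑-distrib-+ (λ u → 𝟙 (0# ≟ u)) (λ u → 𝟙 (≢0? u))))
        (trans (sum-cong-≗ zero-or-not) (trans (sum-const n 1) (ℕₚ.*-identityʳ n))))

    -- The sum of L^(2j) over j < i, that is (L^(2i) - 1) / (L² - 1). Thus `M` is (n - 1) / K,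
    -- obtained without division and visibly a multiple of L - 1.
    G : ℕ → ℕ
    G zero    = 0
    G (suc i) = suc (L ℕ.* (L ℕ.* G i))

    M : ℕ
    M = L′ ℕ.* G s

    geometric : ∀ i → L ℕ.^ (i ℕ.+ i) ≡ suc (K ℕ.* (L′ ℕ.* G i))
    geometric zero    = cong suc (sym (trans (cong (K ℕ.*_) (ℕₚ.*-zeroʳ L′)) (ℕₚ.*-zeroʳ K)))
    geometric (suc i) = begin
      L ℕ.* L ℕ.^ (i ℕ.+ suc i)              ≡⟨ cong (λ j → L ℕ.* L ℕ.^ j) (ℕₚ.+-suc i i) ⟩
      L ℕ.* (L ℕ.* L ℕ.^ (i ℕ.+ i))          ≡⟨ cong (λ x → L ℕ.* (L ℕ.* x)) (geometric i) ⟩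
      L ℕ.* (L ℕ.* suc (K ℕ.* (L′ ℕ.* G i))) ≡⟨ identity L′ (G i) ⟩
      suc (K ℕ.* (L′ ℕ.* G (suc i)))         ∎
      where
      identity : ∀ l g → (1 ℕ.+ l) ℕ.* ((1 ℕ.+ l) ℕ.* (1 ℕ.+ (2 ℕ.+ l) ℕ.* (l ℕ.* g)))
                         ≡ 1 ℕ.+ (2 ℕ.+ l) ℕ.* (l ℕ.* (1 ℕ.+ (1 ℕ.+ l) ℕ.* ((1 ℕ.+ l) ℕ.* g)))
      identity = ℕ-Solver.solve-∀

    n≡1+KM : n ≡ suc (K ℕ.* M)
    n≡1+KM = trans n≡ (geometric s)

    0<M : 0 < M
    0<M = ℕ.>-nonZero⁻¹ M {{ℕₚ.m*n≢0 L′ (G s) {{ℕ.>-nonZero 0<L′}}}}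

    x^[n-1]≡1 : ∀ {x} → x ≢ 0# → x ^ (K ℕ.* M) ≡ 1#
    x^[n-1]≡1 {x} x≢0 = *-cancelˡ x≢0 (trans (cong (x ^_) (sym n≡1+KM)) (trans (x^n≡x x) (sym (*-identityʳ x))))

    IsPower : Fin n → Set
    IsPower y = ∃ λ x → x ≢ 0# × y ≡ x ^ K

    isPower? : ∀ y → Dec (IsPower y)
    isPower? y = Fₚ.any? (λ x → ¬? (x ≟ 0#) ×-dec (y ≟ x ^ K))

    roots-of-unity≤ : ∀ d → 0 < d → sum (λ x → 𝟙 (x ^ d ≟ 1#)) ≤ d
    roots-of-unity≤ d 0<d = ℕₚ.≤-trans
      (ℕₚ.≤-reflexive (sum-cong-≗ λ x → 𝟙-cong (x ^ d ≟ 1#) (- 1# + x ^ d ≟ 0#)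
        (λ eq → trans (cong (- 1# +_) eq) (-‿inverseˡ 1#))
        (λ eq → +-cancelˡ (- 1#) (trans eq (sym (-‿inverseˡ 1#))))))
      (roots≤degree (λ 0+1≡0 → 1≢0 (trans (sym (+-identityˡ 1#)) 0+1≡0))
        (Polynomial-cong (λ x → cong (- 1# +_) (sym (*-identityˡ (x ^ d))))
          (Polynomial-+ (Polynomial-weaken 0<d (constant {f = λ _ → - 1#} λ _ → refl)) (Polynomial-monomial 1# d))))

    τ : Fin n → ℕ
    τ = fiber (_^ K)

    κ : ℕ
    κ = τ 1#

    τ-power : ∀ {a} → a ≢ 0# → τ (a ^ K) ≡ κ
    τ-power {a} a≢0 = trans (sum-scale a≢0 (λ x → 𝟙 (x ^ K ≟ a ^ K)))
      (sum-cong-≗ λ x → 𝟙-cong ((a * x) ^ K ≟ a ^ K) (x ^ K ≟ 1#)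
        (λ eq → *-cancelˡ (x^m≢0 K a≢0) (trans (sym (^-distrib-* a x K)) (trans eq (sym (*-identityʳ (a ^ K))))))
        (λ eq → trans (^-distrib-* a x K) (trans (cong (a ^ K *_) eq) (*-identityʳ (a ^ K)))))

    τ-κ : ∀ y → τ y ≡ 𝟙 (0# ≟ y) ℕ.+ κ ℕ.* 𝟙 (isPower? y)
    τ-κ y = by-cases (0# ≟ y) (isPower? y)
      where
      by-cases : Dec (0# ≡ y) → Dec (IsPower y) → τ y ≡ 𝟙 (0# ≟ y) ℕ.+ κ ℕ.* 𝟙 (isPower? y)
      by-cases (yes 0≡y) _ = begin
        τ y                                          ≡⟨ cong τ (sym 0≡y) ⟩
        sum (λ x → 𝟙 (x ^ K ≟ 0#))                   ≡⟨ sum-cong-≗ (λ x → 𝟙-cong (x ^ K ≟ 0#) (0# ≟ x) (λ eq → sym (x^m≡0⇒x≡0 K eq)) (λ { refl → 0^K≡0 })) ⟩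
        sum (λ x → 𝟙 (0# ≟ x))                       ≡⟨ sum-pick-one 0# ⟩
        1                                            ≡⟨ cong suc (ℕₚ.*-zeroʳ κ) ⟨
        1 ℕ.+ κ ℕ.* 0                                ≡⟨ cong₂ (λ a b → a ℕ.+ κ ℕ.* b) (𝟙-yes (0# ≟ y) 0≡y)
                                                          (𝟙-no (isPower? y) λ { (x , x≢0 , eq) → x^m≢0 K x≢0 (trans (sym eq) (sym 0≡y)) }) ⟨
        𝟙 (0# ≟ y) ℕ.+ κ ℕ.* 𝟙 (isPower? y)          ∎
      by-cases (no 0≢y) (yes (x , x≢0 , y≡)) = trans (cong τ y≡) (trans (τ-power x≢0) (trans (sym (ℕₚ.*-identityʳ κ))
        (sym (cong₂ (λ a b → a ℕ.+ κ ℕ.* b) (𝟙-no (0# ≟ y) 0≢y) (𝟙-yes (isPower? y) (x , x≢0 , y≡))))))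
      by-cases (no 0≢y) (no ¬P) = trans
        (fiber-empty (_^ K) λ { (x , eq) → ¬P (x , (λ { refl → 0≢y (trans (sym 0^K≡0) eq) }) , sym eq) })
        (trans (sym (ℕₚ.*-zeroʳ κ))
          (sym (cong₂ (λ a b → a ℕ.+ κ ℕ.* b) (𝟙-no (0# ≟ y) 0≢y) (𝟙-no (isPower? y) ¬P))))

    isPower≤ : ∀ y → 𝟙 (isPower? y) ≤ 𝟙 (y ^ M ≟ 1#)
    isPower≤ y = 𝟙-mono (isPower? y) (y ^ M ≟ 1#) λ { (x , x≢0 , refl) → trans (^-assocʳ x K M) (x^[n-1]≡1 x≢0) }

    private
      κ#S : κ ℕ.* sum (λ y → 𝟙 (isPower? y)) ≡ K ℕ.* M
      κ#S = ℕₚ.suc-injective (begin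
        1 ℕ.+ κ ℕ.* sum (λ y → 𝟙 (isPower? y))
          ≡⟨ cong₂ ℕ._+_ (sym (sum-pick-one 0#)) (*-distribˡ-sum κ (λ y → 𝟙 (isPower? y))) ⟩
        sum (λ y → 𝟙 (0# ≟ y)) ℕ.+ sum (λ y → κ ℕ.* 𝟙 (isPower? y))
          ≡⟨ ∑-distrib-+ (λ y → 𝟙 (0# ≟ y)) (λ y → κ ℕ.* 𝟙 (isPower? y)) ⟨
        sum (λ y → 𝟙 (0# ≟ y) ℕ.+ κ ℕ.* 𝟙 (isPower? y))
          ≡⟨ sum-cong-≗ τ-κ ⟨
        sum τ
          ≡⟨ fiber-total (_^ K) ⟩
        n
          ≡⟨ n≡1+KM ⟩
        suc (K ℕ.* M) ∎)

      -- There are at most K roots of x^K = 1, and at most M powers, since these satisfy y^M = 1.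
      -- The fibers of x ↦ x^K over nonzero elements give κ · #S = KM, so both bounds are attained;
      -- a generator of the multiplicative group is not invoked.
      S-tight : κ ≡ K × sum (λ y → 𝟙 (isPower? y)) ≡ M
      S-tight = product-tight κ#S (roots-of-unity≤ K (s≤s z≤n))
        (ℕₚ.≤-trans (sum-mono isPower≤) (roots-of-unity≤ M 0<M)) (s≤s z≤n) 0<M

    #S : sum (λ y → 𝟙 (isPower? y)) ≡ M
    #S = proj₂ S-tight

    τ-formula : ∀ y → τ y ≡ 𝟙 (0# ≟ y) ℕ.+ K ℕ.* 𝟙 (isPower? y)
    τ-formula y = trans (τ-κ y) (cong (λ k → 𝟙 (0# ≟ y) ℕ.+ k ℕ.* 𝟙 (isPower? y)) (proj₁ S-tight))

    isPower-criterion : ∀ {y} → y ^ M ≡ 1# → IsPower y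
    isPower-criterion {y} yM≡1 = 𝟙≡1⇒ (isPower? y) (trans
      (sum-mono-tight isPower≤ (ℕₚ.≤-trans (roots-of-unity≤ M 0<M) (ℕₚ.≤-reflexive (sym #S))) y)
      (𝟙-yes (y ^ M ≟ 1#) yM≡1))

    -- f^(L - 1) = 1 and M is a multiple of L - 1, so f^M = 1. Consequently a fixed factor in front
    -- of u^K can be absorbed by rescaling u.
    fixed⇒power : ∀ {f} → f ≢ 0# → f ^ L ≡ f → IsPower f
    fixed⇒power {f} f≢0 fL≡f = isPower-criterion (trans (sym (^-assocʳ f L′ (G s)))
      (trans (cong (_^ G s) (*-cancelˡ f≢0 (trans fL≡f (sym (*-identityʳ f))))) (1^m≡1 (G s))))

    sum-powers : ∀ (ψ : Fin n → ℕ) → sum (λ u → ψ (u ^ K)) ≡ ψ 0# ℕ.+ K ℕ.* sum (λ y → 𝟙 (isPower? y) ℕ.* ψ y)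
    sum-powers ψ = begin
      sum (λ u → ψ (u ^ K))
        ≡⟨ sum-fibers (_^ K) ψ ⟩
      sum (λ y → τ y ℕ.* ψ y)
        ≡⟨ sum-cong-≗ (λ y → trans (cong (ℕ._* ψ y) (τ-formula y)) (trans (ℕₚ.*-distribʳ-+ (ψ y) (𝟙 (0# ≟ y)) (K ℕ.* 𝟙 (isPower? y)))
             (cong (𝟙 (0# ≟ y) ℕ.* ψ y ℕ.+_) (ℕₚ.*-assoc K (𝟙 (isPower? y)) (ψ y))))) ⟩
      sum (λ y → 𝟙 (0# ≟ y) ℕ.* ψ y ℕ.+ K ℕ.* (𝟙 (isPower? y) ℕ.* ψ y))
        ≡⟨ ∑-distrib-+ (λ y → 𝟙 (0# ≟ y) ℕ.* ψ y) (λ y → K ℕ.* (𝟙 (isPower? y) ℕ.* ψ y)) ⟩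
      sum (λ y → 𝟙 (0# ≟ y) ℕ.* ψ y) ℕ.+ sum (λ y → K ℕ.* (𝟙 (isPower? y) ℕ.* ψ y))
        ≡⟨ cong₂ ℕ._+_ (sum-pick 0# ψ) (sym (*-distribˡ-sum K (λ y → 𝟙 (isPower? y) ℕ.* ψ y))) ⟩
      ψ 0# ℕ.+ K ℕ.* sum (λ y → 𝟙 (isPower? y) ℕ.* ψ y) ∎

    -- Translation by 1 preserves the kernel of Λ because Λ(1) = 0, so 1 + tr w is distributed
    -- exactly like tr w.
    fiber-1+tr : ∀ y → fiber (λ w → 1# + tr w) y ≡ L ℕ.* 𝟙 (Λ y ≟ 0#)
    fiber-1+tr y = begin
      sum (λ w → 𝟙 (1# + tr w ≟ y))          ≡⟨ sum-cong-≗ (λ w → 𝟙-cong (1# + tr w ≟ y) (tr w ≟ - 1# + y)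
                                                  (λ eq → trans (sym (neg-cancelˡ 1# (tr w))) (cong (- 1# +_) eq))
                                                  (λ eq → trans (cong (1# +_) eq) (neg-cancelʳ 1# y))) ⟩
      fiber tr (- 1# + y)                    ≡⟨ fiber-tr (- 1# + y) ⟩
      L ℕ.* 𝟙 (Λ (- 1# + y) ≟ 0#)            ≡⟨ cong (λ v → L ℕ.* 𝟙 (v ≟ 0#)) shift ⟩
      L ℕ.* 𝟙 (Λ y ≟ 0#)                     ∎
      where
      shift : Λ (- 1# + y) ≡ Λ y
      shift = sym (trans (cong Λ (sym (neg-cancelʳ 1# y))) (trans (Λ-+ 1# (- 1# + y))
        (trans (cong (_+ Λ (- 1# + y)) Λ-1) (+-identityˡ (Λ (- 1# + y))))))

    sum-1+tr : ∀ (g : Fin n → ℕ) → sum (λ w → g (1# + tr w)) ≡ L ℕ.* sum (λ r → 𝟙 (Λ r ≟ 0#) ℕ.* g r)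
    sum-1+tr g = trans (sum-fibers (λ w → 1# + tr w) g)
      (trans (sum-cong-≗ λ r → trans (cong (ℕ._* g r) (fiber-1+tr r)) (ℕₚ.*-assoc L (𝟙 (Λ r ≟ 0#)) (g r)))
        (sym (*-distribˡ-sum L (λ r → 𝟙 (Λ r ≟ 0#) ℕ.* g r))))

    -- The increment (y + u)^K - y^K; up to the constant u^K it is additive in y.
    H : Fin n → Fin n → Fin n
    H u y = u ^ K + (u ^ L * y + u * y ^ L)

    power-shift : ∀ y u → (y + u) ^ K ≡ y ^ K + H u y
    power-shift y u = trans (cong ((y + u) *_) (frob-+ y u))
      (solve 4 (λ y u Y U → (y :+ u) :* (Y :+ U) := y :* Y :+ (u :* U :+ (U :* y :+ u :* Y))) refl y u (y ^ L) (u ^ L))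

    H-0 : ∀ y → H 0# y ≡ 0#
    H-0 y = begin
      0# ^ K + (0# ^ L * y + 0# * y ^ L)  ≡⟨ cong₂ (λ a b → a + (b * y + 0# * y ^ L)) 0^K≡0 0^L≡0 ⟩
      0# + (0# * y + 0# * y ^ L)          ≡⟨ +-identityˡ _ ⟩
      0# * y + 0# * y ^ L                 ≡⟨ cong₂ _+_ (zeroˡ y) (zeroˡ (y ^ L)) ⟩
      0# + 0#                             ≡⟨ +-identityˡ 0# ⟩
      0#                                  ∎

    H-scale : ∀ u w → H u (u * w) ≡ u ^ K * (1# + tr w)
    H-scale u w = begin
      u * u ^ L + (u ^ L * (u * w) + u * (u * w) ^ L)
        ≡⟨ cong (λ a → u * u ^ L + (u ^ L * (u * w) + u * a)) (^-distrib-* u w L) ⟩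
      u * u ^ L + (u ^ L * (u * w) + u * (u ^ L * w ^ L))
        ≡⟨ cong₂ _+_ (sym (*-identityʳ (u * u ^ L))) (solve 4 (λ u U w W → U :* (u :* w) :+ u :* (U :* W) := u :* U :* (w :+ W)) refl u (u ^ L) w (w ^ L)) ⟩
      u * u ^ L * 1# + u * u ^ L * (w + w ^ L)
        ≡⟨ distribˡ (u * u ^ L) 1# (w + w ^ L) ⟨
      u * u ^ L * (1# + (w + w ^ L)) ∎

    -- For u = 0 the increment is 0 for all n values of y. For u ≠ 0 the substitution y = uw makes
    -- it u^K (1 + tr w), where 1 + tr w takes every value r in the kernel of Λ exactly L times.
    -- This serves both the convolution of τ and the second moment of `Z`.
    sum-H : ∀ (g : Fin n → ℕ) → sum (λ u → sum (λ y → g (H u y))) ≡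
      n ℕ.* g 0# ℕ.+ L ℕ.* sum (λ u → 𝟙 (≢0? u) ℕ.* sum (λ r → 𝟙 (Λ r ≟ 0#) ℕ.* g (u ^ K * r)))
    sum-H g = begin
      sum (λ u → sum (λ y → g (H u y)))
        ≡⟨ sum-split-0 (λ u → sum (λ y → g (H u y))) ⟩
      sum (λ y → g (H 0# y)) ℕ.+ sum (λ u → 𝟙 (≢0? u) ℕ.* sum (λ y → g (H u y)))
        ≡⟨ cong₂ ℕ._+_ (trans (sum-cong-≗ λ y → cong g (H-0 y)) (sum-const n (g 0#))) (sum-on-nonzero nonzero) ⟩
      n ℕ.* g 0# ℕ.+ sum (λ u → 𝟙 (≢0? u) ℕ.* (L ℕ.* inner u))
        ≡⟨ cong (n ℕ.* g 0# ℕ.+_) (trans (sum-cong-≗ λ u → x∙yz≈y∙xz (𝟙 (≢0? u)) L (inner u)) (sym (*-distribˡ-sum L (λ u → 𝟙 (≢0? u) ℕ.* inner u)))) ⟩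
      n ℕ.* g 0# ℕ.+ L ℕ.* sum (λ u → 𝟙 (≢0? u) ℕ.* inner u) ∎
      where
      open import Algebra.Properties.CommutativeSemigroup ℕₚ.*-commutativeSemigroup using (x∙yz≈y∙xz)
      inner : Fin n → ℕ
      inner u = sum (λ r → 𝟙 (Λ r ≟ 0#) ℕ.* g (u ^ K * r))
      nonzero : ∀ u → u ≢ 0# → sum (λ y → g (H u y)) ≡ L ℕ.* inner u
      nonzero u u≢0 = trans (sum-scale u≢0 (λ y → g (H u y)))
        (trans (sum-cong-≗ λ w → cong g (H-scale u w)) (sum-1+tr (λ r → g (u ^ K * r))))

    -- Z a 0 - Z a v₁ equals Σ_u χ(a u^K) for the additive characters χ ≠ 1 that are trivial on ker Λ.
    Z : Fin n → Fin n → ℕ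
    Z a = fiber (λ u → Λ (a * u ^ K))

    Λ-at-0 : ∀ a → Λ (a * 0#) ≡ 0#
    Λ-at-0 a = trans (cong Λ (zeroʳ a)) Λ-0

    Z₀-split : ∀ a → Z a 0# ≡ suc (sum (λ u → 𝟙 (≢0? u) ℕ.* 𝟙 (Λ (a * u ^ K) ≟ 0#)))
    Z₀-split a = trans (sum-split-0 (λ u → 𝟙 (Λ (a * u ^ K) ≟ 0#)))
      (cong (ℕ._+ sum (λ u → 𝟙 (≢0? u) ℕ.* 𝟙 (Λ (a * u ^ K) ≟ 0#)))
        (𝟙-yes (Λ (a * 0# ^ K) ≟ 0#) (trans (cong (λ b → Λ (a * b)) 0^K≡0) (Λ-at-0 a))))

    -- The sum over u ≠ 0 becomes `Z a 0#` after u ↦ u⁻¹ and the addition of the term at u = 0,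
    -- which always counts. That term accounts for the `+ L`, placed on the left to avoid
    -- subtraction in ℕ.
    convolution : ∀ a → sum (λ z → τ z ℕ.* τ (- a + z)) ℕ.+ L ≡ n ℕ.* 𝟙 (0# ≟ a) ℕ.+ L ℕ.* Z a 0#
    convolution a = begin
      sum (λ z → τ z ℕ.* τ (- a + z)) ℕ.+ L
        ≡⟨ cong (ℕ._+ L) (sum-fibers (_^ K) (λ z → τ (- a + z))) ⟨
      sum (λ x → sum (λ y → 𝟙 (y ^ K ≟ - a + x ^ K))) ℕ.+ L
        ≡⟨ cong (ℕ._+ L) (∑-comm (λ x y → 𝟙 (y ^ K ≟ - a + x ^ K))) ⟩
      sum (λ y → sum (λ x → 𝟙 (y ^ K ≟ - a + x ^ K))) ℕ.+ L
        ≡⟨ cong (ℕ._+ L) (sum-cong-≗ λ y → trans (sum-translate y (λ x → 𝟙 (y ^ K ≟ - a + x ^ K))) (sum-cong-≗ λ u → shifted y u)) ⟩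
      sum (λ y → sum (λ u → 𝟙 (H u y ≟ a))) ℕ.+ L
        ≡⟨ cong (ℕ._+ L) (∑-comm (λ y u → 𝟙 (H u y ≟ a))) ⟩
      sum (λ u → sum (λ y → 𝟙 (H u y ≟ a))) ℕ.+ L
        ≡⟨ cong (ℕ._+ L) (sum-H (λ h → 𝟙 (h ≟ a))) ⟩
      n ℕ.* 𝟙 (0# ≟ a) ℕ.+ L ℕ.* sum (λ u → 𝟙 (≢0? u) ℕ.* sum (λ r → 𝟙 (Λ r ≟ 0#) ℕ.* 𝟙 (u ^ K * r ≟ a))) ℕ.+ L
        ≡⟨ cong (λ b → n ℕ.* 𝟙 (0# ≟ a) ℕ.+ L ℕ.* b ℕ.+ L) (trans (sum-on-nonzero pick) inverted) ⟩
      n ℕ.* 𝟙 (0# ≟ a) ℕ.+ L ℕ.* Z* ℕ.+ L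
        ≡⟨ trans (ℕₚ.+-assoc (n ℕ.* 𝟙 (0# ≟ a)) (L ℕ.* Z*) L) (cong (n ℕ.* 𝟙 (0# ≟ a) ℕ.+_) (trans (ℕₚ.+-comm (L ℕ.* Z*) L) (sym (ℕₚ.*-suc L Z*)))) ⟩
      n ℕ.* 𝟙 (0# ≟ a) ℕ.+ L ℕ.* suc Z*
        ≡⟨ cong (λ b → n ℕ.* 𝟙 (0# ≟ a) ℕ.+ L ℕ.* b) (Z₀-split a) ⟨
      n ℕ.* 𝟙 (0# ≟ a) ℕ.+ L ℕ.* Z a 0# ∎
      where
      Z* : ℕ
      Z* = sum (λ u → 𝟙 (≢0? u) ℕ.* 𝟙 (Λ (a * u ^ K) ≟ 0#))
      shifted : ∀ y u → 𝟙 (y ^ K ≟ - a + (y + u) ^ K) ≡ 𝟙 (H u y ≟ a)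
      shifted y u = 𝟙-cong (y ^ K ≟ - a + (y + u) ^ K) (H u y ≟ a)
        (λ eq → +-cancelˡ (y ^ K) (begin
          y ^ K + H u y                   ≡⟨ power-shift y u ⟨
          (y + u) ^ K                     ≡⟨ neg-cancelʳ a ((y + u) ^ K) ⟨
          a + (- a + (y + u) ^ K)         ≡⟨ cong (a +_) eq ⟨
          a + y ^ K                       ≡⟨ +-comm a (y ^ K) ⟩
          y ^ K + a                       ∎))
        (λ eq → +-cancelˡ a (begin
          a + y ^ K                       ≡⟨ +-comm a (y ^ K) ⟩
          y ^ K + a                       ≡⟨ cong (y ^ K +_) eq ⟨
          y ^ K + H u y                   ≡⟨ power-shift y u ⟨
          (y + u) ^ K                     ≡⟨ neg-cancelʳ a ((y + u) ^ K) ⟨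
          a + (- a + (y + u) ^ K)         ∎))
      pick : ∀ u → u ≢ 0# → sum (λ r → 𝟙 (Λ r ≟ 0#) ℕ.* 𝟙 (u ^ K * r ≟ a)) ≡ 𝟙 (Λ (a * (u ⁻¹) ^ K) ≟ 0#)
      pick u u≢0 = trans
        (sum-cong-≗ λ r → trans (ℕₚ.*-comm (𝟙 (Λ r ≟ 0#)) (𝟙 (u ^ K * r ≟ a)))
          (cong (ℕ._* 𝟙 (Λ r ≟ 0#)) (𝟙-cong (u ^ K * r ≟ a) (b ≟ r)
            (λ eq → *-cancelˡ (x^m≢0 K u≢0) (trans u^K*b≡a (sym eq)))
            (λ { refl → u^K*b≡a }))))
        (sum-pick b (λ r → 𝟙 (Λ r ≟ 0#)))
        where
        b : Fin n
        b = a * (u ⁻¹) ^ K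
        u^K*b≡a : u ^ K * b ≡ a
        u^K*b≡a = begin
          u ^ K * (a * (u ⁻¹) ^ K)    ≡⟨ solve 3 (λ x a y → x :* (a :* y) := a :* (x :* y)) refl (u ^ K) a ((u ⁻¹) ^ K) ⟩
          a * (u ^ K * (u ⁻¹) ^ K)    ≡⟨ cong (a *_) (trans (sym (^-distrib-* u (u ⁻¹) K)) (trans (cong (_^ K) (⁻¹-inverseʳ u≢0)) (1^m≡1 K))) ⟩
          a * 1#                      ≡⟨ *-identityʳ a ⟩
          a                           ∎
      inverted : sum (λ u → 𝟙 (≢0? u) ℕ.* 𝟙 (Λ (a * (u ⁻¹) ^ K) ≟ 0#)) ≡ Z*
      inverted = trans
        (sum-cong-≗ λ u → cong (ℕ._* 𝟙 (Λ (a * (u ⁻¹) ^ K) ≟ 0#)) (𝟙-cong (≢0? u) (≢0? (u ⁻¹)) ⁻¹-≢0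
          (λ u⁻¹≢0 u≡0 → u⁻¹≢0 (trans (cong _⁻¹ u≡0) 0⁻¹≡0))))
        (sym (sum-reindex (λ u → 𝟙 (≢0? u) ℕ.* 𝟙 (Λ (a * u ^ K) ≟ 0#)) _⁻¹ _⁻¹ ⁻¹-involutive ⁻¹-involutive))

    -- For y outside ker Λ and f = Λ(c y) / Λ(y), which satisfies f^L = f, the element c - f stabilises ker Λ
    -- and maps y into it. If c - f were nonzero, its inverse would be a power of it and stabilise ker Λ as well.
    stabiliser⇒fixed : ∀ c → (∀ r → Λ r ≡ 0# → Λ (c * r) ≡ 0#) → c ^ L ≡ c
    stabiliser⇒fixed c stab = trans (cong (_^ L) c≡f) (trans fL≡f (sym c≡f))
      where
      y : Fin n
      y = proj₁ (Λ-surjective tr-v₁)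
      Λy≡v₁ : Λ y ≡ v₁
      Λy≡v₁ = proj₂ (Λ-surjective tr-v₁)
      quotient : ∃ λ f → f ^ L ≡ f × f * v₁ ≡ Λ (c * y)
      quotient = ratio v₁≢0 tr-v₁ (tr-Λ (c * y))
      f g : Fin n
      f = proj₁ quotient
      g = c - f
      fL≡f : f ^ L ≡ f
      fL≡f = proj₁ (proj₂ quotient)
      -fL≡-f : (- f) ^ L ≡ - f
      -fL≡-f = trans (frob-neg f) (cong -_ fL≡f)
      Λ-g : ∀ r → Λ (g * r) ≡ Λ (c * r) + - f * Λ r
      Λ-g r = trans (cong Λ (distribʳ r c (- f))) (trans (Λ-+ (c * r) (- f * r)) (cong (Λ (c * r) +_) (Λ-scale -fL≡-f r)))
      g-stab : ∀ r → Λ r ≡ 0# → Λ (g * r) ≡ 0#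
      g-stab r Λr≡0 = trans (Λ-g r) (trans (cong₂ (λ a b → a + - f * b) (stab r Λr≡0) Λr≡0)
        (trans (+-identityˡ (- f * 0#)) (zeroʳ (- f))))
      Λgy≡0 : Λ (g * y) ≡ 0#
      Λgy≡0 = begin
        Λ (g * y)                ≡⟨ Λ-g y ⟩
        Λ (c * y) + - f * Λ y    ≡⟨ cong₂ (λ a b → a + - f * b) (sym (proj₂ (proj₂ quotient))) Λy≡v₁ ⟩
        f * v₁ + - f * v₁        ≡⟨ distribʳ v₁ f (- f) ⟨
        (f - f) * v₁             ≡⟨ cong (_* v₁) (-‿inverseʳ f) ⟩
        0# * v₁                  ≡⟨ zeroˡ v₁ ⟩
        0#                       ∎
      powers : ∀ m → Λ (g ^ suc m * y) ≡ 0#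
      powers zero    = trans (cong (λ h → Λ (h * y)) (*-identityʳ g)) Λgy≡0
      powers (suc m) = trans (cong Λ (*-assoc g (g ^ suc m) y)) (g-stab (g ^ suc m * y) (powers m))
      KM≢0 : ℕ.NonZero (K ℕ.* M)
      KM≢0 = ℕₚ.m*n≢0 K M {{_}} {{ℕ.>-nonZero 0<M}}
      g≡0 : Dec (g ≡ 0#) → g ≡ 0#
      g≡0 (yes g≡0) = g≡0
      -- Since g^(KM) = 1, the element y itself would lie in the kernel of Λ, against Λ y = v₁. As
      -- KM is positive it is a successor, the shape `powers` requires.
      g≡0 (no g≢0)  = contradiction (trans (sym Λy≡v₁) (trans (cong Λ (sym
        (trans (cong (_* y) (trans (cong (g ^_) (ℕₚ.suc-pred (K ℕ.* M) {{KM≢0}})) (x^[n-1]≡1 g≢0))) (*-identityˡ y))))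
        (powers (ℕ.pred (K ℕ.* M))))) v₁≢0
      c≡f : c ≡ f
      c≡f = x-y≡0⇒x≡y c f (g≡0 (g ≟ 0#))

    -- How many elements of the kernel of Λ multiplication by c keeps inside it: all w₀ if c is
    -- fixed by x ↦ x^L, and one in L otherwise.
    I : Fin n → ℕ
    I c = sum (λ r → 𝟙 (Λ r ≟ 0#) ℕ.* 𝟙 (Λ (c * r) ≟ 0#))

    I-fixed : ∀ {c} → c ^ L ≡ c → I c ≡ w₀
    I-fixed {c} cL≡c = trans (sum-cong-≗ λ r → by-cases r (Λ r ≟ 0#)) kernel-Λ
      where
      by-cases : ∀ r (d : Dec (Λ r ≡ 0#)) → 𝟙 d ℕ.* 𝟙 (Λ (c * r) ≟ 0#) ≡ 𝟙 d
      by-cases r (no _)     = refl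
      by-cases r (yes Λr≡0) = trans (ℕₚ.*-identityˡ (𝟙 (Λ (c * r) ≟ 0#)))
        (𝟙-yes (Λ (c * r) ≟ 0#) (trans (Λ-scale cL≡c r) (trans (cong (c *_) Λr≡0) (zeroʳ c))))

    -- On the kernel of Λ the map r ↦ Λ(cr) takes a nonzero value. Scaling r₀ by fixed elements
    -- produces every value in the kernel of `tr`, and translation shows that each of these L values
    -- is taken `I c` times.
    I-moved : ∀ {c r₀} → Λ r₀ ≡ 0# → Λ (c * r₀) ≢ 0# → L ℕ.* I c ≡ w₀
    I-moved {c} {r₀} Λr₀≡0 z≢0 = begin
      L ℕ.* I c
        ≡⟨ cong (ℕ._* I c) kernel-tr ⟨
      fiber tr 0# ℕ.* I c
        ≡⟨ *-distribʳ-sum (I c) (λ v → 𝟙 (tr v ≟ 0#)) ⟩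
      sum (λ v → 𝟙 (tr v ≟ 0#) ℕ.* I c)
        ≡⟨ sum-cong-≗ (λ v → Iᵥ-formula v (tr v ≟ 0#)) ⟨
      sum (λ v → sum (λ r → 𝟙 (Λ r ≟ 0#) ℕ.* 𝟙 (Λ (c * r) ≟ v)))
        ≡⟨ ∑-comm (λ v r → 𝟙 (Λ r ≟ 0#) ℕ.* 𝟙 (Λ (c * r) ≟ v)) ⟩
      sum (λ r → sum (λ v → 𝟙 (Λ r ≟ 0#) ℕ.* 𝟙 (Λ (c * r) ≟ v)))
        ≡⟨ sum-cong-≗ (λ r → trans (sym (*-distribˡ-sum (𝟙 (Λ r ≟ 0#)) (λ v → 𝟙 (Λ (c * r) ≟ v))))
             (trans (cong (𝟙 (Λ r ≟ 0#) ℕ.*_) (sum-pick-one (Λ (c * r)))) (ℕₚ.*-identityʳ (𝟙 (Λ r ≟ 0#))))) ⟩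
      fiber Λ 0#
        ≡⟨ kernel-Λ ⟩
      w₀ ∎
      where
      z : Fin n
      z = Λ (c * r₀)
      Iᵥ-formula : ∀ v (d : Dec (tr v ≡ 0#)) → sum (λ r → 𝟙 (Λ r ≟ 0#) ℕ.* 𝟙 (Λ (c * r) ≟ v)) ≡ 𝟙 d ℕ.* I c
      Iᵥ-formula v (no trv≢0) = sum-zero {f = λ r → 𝟙 (Λ r ≟ 0#) ℕ.* 𝟙 (Λ (c * r) ≟ v)} λ r → trans
        (cong (𝟙 (Λ r ≟ 0#) ℕ.*_) (𝟙-no (Λ (c * r) ≟ v) (λ eq → trv≢0 (trans (cong tr (sym eq)) (tr-Λ (c * r))))))
        (ℕₚ.*-zeroʳ (𝟙 (Λ r ≟ 0#)))
      Iᵥ-formula v (yes trv≡0) = trans (sum-translate (f * r₀) (λ r → 𝟙 (Λ r ≟ 0#) ℕ.* 𝟙 (Λ (c * r) ≟ v)))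
        (trans (sum-cong-≗ λ r → cong₂ ℕ._*_ (cong (λ x → 𝟙 (x ≟ 0#)) (same r))
          (trans (cong (λ x → 𝟙 (x ≟ v)) (moved r))
            (𝟙-cong (v + Λ (c * r) ≟ v) (Λ (c * r) ≟ 0#)
              (λ eq → +-cancelˡ v (trans eq (sym (+-identityʳ v))))
              (λ eq → trans (cong (v +_) eq) (+-identityʳ v)))))
          (sym (ℕₚ.*-identityˡ (I c))))
        where
        f : Fin n
        f = proj₁ (ratio z≢0 (tr-Λ (c * r₀)) trv≡0)
        fL≡f : f ^ L ≡ f
        fL≡f = proj₁ (proj₂ (ratio z≢0 (tr-Λ (c * r₀)) trv≡0))
        fz≡v : f * z ≡ v
        fz≡v = proj₂ (proj₂ (ratio z≢0 (tr-Λ (c * r₀)) trv≡0))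
        same : ∀ r → Λ (f * r₀ + r) ≡ Λ r
        same r = trans (Λ-+ (f * r₀) r) (trans (cong (_+ Λ r) (trans (Λ-scale fL≡f r₀) (trans (cong (f *_) Λr₀≡0) (zeroʳ f)))) (+-identityˡ (Λ r)))
        moved : ∀ r → Λ (c * (f * r₀ + r)) ≡ v + Λ (c * r)
        moved r = trans (cong Λ (solve 4 (λ c f r₀ r → c :* (f :* r₀ :+ r) := f :* (c :* r₀) :+ c :* r) refl c f r₀ r))
          (trans (Λ-+ (f * (c * r₀)) (c * r)) (cong (_+ Λ (c * r)) (trans (Λ-scale fL≡f (c * r₀)) fz≡v)))

    I-formula : ∀ c → L ℕ.* I c ≡ w₀ ℕ.* suc (L′ ℕ.* 𝟙 (c ^ L ≟ c))
    I-formula c = by-cases (Fₚ.any? (λ r → (Λ r ≟ 0#) ×-dec ¬? (Λ (c * r) ≟ 0#)))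
      where
      fixed : c ^ L ≡ c → L ℕ.* I c ≡ w₀ ℕ.* suc (L′ ℕ.* 𝟙 (c ^ L ≟ c))
      fixed cL≡c = trans (cong (L ℕ.*_) (I-fixed cL≡c)) (trans (ℕₚ.*-comm L w₀)
        (cong (λ x → w₀ ℕ.* suc x) (sym (trans (cong (L′ ℕ.*_) (𝟙-yes (c ^ L ≟ c) cL≡c)) (ℕₚ.*-identityʳ L′)))))
      by-cases : Dec (∃ λ r → Λ r ≡ 0# × Λ (c * r) ≢ 0#) → _
      by-cases (no ¬moved) = fixed (stabiliser⇒fixed c λ r Λr≡0 →
        decidable-stable (Λ (c * r) ≟ 0#) (λ z≢0 → ¬moved (r , Λr≡0 , z≢0)))
      by-cases (yes (r₀ , Λr₀≡0 , z≢0)) = trans (I-moved Λr₀≡0 z≢0) (trans (sym (ℕₚ.*-identityʳ w₀))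
        (cong (λ x → w₀ ℕ.* suc x) (sym (trans (cong (L′ ℕ.*_) (𝟙-no (c ^ L ≟ c)
          (λ cL≡c → z≢0 (trans (Λ-scale cL≡c r₀) (trans (cong (c *_) Λr₀≡0) (zeroʳ c)))))) (ℕₚ.*-zeroʳ L′)))))

    -- The number of u ≠ 0 at which `I (a * u ^ K)` takes its larger value w₀. Fixed elements are
    -- K-th powers, so this count tells whether a is one.
    fixedMultiples : Fin n → ℕ
    fixedMultiples a = sum λ u → 𝟙 (≢0? u) ℕ.* 𝟙 ((a * u ^ K) ^ L ≟ a * u ^ K)

    -- Multiplication by v₁ carries the fixed elements onto the kernel of `tr`, which has L
    -- elements.
    #fixed : sum (λ f → 𝟙 (f ^ L ≟ f)) ≡ L
    #fixed = trans
      (trans (sum-cong-≗ λ f → 𝟙-cong (f ^ L ≟ f) (tr (v₁ * f) ≟ 0#)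
          (λ fL≡f → trans (cong tr (*-comm v₁ f)) (fixed-tr fL≡f tr-v₁))
          (λ h → ratio-fixed v₁≢0 tr-v₁ (trans (cong tr (*-comm f v₁)) h)))
        (sym (sum-scale v₁≢0 (λ z → 𝟙 (tr z ≟ 0#)))))
      kernel-tr

    #fixed-nonzero : sum (λ f → 𝟙 (≢0? f) ℕ.* 𝟙 (f ^ L ≟ f)) ≡ L′
    #fixed-nonzero = ℕₚ.suc-injective (trans
      (cong (ℕ._+ sum (λ f → 𝟙 (≢0? f) ℕ.* 𝟙 (f ^ L ≟ f))) (sym (𝟙-yes (0# ^ L ≟ 0#) 0^L≡0)))
      (trans (sym (sum-split-0 (λ f → 𝟙 (f ^ L ≟ f)))) #fixed))

    fixedMultiples-power : ∀ {a} → IsPower a → fixedMultiples a ≡ K ℕ.* L′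
    fixedMultiples-power {a} (x , x≢0 , refl) = ℕₚ.suc-injective (begin
      suc (fixedMultiples a)
        ≡⟨ cong suc (trans (sum-cong-≗ rescaled) (sym (sum-scale x≢0 (λ u → 𝟙 (≢0? u) ℕ.* h (u ^ K))))) ⟩
      suc (sum (λ u → 𝟙 (≢0? u) ℕ.* h (u ^ K)))
        ≡⟨ cong (ℕ._+ sum (λ u → 𝟙 (≢0? u) ℕ.* h (u ^ K))) (trans (cong h 0^K≡0) h0≡1) ⟨
      h (0# ^ K) ℕ.+ sum (λ u → 𝟙 (≢0? u) ℕ.* h (u ^ K))
        ≡⟨ sum-split-0 (λ u → h (u ^ K)) ⟨
      sum (λ u → h (u ^ K))
        ≡⟨ sum-powers h ⟩
      h 0# ℕ.+ K ℕ.* sum (λ y → 𝟙 (isPower? y) ℕ.* h y)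
        ≡⟨ cong₂ (λ p q → p ℕ.+ K ℕ.* q) h0≡1 (trans (sum-cong-≗ (λ y → power∧fixed y (y ^ L ≟ y))) #fixed-nonzero) ⟩
      suc (K ℕ.* L′) ∎)
      where
      h : Fin n → ℕ
      h y = 𝟙 (y ^ L ≟ y)
      h0≡1 : h 0# ≡ 1
      h0≡1 = 𝟙-yes (0# ^ L ≟ 0#) 0^L≡0
      rescaled : ∀ u → 𝟙 (≢0? u) ℕ.* h (x ^ K * u ^ K) ≡ 𝟙 (≢0? (x * u)) ℕ.* h ((x * u) ^ K)
      rescaled u = cong₂ ℕ._*_
        (𝟙-cong (≢0? u) (≢0? (x * u)) (x*y≢0 x≢0) (λ xu≢0 u≡0 → xu≢0 (trans (cong (x *_) u≡0) (zeroʳ x))))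
        (cong h (sym (^-distrib-* x u K)))
      power∧fixed : ∀ y (d : Dec (y ^ L ≡ y)) → 𝟙 (isPower? y) ℕ.* 𝟙 d ≡ 𝟙 (≢0? y) ℕ.* 𝟙 d
      power∧fixed y (no _)     = trans (ℕₚ.*-zeroʳ (𝟙 (isPower? y))) (sym (ℕₚ.*-zeroʳ (𝟙 (≢0? y))))
      power∧fixed y (yes yL≡y) = cong (ℕ._* 1) (𝟙-cong (isPower? y) (≢0? y)
        (λ { (x , x≢0 , refl) → x^m≢0 K x≢0 }) (λ y≢0 → fixed⇒power y≢0 yL≡y))

    fixedMultiples-nonpower : ∀ {a} → a ≢ 0# → ¬ IsPower a → fixedMultiples a ≡ 0
    fixedMultiples-nonpower {a} a≢0 ¬P = trans
      (sum-on-nonzero {g = λ _ → 0} λ u u≢0 → 𝟙-no ((a * u ^ K) ^ L ≟ a * u ^ K) (impossible u u≢0))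
      (sum-zero {f = λ u → 𝟙 (≢0? u) ℕ.* 0} λ u → ℕₚ.*-zeroʳ (𝟙 (≢0? u)))
      where
      impossible : ∀ u → u ≢ 0# → (a * u ^ K) ^ L ≢ a * u ^ K
      impossible u u≢0 eq with fixed⇒power (x*y≢0 a≢0 (x^m≢0 K u≢0)) eq
      ... | z , z≢0 , auK≡zK = ¬P (z * u ⁻¹ , x*y≢0 z≢0 (⁻¹-≢0 u≢0) , (begin
        a                              ≡⟨ *-identityʳ a ⟨
        a * 1#                         ≡⟨ cong (a *_) (trans (sym (1^m≡1 K)) (trans (cong (_^ K) (sym (⁻¹-inverseʳ u≢0))) (^-distrib-* u (u ⁻¹) K))) ⟩
        a * (u ^ K * (u ⁻¹) ^ K)       ≡⟨ *-assoc a (u ^ K) ((u ⁻¹) ^ K) ⟨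
        a * u ^ K * (u ⁻¹) ^ K         ≡⟨ cong (_* (u ⁻¹) ^ K) auK≡zK ⟩
        z ^ K * (u ⁻¹) ^ K             ≡⟨ ^-distrib-* z (u ⁻¹) K ⟨
        (z * u ⁻¹) ^ K                 ∎))

    -- Writing f = g^K and replacing u by gu multiplies Λ(a u^K) by f.
    Z-scale : ∀ a {f v} → f ≢ 0# → f ^ L ≡ f → Z a (f * v) ≡ Z a v
    Z-scale a {f} {v} f≢0 fL≡f with fixed⇒power f≢0 fL≡f
    ... | g , g≢0 , f≡gK = trans (sum-scale g≢0 (λ u → 𝟙 (Λ (a * u ^ K) ≟ f * v)))
      (sum-cong-≗ λ u → trans (cong (λ x → 𝟙 (x ≟ f * v)) (pull u))
        (𝟙-cong (f * Λ (a * u ^ K) ≟ f * v) (Λ (a * u ^ K) ≟ v) (*-cancelˡ f≢0) (cong (f *_))))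
      where
      pull : ∀ u → Λ (a * (g * u) ^ K) ≡ f * Λ (a * u ^ K)
      pull u = trans (cong (λ x → Λ (a * x)) (^-distrib-* g u K))
        (trans (cong Λ (solve 3 (λ a g u → a :* (g :* u) := g :* (a :* u)) refl a (g ^ K) (u ^ K)))
          (trans (cong (λ x → Λ (x * (a * u ^ K))) (sym f≡gK)) (Λ-scale fL≡f (a * u ^ K))))

    module SecondMoment (a : Fin n) (a≢0 : a ≢ 0#) where

      Z₀ Z₁ : ℕ
      Z₀ = Z a 0#
      Z₁ = Z a v₁

      -- The fiber sizes are Z₀ at 0, Z₁ on all of V*, and 0 outside the kernel of `tr`, where p 0 =
      -- 0 removes the contribution. The function `p` is the identity for the first moment and the
      -- square for the second.
      Z-formula : ∀ (p : ℕ → ℕ) → p 0 ≡ 0 → ∀ v → p (Z a v) ≡ 𝟙 (0# ≟ v) ℕ.* p Z₀ ℕ.+ 𝟙 (isV*? v) ℕ.* p Z₁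
      Z-formula p p0≡0 v = by-cases (0# ≟ v) (tr v ≟ 0#)
        where
        by-cases : Dec (0# ≡ v) → Dec (tr v ≡ 0#) → p (Z a v) ≡ 𝟙 (0# ≟ v) ℕ.* p Z₀ ℕ.+ 𝟙 (isV*? v) ℕ.* p Z₁
        by-cases (yes 0≡v) _ = sym (begin
          𝟙 (0# ≟ v) ℕ.* p Z₀ ℕ.+ 𝟙 (isV*? v) ℕ.* p Z₁
            ≡⟨ cong₂ (λ x y → x ℕ.* p Z₀ ℕ.+ y ℕ.* p Z₁) (𝟙-yes (0# ≟ v) 0≡v) (𝟙-no (isV*? v) (λ h → proj₁ h (sym 0≡v))) ⟩
          1 ℕ.* p Z₀ ℕ.+ 0       ≡⟨ trans (ℕₚ.+-identityʳ (1 ℕ.* p Z₀)) (ℕₚ.*-identityˡ (p Z₀)) ⟩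
          p Z₀                   ≡⟨ cong (λ x → p (Z a x)) 0≡v ⟩
          p (Z a v)              ∎)
        by-cases (no 0≢v) (yes trv≡0) = sym (begin
          𝟙 (0# ≟ v) ℕ.* p Z₀ ℕ.+ 𝟙 (isV*? v) ℕ.* p Z₁
            ≡⟨ cong₂ (λ x y → x ℕ.* p Z₀ ℕ.+ y ℕ.* p Z₁) (𝟙-no (0# ≟ v) 0≢v) (𝟙-yes (isV*? v) ((λ v≡0 → 0≢v (sym v≡0)) , trv≡0)) ⟩
          1 ℕ.* p Z₁             ≡⟨ ℕₚ.*-identityˡ (p Z₁) ⟩
          p Z₁                   ≡⟨ cong p (Z-scale a f≢0 (proj₁ (proj₂ q))) ⟨
          p (Z a (proj₁ q * v₁)) ≡⟨ cong (λ x → p (Z a x)) (proj₂ (proj₂ q)) ⟩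
          p (Z a v)              ∎)
          where
          q : ∃ λ f → f ^ L ≡ f × f * v₁ ≡ v
          q = ratio v₁≢0 tr-v₁ trv≡0
          f≢0 : proj₁ q ≢ 0#
          f≢0 f≡0 = 0≢v (trans (sym (zeroˡ v₁)) (trans (cong (_* v₁) (sym f≡0)) (proj₂ (proj₂ q))))
        by-cases (no 0≢v) (no trv≢0) = trans (cong p (sum-zero {f = λ u → 𝟙 (Λ (a * u ^ K) ≟ v)} λ u →
          𝟙-no (Λ (a * u ^ K) ≟ v) (λ eq → trv≢0 (trans (cong tr (sym eq)) (tr-Λ (a * u ^ K))))))
          (trans p0≡0 (sym (cong₂ (λ x y → x ℕ.* p Z₀ ℕ.+ y ℕ.* p Z₁) (𝟙-no (0# ≟ v) 0≢v) (𝟙-no (isV*? v) (λ h → trv≢0 (proj₂ h))))))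

      sum-Z : ∀ (p : ℕ → ℕ) → p 0 ≡ 0 → sum (λ v → p (Z a v)) ≡ p Z₀ ℕ.+ L′ ℕ.* p Z₁
      sum-Z p p0≡0 = begin
        sum (λ v → p (Z a v))
          ≡⟨ sum-cong-≗ (Z-formula p p0≡0) ⟩
        sum (λ v → 𝟙 (0# ≟ v) ℕ.* p Z₀ ℕ.+ 𝟙 (isV*? v) ℕ.* p Z₁)
          ≡⟨ ∑-distrib-+ (λ v → 𝟙 (0# ≟ v) ℕ.* p Z₀) (λ v → 𝟙 (isV*? v) ℕ.* p Z₁) ⟩
        sum (λ v → 𝟙 (0# ≟ v) ℕ.* p Z₀) ℕ.+ sum (λ v → 𝟙 (isV*? v) ℕ.* p Z₁)
          ≡⟨ cong₂ ℕ._+_ (sum-pick 0# (λ _ → p Z₀)) (trans (sym (*-distribʳ-sum (p Z₁) (λ v → 𝟙 (isV*? v)))) (cong (ℕ._* p Z₁) #V*)) ⟩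
        p Z₀ ℕ.+ L′ ℕ.* p Z₁ ∎

      first-moment : Z₀ ℕ.+ L′ ℕ.* Z₁ ≡ n
      first-moment = trans (sym (sum-Z (λ x → x) refl)) (fiber-total (λ u → Λ (a * u ^ K)))

      -- Both sides count the pairs with equal values of Λ(a x^K) and Λ(a y^K): by fibers on the
      -- left, and on the right by the difference u = y - x, since Λ turns the increment into a
      -- difference of values.
      collisions : Z₀ ℕ.* Z₀ ℕ.+ L′ ℕ.* (Z₁ ℕ.* Z₁) ≡ n ℕ.+ L ℕ.* sum (λ u → 𝟙 (≢0? u) ℕ.* I (a * u ^ K))
      collisions = begin
        Z₀ ℕ.* Z₀ ℕ.+ L′ ℕ.* (Z₁ ℕ.* Z₁)
          ≡⟨ sum-Z (λ x → x ℕ.* x) refl ⟨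
        sum (λ v → Z a v ℕ.* Z a v)
          ≡⟨ sum-fibers (λ u → Λ (a * u ^ K)) (Z a) ⟨
        sum (λ x → sum (λ y → 𝟙 (Λ (a * y ^ K) ≟ Λ (a * x ^ K))))
          ≡⟨ sum-cong-≗ (λ x → trans (sum-translate x (λ y → 𝟙 (Λ (a * y ^ K) ≟ Λ (a * x ^ K)))) (sum-cong-≗ λ u → shifted x u)) ⟩
        sum (λ x → sum (λ u → 𝟙 (Λ (a * H u x) ≟ 0#)))
          ≡⟨ ∑-comm (λ x u → 𝟙 (Λ (a * H u x) ≟ 0#)) ⟩
        sum (λ u → sum (λ x → 𝟙 (Λ (a * H u x) ≟ 0#)))
          ≡⟨ sum-H (λ h → 𝟙 (Λ (a * h) ≟ 0#)) ⟩
        n ℕ.* 𝟙 (Λ (a * 0#) ≟ 0#) ℕ.+ L ℕ.* sum (λ u → 𝟙 (≢0? u) ℕ.* sum (λ r → 𝟙 (Λ r ≟ 0#) ℕ.* 𝟙 (Λ (a * (u ^ K * r)) ≟ 0#)))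
          ≡⟨ cong₂ (λ x y → x ℕ.+ L ℕ.* y) (trans (cong (n ℕ.*_) (𝟙-yes (Λ (a * 0#) ≟ 0#) (Λ-at-0 a))) (ℕₚ.*-identityʳ n))
               (sum-cong-≗ λ u → cong (𝟙 (≢0? u) ℕ.*_) (sum-cong-≗ λ r → cong (λ x → 𝟙 (Λ r ≟ 0#) ℕ.* 𝟙 (Λ x ≟ 0#)) (sym (*-assoc a (u ^ K) r)))) ⟩
        n ℕ.+ L ℕ.* sum (λ u → 𝟙 (≢0? u) ℕ.* I (a * u ^ K)) ∎
        where
        shifted : ∀ x u → 𝟙 (Λ (a * (x + u) ^ K) ≟ Λ (a * x ^ K)) ≡ 𝟙 (Λ (a * H u x) ≟ 0#)
        shifted x u = trans (cong (λ y → 𝟙 (y ≟ Λ (a * x ^ K)))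
            (trans (cong (λ y → Λ (a * y)) (power-shift x u)) (trans (cong Λ (distribˡ a (x ^ K) (H u x))) (Λ-+ (a * x ^ K) (a * H u x)))))
          (𝟙-cong (Λ (a * x ^ K) + Λ (a * H u x) ≟ Λ (a * x ^ K)) (Λ (a * H u x) ≟ 0#)
            (λ eq → +-cancelˡ (Λ (a * x ^ K)) (trans eq (sym (+-identityʳ (Λ (a * x ^ K))))))
            (λ eq → trans (cong (Λ (a * x ^ K) +_) eq) (+-identityʳ (Λ (a * x ^ K)))))

      second-moment : L ℕ.* (Z₀ ℕ.* Z₀ ℕ.+ L′ ℕ.* (Z₁ ℕ.* Z₁)) ≡ n ℕ.* (n ℕ.+ L′ ℕ.* suc (fixedMultiples a))
      second-moment = ℕₚ.+-cancelˡ-≡ n _ _ (begin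
        n ℕ.+ L ℕ.* (Z₀ ℕ.* Z₀ ℕ.+ L′ ℕ.* (Z₁ ℕ.* Z₁))
          ≡⟨ cong (λ x → n ℕ.+ L ℕ.* x) collisions ⟩
        n ℕ.+ L ℕ.* (n ℕ.+ L ℕ.* Σ)
          ≡⟨ cong (λ x → n ℕ.+ L ℕ.* (n ℕ.+ x)) total ⟩
        n ℕ.+ L ℕ.* (n ℕ.+ w₀ ℕ.* (N* ℕ.+ L′ ℕ.* R))
          ≡⟨ rearrange n L′ w₀ N* R ⟩
        n ℕ.+ ((n ℕ.+ L′ ℕ.* n) ℕ.+ L ℕ.* w₀ ℕ.* (N* ℕ.+ L′ ℕ.* R))
          ≡⟨ cong (λ x → n ℕ.+ ((n ℕ.+ L′ ℕ.* n) ℕ.+ x ℕ.* (N* ℕ.+ L′ ℕ.* R))) (sym n≡L*w₀) ⟩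
        n ℕ.+ ((n ℕ.+ L′ ℕ.* n) ℕ.+ n ℕ.* (N* ℕ.+ L′ ℕ.* R))
          ≡⟨ collect n L′ N* R ⟩
        n ℕ.+ n ℕ.* (suc N* ℕ.+ L′ ℕ.* suc R)
          ≡⟨ cong (λ x → n ℕ.+ n ℕ.* (x ℕ.+ L′ ℕ.* suc R)) #nonzero ⟩
        n ℕ.+ n ℕ.* (n ℕ.+ L′ ℕ.* suc R) ∎)
        where
        Σ N* R : ℕ
        Σ = sum (λ u → 𝟙 (≢0? u) ℕ.* I (a * u ^ K))
        N* = sum (λ u → 𝟙 (≢0? u))
        R = fixedMultiples a
        rearrange : ∀ n l w x r → n ℕ.+ (1 ℕ.+ l) ℕ.* (n ℕ.+ w ℕ.* (x ℕ.+ l ℕ.* r)) ≡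
          n ℕ.+ ((n ℕ.+ l ℕ.* n) ℕ.+ (1 ℕ.+ l) ℕ.* w ℕ.* (x ℕ.+ l ℕ.* r))
        rearrange = ℕ-Solver.solve-∀
        collect : ∀ n l x r → n ℕ.+ ((n ℕ.+ l ℕ.* n) ℕ.+ n ℕ.* (x ℕ.+ l ℕ.* r)) ≡ n ℕ.+ n ℕ.* (1 ℕ.+ x ℕ.+ l ℕ.* (1 ℕ.+ r))
        collect = ℕ-Solver.solve-∀
        regroup : ∀ b w l x → b ℕ.* (w ℕ.* (1 ℕ.+ l ℕ.* x)) ≡ w ℕ.* (b ℕ.+ l ℕ.* (b ℕ.* x))
        regroup = ℕ-Solver.solve-∀
        swap : ∀ l b x → l ℕ.* (b ℕ.* x) ≡ b ℕ.* (l ℕ.* x)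
        swap = ℕ-Solver.solve-∀
        total : L ℕ.* Σ ≡ w₀ ℕ.* (N* ℕ.+ L′ ℕ.* R)
        total = begin
          L ℕ.* Σ
            ≡⟨ *-distribˡ-sum L (λ u → 𝟙 (≢0? u) ℕ.* I (a * u ^ K)) ⟩
          sum (λ u → L ℕ.* (𝟙 (≢0? u) ℕ.* I (a * u ^ K)))
            ≡⟨ sum-cong-≗ (λ u → trans (swap L (𝟙 (≢0? u)) (I (a * u ^ K)))
                 (trans (cong (𝟙 (≢0? u) ℕ.*_) (I-formula (a * u ^ K)))
                   (regroup (𝟙 (≢0? u)) w₀ L′ (𝟙 ((a * u ^ K) ^ L ≟ a * u ^ K))))) ⟩
          sum (λ u → w₀ ℕ.* (𝟙 (≢0? u) ℕ.+ L′ ℕ.* (𝟙 (≢0? u) ℕ.* 𝟙 ((a * u ^ K) ^ L ≟ a * u ^ K))))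
            ≡⟨ *-distribˡ-sum w₀ (λ u → 𝟙 (≢0? u) ℕ.+ L′ ℕ.* (𝟙 (≢0? u) ℕ.* 𝟙 ((a * u ^ K) ^ L ≟ a * u ^ K))) ⟨
          w₀ ℕ.* sum (λ u → 𝟙 (≢0? u) ℕ.+ L′ ℕ.* (𝟙 (≢0? u) ℕ.* 𝟙 ((a * u ^ K) ^ L ≟ a * u ^ K)))
            ≡⟨ cong (w₀ ℕ.*_) (trans (∑-distrib-+ (λ u → 𝟙 (≢0? u)) (λ u → L′ ℕ.* (𝟙 (≢0? u) ℕ.* 𝟙 ((a * u ^ K) ^ L ≟ a * u ^ K))))
                 (cong (N* ℕ.+_) (sym (*-distribˡ-sum L′ (λ u → 𝟙 (≢0? u) ℕ.* 𝟙 ((a * u ^ K) ^ L ≟ a * u ^ K)))))) ⟩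
          w₀ ℕ.* (N* ℕ.+ L′ ℕ.* R) ∎

      -- Nonzero u come in classes of K with the same u^K, while u = 0 contributes to Z₀ and not to
      -- Z₁. Hence Z₀ - Z₁ ≡ 1 modulo K.
      Z₀-mod-K : ∃ λ c → Z₀ ≡ suc (K ℕ.* c)
      Z₀-mod-K = sum (λ y → 𝟙 (isPower? y) ℕ.* 𝟙 (Λ (a * y) ≟ 0#)) ,
        trans (sum-powers (λ y → 𝟙 (Λ (a * y) ≟ 0#)))
          (cong (ℕ._+ K ℕ.* sum (λ y → 𝟙 (isPower? y) ℕ.* 𝟙 (Λ (a * y) ≟ 0#))) (𝟙-yes (Λ (a * 0#) ≟ 0#) (Λ-at-0 a)))

      Z₁-mod-K : ∃ λ c → Z₁ ≡ K ℕ.* c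
      Z₁-mod-K = sum (λ y → 𝟙 (isPower? y) ℕ.* 𝟙 (Λ (a * y) ≟ v₁)) ,
        trans (sum-powers (λ y → 𝟙 (Λ (a * y) ≟ v₁)))
          (cong (ℕ._+ K ℕ.* sum (λ y → 𝟙 (isPower? y) ℕ.* 𝟙 (Λ (a * y) ≟ v₁)))
            (𝟙-no (Λ (a * 0#) ≟ v₁) (λ eq → v₁≢0 (trans (sym eq) (Λ-at-0 a)))))

    -- The element -1 is fixed by x ↦ x^L, hence a K-th power; this makes the graph undirected.
    τ-neg : ∀ y → τ (- y) ≡ τ y
    τ-neg y with fixed⇒power {f = - 1#} (σ≢0-1) -1-fixed
      where
      σ≢0-1 : - 1# ≢ 0#
      σ≢0-1 -1≡0 = σ≢0 1 (trans (*-identityʳ (- 1#)) -1≡0)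
      -1-fixed : (- 1#) ^ L ≡ - 1#
      -1-fixed = trans (frob-neg 1#) (cong -_ (1^m≡1 L))
    ... | g , g≢0 , -1≡gK = trans (sum-scale g≢0 (λ x → 𝟙 (x ^ K ≟ - y)))
      (sum-cong-≗ λ x → 𝟙-cong ((g * x) ^ K ≟ - y) (x ^ K ≟ y)
        (λ eq → trans (sym (neg-involutive (x ^ K))) (trans (cong -_ (trans (sym (pull x)) eq)) (neg-involutive y)))
        (λ eq → trans (pull x) (cong -_ eq)))
      where
      pull : ∀ x → (g * x) ^ K ≡ - (x ^ K)
      pull x = trans (^-distrib-* g x K) (trans (cong (_* x ^ K) (sym -1≡gK))
        (trans (sym (-‿distribˡ-* 1# (x ^ K))) (cong -_ (*-identityˡ (x ^ K)))))

-- The quadratic relation of the adjacency matrix and its characteristic polynomial.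

module PowerCayleyGraph where

  open FiniteFields using (FieldOn; module FieldTheory; IsAdditivePower)
  open HermitianSums using (module Hermitian)
  open Counting using (𝟙; 𝟙-yes; 𝟙-no; sum-const; fiber-total)
  open Determinants using (Matrix; det; det-cong; δ; δ-refl; δ-≢; sum; sum-cong-≗; ∑-distrib-+; *-distribˡ-sum; sum-δˡ; sum-δʳ; _⊗_; _≑_)
  open IntegerPolynomials using (*-cancelˡ; eval; eval-charPoly; eventually-equal)
  open ScaledIdempotents using (_*ₛ_; trace; sum-replicate-ℤ)
  open StronglyRegularSpectrum using (J; projector; charPoly-factors)
  open import Defs using (charPoly; lin; _*P_; _^P_; _≈P_)
  open import Data.Nat as ℕ using (ℕ; zero; suc)
  import Data.Nat.Properties as ℕₚ
  import Data.Nat.Divisibility as ℕ∣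
  open import Data.Integer hiding (suc)
  open import Data.Integer.Properties hiding (*-cancelˡ-≡)
  open import Data.Integer.Tactic.RingSolver using (solve-∀)
  open import Data.Fin using (Fin; zero; suc)
  open import Data.Product using (∃; ∃₂; _×_; _,_; proj₁; proj₂)
  open import Data.Sum using (_⊎_; inj₁; inj₂)
  open import Function using (_∘_)
  open import Relation.Nullary using (Dec; yes; no; ¬_; contradiction)
  open import Relation.Binary.PropositionalEquality hiding (J)
  open ≡-Reasoning

  sum-pos : ∀ {n} (f : Fin n → ℕ) → sum (λ i → + f i) ≡ + Counting.sum f
  sum-pos {zero}  f = refl
  sum-pos {suc n} f = cong (_+_ (+ f zero)) (sum-pos (f ∘ suc))

  -- This is (-l)^i, kept as a sign times a natural power to match ε q^(m/2) in the theorem; at l =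
  -- L and i = s it is B.
  signedPower : ℕ → ℕ → ℤ
  signedPower l i = -[1+ 0 ] ^ i * + (l ℕ.^ i)

  signedPower-suc : ∀ l i → signedPower l (suc i) ≡ - (+ l * signedPower l i)
  signedPower-suc l i = trans (cong (-1ℤ * -1ℤ ^ i *_) (pos-* l (l ℕ.^ i))) (regroup (-1ℤ ^ i) (+ l) (+ (l ℕ.^ i)))
    where
    regroup : ∀ e a b → -1ℤ * e * (a * b) ≡ - (a * (e * b))
    regroup = solve-∀

  signedPower² : ∀ l i → signedPower l i * signedPower l i ≡ + (l ℕ.^ (i ℕ.+ i))
  signedPower² l zero    = refl
  signedPower² l (suc i) = begin
    signedPower l (suc i) * signedPower l (suc i)
      ≡⟨ cong₂ _*_ (signedPower-suc l i) (signedPower-suc l i) ⟩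
    - (+ l * signedPower l i) * - (+ l * signedPower l i)
      ≡⟨ regroup (+ l) (signedPower l i) ⟩
    + l * (+ l * (signedPower l i * signedPower l i))
      ≡⟨ cong (λ x → + l * (+ l * x)) (signedPower² l i) ⟩
    + l * (+ l * + (l ℕ.^ (i ℕ.+ i)))
      ≡⟨ trans (cong (+ l *_) (sym (pos-* l (l ℕ.^ (i ℕ.+ i))))) (sym (pos-* l (l ℕ.^ suc (i ℕ.+ i)))) ⟩
    + (l ℕ.^ suc (suc (i ℕ.+ i)))
      ≡⟨ cong (λ j → + (l ℕ.^ suc j)) (ℕₚ.+-suc i i) ⟨
    + (l ℕ.^ (suc i ℕ.+ suc i)) ∎
    where
    regroup : ∀ l b → - (l * b) * - (l * b) ≡ l * (l * (b * b))
    regroup = solve-∀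

  -- (-L)^i = 1 + (L + 1) υᵢ.
  restrictedEigenvalue : ℕ → ℕ → ℤ
  restrictedEigenvalue l zero    = 0ℤ
  restrictedEigenvalue l (suc i) = -1ℤ - + l * restrictedEigenvalue l i

  signedPower-υ : ∀ l i → signedPower l i ≡ 1ℤ + + suc l * restrictedEigenvalue l i
  signedPower-υ l zero    = sym (trans (cong (_+_ 1ℤ) (*-zeroʳ (+ suc l))) (+-identityʳ 1ℤ))
  signedPower-υ l (suc i) = trans (signedPower-suc l i) (trans (cong (λ x → - (+ l * x)) (signedPower-υ l i))
    (regroup (+ l) (restrictedEigenvalue l i)))
    where
    regroup : ∀ l u → - (l * (1ℤ + (1ℤ + l) * u)) ≡ 1ℤ + (1ℤ + l) * (-1ℤ - l * u)
    regroup = solve-∀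

  x²≡y²⇒x≡±y : ∀ x y → x * x ≡ y * y → x ≡ y ⊎ x ≡ - y
  x²≡y²⇒x≡±y x y eq = cases (i*j≡0⇒i≡0∨j≡0 (x - y) (trans (factor x y) (i≡j⇒i-j≡0 eq)))
    where
    factor : ∀ x y → (x - y) * (x + y) ≡ x * x - y * y
    factor = solve-∀
    cases : x - y ≡ 0ℤ ⊎ x + y ≡ 0ℤ → x ≡ y ⊎ x ≡ - y
    cases (inj₁ x-y≡0) = inj₁ (i-j≡0⇒i≡j x y x-y≡0)
    cases (inj₂ x+y≡0) = inj₂ (i-j≡0⇒i≡j x (- y) (trans (cong (_+_ x) (neg-involutive y)) x+y≡0))

  -- K = L + 1 ≥ 3 does not divide 2, so the residues 1 and -1 modulo K differ and a square root is
  -- determined by its residue.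
  multiple≢2 : ∀ k x → + (3 ℕ.+ k) * x ≢ + 2
  multiple≢2 k x eq = ℕₚ.<⇒≱ (ℕ.s≤s (ℕ.s≤s (ℕ.s≤s ℕ.z≤n)))
    (ℕ∣.∣⇒≤ (ℕ∣.divides ∣ x ∣ (trans (cong ∣_∣ (sym eq)) (trans (∣i*j∣≡∣i∣*∣j∣ (+ (3 ℕ.+ k)) x) (ℕₚ.*-comm (3 ℕ.+ k) ∣ x ∣)))))

  module _ {n : ℕ} (𝔽 : FieldOn n) (L″ s′ : ℕ)
    (n≡ : n ≡ suc (suc L″) ℕ.^ (suc s′ ℕ.+ suc s′))
    (frob-+ : IsAdditivePower 𝔽 (suc (suc L″))) where

    private
      module H = Hermitian 𝔽 (suc L″) s′ (ℕ.s≤s ℕ.z≤n) n≡ frob-+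
      module 𝔽 = FieldTheory 𝔽
    open H using (L; K; M; s; τ; Z; IsPower; isPower?; fixedMultiples)

    B υ k l : ℤ
    B = signedPower L s
    υ = restrictedEigenvalue L s
    k = + M
    l = + suc L″

    B≡1+Kυ : B ≡ 1ℤ + + K * υ
    B≡1+Kυ = signedPower-υ L s

    B²≡n : B * B ≡ + n
    B²≡n = trans (signedPower² L s) (cong +_ (sym n≡))

    n≡1+KM : + n ≡ 1ℤ + + K * k
    n≡1+KM = trans (cong +_ H.n≡1+KM) (cong (_+_ 1ℤ) (pos-* K M))

    -- Kk = n - 1 = (B + 1)(B - 1) and B - 1 = Kυ.
    k≡υ+Bυ : k ≡ υ + B * υ
    k≡υ+Bυ = *-cancelˡ (+ K) (λ ()) (begin
      + K * k                          ≡⟨ drop-1 (+ K * k) ⟩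
      1ℤ + + K * k - 1ℤ                ≡⟨ cong (_- 1ℤ) (trans (sym n≡1+KM) (sym B²≡n)) ⟩
      B * B - 1ℤ                       ≡⟨ factor B ⟩
      (1ℤ + B) * (B - 1ℤ)              ≡⟨ cong (λ x → (1ℤ + B) * (x - 1ℤ)) B≡1+Kυ ⟩
      (1ℤ + B) * (1ℤ + + K * υ - 1ℤ)   ≡⟨ regroup B (+ K) υ ⟩
      + K * (υ + B * υ)                ∎)
      where
      drop-1 : ∀ x → x ≡ 1ℤ + x - 1ℤ
      drop-1 = solve-∀
      factor : ∀ b → b * b - 1ℤ ≡ (1ℤ + b) * (b - 1ℤ)
      factor = solve-∀
      regroup : ∀ b k u → (1ℤ + b) * (1ℤ + k * u - 1ℤ) ≡ k * (u + b * u)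
      regroup = solve-∀

    module _ (a : Fin n) (a≢0 : a ≢ 𝔽.0#) where
      private
        module S = H.SecondMoment a a≢0
      open S using (Z₀; Z₁)

      difference : ℤ
      difference = + Z₀ - + Z₁

      first-moment : + Z₀ + l * + Z₁ ≡ + n
      first-moment = trans (cong (_+_ (+ Z₀)) (sym (pos-* (suc L″) Z₁))) (cong +_ S.first-moment)

      difference-mod-K : ∃ λ c → difference ≡ 1ℤ + + K * c
      difference-mod-K = + c₀ - + c₁ , (begin
        + Z₀ - + Z₁                          ≡⟨ cong₂ (λ x y → + x - + y) (proj₂ S.Z₀-mod-K) (proj₂ S.Z₁-mod-K) ⟩
        1ℤ + + (K ℕ.* c₀) - + (K ℕ.* c₁)     ≡⟨ cong₂ (λ x y → 1ℤ + x - y) (pos-* K c₀) (pos-* K c₁) ⟩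
        1ℤ + + K * + c₀ - + K * + c₁         ≡⟨ regroup (+ K) (+ c₀) (+ c₁) ⟩
        1ℤ + + K * (+ c₀ - + c₁)             ∎)
        where
        c₀ c₁ : ℕ
        c₀ = proj₁ S.Z₀-mod-K
        c₁ = proj₁ S.Z₁-mod-K
        regroup : ∀ k x y → 1ℤ + k * x - k * y ≡ 1ℤ + k * (x - y)
        regroup = solve-∀

      -- The variance identity (1 + l)(x² + l y²) - (x + l y)² = l (x - y)² expresses the square
      -- through the two moments.
      difference² : difference * difference ≡ + n * + suc (fixedMultiples a)
      difference² = *-cancelˡ l (λ ()) (begin
        l * ((+ Z₀ - + Z₁) * (+ Z₀ - + Z₁))
          ≡⟨ expand l (+ Z₀) (+ Z₁) ⟩
        (1ℤ + l) * (+ Z₀ * + Z₀ + l * (+ Z₁ * + Z₁)) - (+ Z₀ + l * + Z₁) * (+ Z₀ + l * + Z₁)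
          ≡⟨ cong₂ (λ x y → x - y * y) second first-moment ⟩
        + n * (+ n + l * r) - + n * + n
          ≡⟨ collect l (+ n) r ⟩
        l * (+ n * r) ∎)
        where
        r : ℤ
        r = + suc (fixedMultiples a)
        expand : ∀ l x y → l * ((x - y) * (x - y)) ≡ (1ℤ + l) * (x * x + l * (y * y)) - (x + l * y) * (x + l * y)
        expand = solve-∀
        collect : ∀ l n r → n * (n + l * r) - n * n ≡ l * (n * r)
        collect = solve-∀
        second : (1ℤ + l) * (+ Z₀ * + Z₀ + l * (+ Z₁ * + Z₁)) ≡ + n * (+ n + l * r)
        second = begin
          + L * (+ Z₀ * + Z₀ + l * (+ Z₁ * + Z₁))
            ≡⟨ cong₂ (λ x y → + L * (x + y)) (pos-* Z₀ Z₀) (trans (pos-* (suc L″) (Z₁ ℕ.* Z₁)) (cong (l *_) (pos-* Z₁ Z₁))) ⟨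
          + L * + (Z₀ ℕ.* Z₀ ℕ.+ suc L″ ℕ.* (Z₁ ℕ.* Z₁))
            ≡⟨ pos-* L (Z₀ ℕ.* Z₀ ℕ.+ suc L″ ℕ.* (Z₁ ℕ.* Z₁)) ⟨
          + (L ℕ.* (Z₀ ℕ.* Z₀ ℕ.+ suc L″ ℕ.* (Z₁ ℕ.* Z₁)))
            ≡⟨ cong +_ S.second-moment ⟩
          + (n ℕ.* (n ℕ.+ suc L″ ℕ.* suc (fixedMultiples a)))
            ≡⟨ pos-* n (n ℕ.+ suc L″ ℕ.* suc (fixedMultiples a)) ⟩
          + n * (+ n + + (suc L″ ℕ.* suc (fixedMultiples a)))
            ≡⟨ cong (λ x → + n * (+ n + x)) (pos-* (suc L″) (suc (fixedMultiples a))) ⟩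
          + n * (+ n + l * r) ∎

      -- The squares determine the differences up to sign, and the sign is decided modulo K ≥ 3.
      difference-nonpower : ¬ IsPower a → difference ≡ B
      difference-nonpower ¬P = cases (x²≡y²⇒x≡±y difference B (begin
        difference * difference               ≡⟨ difference² ⟩
        + n * + suc (fixedMultiples a)        ≡⟨ cong (λ r → + n * + suc r) (H.fixedMultiples-nonpower a≢0 ¬P) ⟩
        + n * 1ℤ                              ≡⟨ *-identityʳ (+ n) ⟩
        + n                                   ≡⟨ B²≡n ⟨
        B * B                                 ∎))
        where
        c : ℤ
        c = proj₁ difference-mod-K
        two : ∀ k c u → k * - (c + u) ≡ + 2 - (1ℤ + k * c) - (1ℤ + k * u)
        two = solve-∀
        cancel : ∀ b → + 2 - - b - b ≡ + 2
        cancel = solve-∀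
        cases : difference ≡ B ⊎ difference ≡ - B → difference ≡ B
        cases (inj₁ eq) = eq
        -- The numbers 1 + Kc = -B and 1 + Kυ = B would add up to 0, so K would divide 2.
        cases (inj₂ eq) = contradiction (begin
          + K * - (c + υ)                             ≡⟨ two (+ K) c υ ⟩
          + 2 - (1ℤ + + K * c) - (1ℤ + + K * υ)       ≡⟨ cong₂ (λ x y → + 2 - x - y) (trans (sym (proj₂ difference-mod-K)) eq) (sym B≡1+Kυ) ⟩
          + 2 - - B - B                               ≡⟨ cancel B ⟩
          + 2                                         ∎) (multiple≢2 L″ (- (c + υ)))

      difference-power : IsPower a → difference ≡ - (+ L * B)
      difference-power P = cases (x²≡y²⇒x≡±y difference (+ L * B) (begin
        difference * difference                   ≡⟨ difference² ⟩
        + n * + suc (fixedMultiples a)            ≡⟨ cong (λ r → + n * + suc r) (H.fixedMultiples-power P) ⟩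
        + n * (1ℤ + + (K ℕ.* suc L″))             ≡⟨ cong₂ (λ x y → x * (1ℤ + y)) (sym B²≡n) (pos-* K (suc L″)) ⟩
        B * B * (1ℤ + (+ 2 + l) * l)              ≡⟨ square B l ⟩
        (1ℤ + l) * B * ((1ℤ + l) * B)             ∎))
        where
        c : ℤ
        c = proj₁ difference-mod-K
        square : ∀ b l → b * b * (1ℤ + (+ 2 + l) * l) ≡ (1ℤ + l) * b * ((1ℤ + l) * b)
        square = solve-∀
        two : ∀ l c u → (+ 2 + l) * (1ℤ + (1ℤ + l) * u - c) ≡ (1ℤ + l) * (1ℤ + (+ 2 + l) * u) - (1ℤ + (+ 2 + l) * c) + + 2
        two = solve-∀
        cancel : ∀ b → b - b + + 2 ≡ + 2
        cancel = solve-∀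
        cases : difference ≡ + L * B ⊎ difference ≡ - (+ L * B) → difference ≡ - (+ L * B)
        cases (inj₂ eq) = eq
        -- LB ≡ L ≡ -1 modulo K, whereas the difference is ≡ 1.
        cases (inj₁ eq) = contradiction (begin
          + K * (1ℤ + + L * υ - c)                                  ≡⟨ two l c υ ⟩
          + L * (1ℤ + + K * υ) - (1ℤ + + K * c) + + 2               ≡⟨ cong₂ (λ x y → + L * x - y + + 2) (sym B≡1+Kυ) (trans (sym (proj₂ difference-mod-K)) eq) ⟩
          + L * B - + L * B + + 2                                   ≡⟨ cancel (+ L * B) ⟩
          + 2                                                       ∎) (multiple≢2 L″ (1ℤ + + L * υ - c))

      L*Z₀ : + L * + Z₀ ≡ + n + l * difference
      L*Z₀ = trans (regroup l (+ Z₀) (+ Z₁)) (cong (_+ l * difference) first-moment)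
        where
        regroup : ∀ l x y → (1ℤ + l) * x ≡ x + l * y + l * (x - y)
        regroup = solve-∀

    -- The number of pairs (x, y) with x^K - y^K = a, where z stands for x^K.
    conv : Fin n → ℤ
    conv a = + Counting.sum (λ z → τ z ℕ.* τ (𝔽.- a 𝔽.+ z))

    is0 : Fin n → ℤ
    is0 a = + 𝟙 (𝔽.0# 𝔽.≟ a)

    conv+L : ∀ a → conv a + + L ≡ + n * is0 a + + L * + Z a 𝔽.0#
    conv+L a = trans (cong +_ (H.convolution a)) (cong₂ _+_ (pos-* n (𝟙 (𝔽.0# 𝔽.≟ a))) (pos-* L (Z a 𝔽.0#)))

    τ≡ : ∀ a → + τ a ≡ is0 a + + K * + 𝟙 (isPower? a)
    τ≡ a = trans (cong +_ (H.τ-formula a)) (cong (_+_ (is0 a)) (pos-* K (𝟙 (isPower? a))))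

    -- The cases a = 0, a a K-th power, and neither fit one expression affine in `τ a` and `is0 a`.
    -- Read at a = j - i it writes the matrix T² as a combination of J, T and I.
    conv-formula : ∀ a → conv a ≡ (B - 1ℤ) * (B + + L) - l * B * + τ a + + L * + n * is0 a
    conv-formula a = by-cases (𝔽.0# 𝔽.≟ a) (isPower? a)
      where
      Goal : Set
      Goal = conv a ≡ (B - 1ℤ) * (B + + L) - l * B * + τ a + + L * + n * is0 a
      reduce : ∀ e t z → is0 a ≡ e → + τ a ≡ t → + L * + Z a 𝔽.0# ≡ z →
        + n * e + z - + L ≡ (B - 1ℤ) * (B + + L) - l * B * t + + L * + n * e → Goal
      reduce e t z e≡ t≡ z≡ eq = begin
        conv a                                          ≡⟨ add-sub (conv a) (+ L) ⟩
        conv a + + L - + L                              ≡⟨ cong (_- + L) (conv+L a) ⟩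
        + n * is0 a + + L * + Z a 𝔽.0# - + L            ≡⟨ cong₂ (λ x y → + n * x + y - + L) e≡ z≡ ⟩
        + n * e + z - + L                               ≡⟨ eq ⟩
        (B - 1ℤ) * (B + + L) - l * B * t + + L * + n * e
          ≡⟨ cong₂ (λ x y → (B - 1ℤ) * (B + + L) - l * B * x + + L * + n * y) t≡ e≡ ⟨
        (B - 1ℤ) * (B + + L) - l * B * + τ a + + L * + n * is0 a ∎
        where
        add-sub : ∀ x y → x ≡ x + y - y
        add-sub = solve-∀
      by-cases : Dec (𝔽.0# ≡ a) → Dec (IsPower a) → Goal
      by-cases (yes 0≡a) _ = reduce 1ℤ 1ℤ (+ L * + n) is0≡1 τ≡1 (cong (λ x → + L * + x) Z≡n)
        (trans (cong (λ x → x * 1ℤ + + L * + n - + L) (sym B²≡n)) (identity B l (+ n)))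
        where
        is0≡1 : is0 a ≡ 1ℤ
        is0≡1 = cong +_ (𝟙-yes (𝔽.0# 𝔽.≟ a) 0≡a)
        ¬P : ¬ IsPower a
        ¬P (x , x≢0 , eq) = 𝔽.x^m≢0 K x≢0 (trans (sym eq) (sym 0≡a))
        τ≡1 : + τ a ≡ 1ℤ
        τ≡1 = trans (τ≡ a) (trans (cong₂ (λ x y → x + + K * + y) is0≡1 (𝟙-no (isPower? a) ¬P)) (cong (_+_ 1ℤ) (*-zeroʳ (+ K))))
        Z≡n : Z a 𝔽.0# ≡ n
        Z≡n = trans (Counting.sum-cong-≗ λ u → 𝟙-yes (H.Λ (a 𝔽.* u 𝔽.^ K) 𝔽.≟ 𝔽.0#)
          (trans (cong (λ x → H.Λ (x 𝔽.* u 𝔽.^ K)) (sym 0≡a)) (trans (cong H.Λ (𝔽.zeroˡ (u 𝔽.^ K))) H.Λ-0)))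
          (trans (sum-const n 1) (ℕₚ.*-identityʳ n))
        identity : ∀ b l n → b * b * 1ℤ + (1ℤ + l) * n - (1ℤ + l) ≡ (b - 1ℤ) * (b + (1ℤ + l)) - l * b * 1ℤ + (1ℤ + l) * n * 1ℤ
        identity = solve-∀
      by-cases (no 0≢a) (yes P) = reduce 0ℤ (+ K) (+ n + l * - (+ L * B)) is0≡0 τ≡K
        (trans (L*Z₀ a (0≢a ∘ sym)) (cong (λ x → + n + l * x) (difference-power a (0≢a ∘ sym) P)))
        (trans (cong (λ x → + n * 0ℤ + (x + l * - (+ L * B)) - + L) (sym B²≡n)) (identity B l (+ n)))
        where
        is0≡0 : is0 a ≡ 0ℤ
        is0≡0 = cong +_ (𝟙-no (𝔽.0# 𝔽.≟ a) 0≢a)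
        τ≡K : + τ a ≡ + K
        τ≡K = trans (τ≡ a) (trans (cong₂ (λ x y → x + + K * + y) is0≡0 (𝟙-yes (isPower? a) P)) (trans (+-identityˡ (+ K * 1ℤ)) (*-identityʳ (+ K))))
        identity : ∀ b l n → n * 0ℤ + (b * b + l * - ((1ℤ + l) * b)) - (1ℤ + l) ≡
          (b - 1ℤ) * (b + (1ℤ + l)) - l * b * (+ 2 + l) + (1ℤ + l) * n * 0ℤ
        identity = solve-∀
      by-cases (no 0≢a) (no ¬P) = reduce 0ℤ 0ℤ (+ n + l * B) is0≡0 τ≡0
        (trans (L*Z₀ a (0≢a ∘ sym)) (cong (λ x → + n + l * x) (difference-nonpower a (0≢a ∘ sym) ¬P)))
        (trans (cong (λ x → + n * 0ℤ + (x + l * B) - + L) (sym B²≡n)) (identity B l (+ n)))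
        where
        is0≡0 : is0 a ≡ 0ℤ
        is0≡0 = cong +_ (𝟙-no (𝔽.0# 𝔽.≟ a) 0≢a)
        τ≡0 : + τ a ≡ 0ℤ
        τ≡0 = trans (τ≡ a) (trans (cong₂ (λ x y → x + + K * + y) is0≡0 (𝟙-no (isPower? a) ¬P)) (trans (+-identityˡ (+ K * 0ℤ)) (*-zeroʳ (+ K))))
        identity : ∀ b l n → n * 0ℤ + (b * b + l * b) - (1ℤ + l) ≡
          (b - 1ℤ) * (b + (1ℤ + l)) - l * b * 0ℤ + (1ℤ + l) * n * 0ℤ
        identity = solve-∀

    -- `T` counts all K-th roots of j - i, the root 0 included, so that T = I + K adj and T² is the
    -- convolution already counted.
    adj T : Matrix n
    adj i j = + 𝟙 (isPower? (j 𝔽.+ 𝔽.- i))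
    T i j = + τ (j 𝔽.+ 𝔽.- i)

    is0-difference : ∀ i j → is0 (j 𝔽.+ 𝔽.- i) ≡ δ i j
    is0-difference i j = by-cases (i 𝔽.≟ j)
      where
      by-cases : Dec (i ≡ j) → is0 (j 𝔽.+ 𝔽.- i) ≡ δ i j
      by-cases (yes refl) = trans (cong +_ (𝟙-yes (𝔽.0# 𝔽.≟ (i 𝔽.+ 𝔽.- i)) (sym (𝔽.-‿inverseʳ i)))) (sym (δ-refl i))
      by-cases (no i≢j)   = trans (cong +_ (𝟙-no (𝔽.0# 𝔽.≟ (j 𝔽.+ 𝔽.- i)) (λ eq → i≢j (sym (𝔽.x-y≡0⇒x≡y j i (sym eq)))))) (sym (δ-≢ i≢j))

    T≡ : ∀ i j → T i j ≡ δ i j + + K * adj i j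
    T≡ i j = trans (τ≡ (j 𝔽.+ 𝔽.- i)) (cong (_+ + K * adj i j) (is0-difference i j))

    total-τ : sum (λ z → + τ z) ≡ + n
    total-τ = trans (sum-pos τ) (cong +_ (fiber-total (𝔽._^ K)))

    sum-translate-ℤ : ∀ x (f : Fin n → ℕ) → sum (λ y → + f (y 𝔽.+ 𝔽.- x)) ≡ sum (λ y → + f y)
    sum-translate-ℤ x f = trans (sum-pos (λ y → f (y 𝔽.+ 𝔽.- x))) (trans (cong +_ (trans
      (Counting.sum-cong-≗ λ y → cong f (𝔽.+-comm y (𝔽.- x))) (sym (𝔽.sum-translate (𝔽.- x) f)))) (sym (sum-pos f)))

    T-row : ∀ i → sum (λ j → T i j) ≡ + n
    T-row i = trans (sum-translate-ℤ i τ) total-τ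

    neg-difference : ∀ i j → 𝔽.- (i 𝔽.+ 𝔽.- j) ≡ j 𝔽.+ 𝔽.- i
    neg-difference i j = trans (sym (𝔽.neg-distrib-+ i (𝔽.- j)))
      (trans (cong (𝔽._+_ (𝔽.- i)) (𝔽.neg-involutive j)) (𝔽.+-comm (𝔽.- i) j))

    T-sym : ∀ i j → T i j ≡ T j i
    T-sym i j = cong +_ (trans (cong τ (sym (neg-difference i j))) (H.τ-neg (i 𝔽.+ 𝔽.- j)))

    T-column : ∀ j → sum (λ i → T i j) ≡ + n
    T-column j = trans (sum-cong-≗ λ i → T-sym i j) (T-row j)

    T⊗T : ∀ i j → (T ⊗ T) i j ≡ (B - 1ℤ) * (B + + L) - l * B * T i j + + L * + n * δ i j
    T⊗T i j = begin
      sum (λ k → + τ (k 𝔽.+ 𝔽.- i) * + τ (j 𝔽.+ 𝔽.- k))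
        ≡⟨ sum-cong-≗ (λ k → trans (cong (λ x → + τ (k 𝔽.+ 𝔽.- i) * + x) (shift k)) (sym (pos-* (τ (k 𝔽.+ 𝔽.- i)) (τ (𝔽.- d 𝔽.+ (k 𝔽.+ 𝔽.- i)))))) ⟩
      sum (λ k → + (τ (k 𝔽.+ 𝔽.- i) ℕ.* τ (𝔽.- d 𝔽.+ (k 𝔽.+ 𝔽.- i))))
        ≡⟨ sum-translate-ℤ i (λ z → τ z ℕ.* τ (𝔽.- d 𝔽.+ z)) ⟩
      sum (λ z → + (τ z ℕ.* τ (𝔽.- d 𝔽.+ z)))
        ≡⟨ sum-pos (λ z → τ z ℕ.* τ (𝔽.- d 𝔽.+ z)) ⟩
      conv d
        ≡⟨ conv-formula d ⟩
      (B - 1ℤ) * (B + + L) - l * B * T i j + + L * + n * is0 d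
        ≡⟨ cong (λ x → (B - 1ℤ) * (B + + L) - l * B * T i j + + L * + n * x) (is0-difference i j) ⟩
      (B - 1ℤ) * (B + + L) - l * B * T i j + + L * + n * δ i j ∎
      where
      d : Fin n
      d = j 𝔽.+ 𝔽.- i
      shift : ∀ k → τ (j 𝔽.+ 𝔽.- k) ≡ τ (𝔽.- d 𝔽.+ (k 𝔽.+ 𝔽.- i))
      shift k = trans (sym (H.τ-neg (j 𝔽.+ 𝔽.- k))) (cong τ (trans (neg-difference j k) (sym (begin
        𝔽.- (j 𝔽.+ 𝔽.- i) 𝔽.+ (k 𝔽.+ 𝔽.- i)   ≡⟨ cong (𝔽._+ (k 𝔽.+ 𝔽.- i)) (neg-difference j i) ⟩
        i 𝔽.+ 𝔽.- j 𝔽.+ (k 𝔽.+ 𝔽.- i)         ≡⟨ 𝔽.solve 4 (λ a b c e → a 𝔽.:+ b 𝔽.:+ (c 𝔽.:+ e) 𝔽.:= c 𝔽.:+ b 𝔽.:+ (a 𝔽.:+ e)) refl i (𝔽.- j) k (𝔽.- i) ⟩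
        k 𝔽.+ 𝔽.- j 𝔽.+ (i 𝔽.+ 𝔽.- i)         ≡⟨ cong (𝔽._+_ (k 𝔽.+ 𝔽.- j)) (𝔽.-‿inverseʳ i) ⟩
        k 𝔽.+ 𝔽.- j 𝔽.+ 𝔽.0#                  ≡⟨ 𝔽.+-identityʳ (k 𝔽.+ 𝔽.- j) ⟩
        k 𝔽.+ 𝔽.- j                           ∎))))

    combination : ℤ → ℤ → ℤ → Matrix n
    combination a b c i j = a * δ i j + b * T i j + c

    combination² : ∀ a b c i j → (combination a b c ⊗ combination a b c) i j ≡
      a * a * δ i j + + 2 * a * b * T i j + b * b * (T ⊗ T) i j + (+ 2 * a * c + + 2 * b * c * + n + + n * (c * c))
    combination² a b c i j = begin
      sum (λ k → (a * δ i k + b * T i k + c) * (a * δ k j + b * T k j + c))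
        ≡⟨ sum-cong-≗ (λ k → expand a b c (δ i k) (T i k) (δ k j) (T k j)) ⟩
      sum (λ k → f₁ k + (f₂ k + (f₃ k + (f₄ k + (f₅ k + c * c)))))
        ≡⟨ ∑-distrib-+ f₁ (λ k → f₂ k + (f₃ k + (f₄ k + (f₅ k + c * c)))) ⟩
      sum f₁ + sum (λ k → f₂ k + (f₃ k + (f₄ k + (f₅ k + c * c))))
        ≡⟨ cong (_+_ (sum f₁)) (∑-distrib-+ f₂ (λ k → f₃ k + (f₄ k + (f₅ k + c * c)))) ⟩
      sum f₁ + (sum f₂ + sum (λ k → f₃ k + (f₄ k + (f₅ k + c * c))))
        ≡⟨ cong (λ x → sum f₁ + (sum f₂ + x)) (∑-distrib-+ f₃ (λ k → f₄ k + (f₅ k + c * c))) ⟩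
      sum f₁ + (sum f₂ + (sum f₃ + sum (λ k → f₄ k + (f₅ k + c * c))))
        ≡⟨ cong (λ x → sum f₁ + (sum f₂ + (sum f₃ + x))) (trans (∑-distrib-+ f₄ (λ k → f₅ k + c * c)) (cong (_+_ (sum f₄)) (∑-distrib-+ f₅ (λ _ → c * c)))) ⟩
      sum f₁ + (sum f₂ + (sum f₃ + (sum f₄ + (sum f₅ + sum {n} (λ _ → c * c)))))
        ≡⟨ cong₂ _+_ (sum-δˡ i (λ k → a * (a * δ k j + b * T k j + c)))
             (cong₂ _+_ (sum-δʳ j (λ k → a * (b * T i k + c)))
               (cong₂ _+_ (sym (*-distribˡ-sum (b * b) (λ k → T i k * T k j)))
                 (cong₂ _+_ (trans (sym (*-distribˡ-sum (b * c) (λ k → T i k))) (cong (b * c *_) (T-row i)))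
                   (cong₂ _+_ (trans (sym (*-distribˡ-sum (b * c) (λ k → T k j))) (cong (b * c *_) (T-column j)))
                     (sum-replicate-ℤ n (c * c)))))) ⟩
      a * (a * δ i j + b * T i j + c) + (a * (b * T i j + c) + (b * b * (T ⊗ T) i j + (b * c * + n + (b * c * + n + + n * (c * c)))))
        ≡⟨ collect a b c (δ i j) (T i j) ((T ⊗ T) i j) (+ n) ⟩
      a * a * δ i j + + 2 * a * b * T i j + b * b * (T ⊗ T) i j + (+ 2 * a * c + + 2 * b * c * + n + + n * (c * c)) ∎
      where
      f₁ f₂ f₃ f₄ f₅ : Fin n → ℤ
      f₁ k = δ i k * (a * (a * δ k j + b * T k j + c))
      f₂ k = a * (b * T i k + c) * δ k j
      f₃ k = b * b * (T i k * T k j)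
      f₄ k = b * c * T i k
      f₅ k = b * c * T k j
      expand : ∀ a b c x t y u → (a * x + b * t + c) * (a * y + b * u + c) ≡
        x * (a * (a * y + b * u + c)) + (a * (b * t + c) * y + (b * b * (t * u) + (b * c * t + (b * c * u + c * c))))
      expand = solve-∀
      collect : ∀ a b c x t w n →
        a * (a * x + b * t + c) + (a * (b * t + c) + (b * b * w + (b * c * n + (b * c * n + n * (c * c))))) ≡
        a * a * x + + 2 * a * b * t + b * b * w + (+ 2 * a * c + + 2 * b * c * n + n * (c * c))
      collect = solve-∀

    -- `R` is K times the projector, written as nI - BT + (B - 1)J; the factor K clears the
    -- denominator in adj = (T - I) / K.
    N R : Matrix n
    N = projector B υ adj
    R = combination (+ n) (- B) (B - 1ℤ)

    K*N≡R : ∀ i j → + K * N i j ≡ R i j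
    K*N≡R i j = begin
      + K * (B * (υ * δ i j - adj i j) + υ)
        ≡⟨ identity (+ K) B υ (δ i j) (adj i j) ⟩
      B * (1ℤ + + K * υ) * δ i j + - B * (δ i j + + K * adj i j) + (1ℤ + + K * υ - 1ℤ)
        ≡⟨ cong₂ (λ x t → B * x * δ i j + - B * t + (x - 1ℤ)) (sym B≡1+Kυ) (sym (T≡ i j)) ⟩
      B * B * δ i j + - B * T i j + (B - 1ℤ)
        ≡⟨ cong (λ x → x * δ i j + - B * T i j + (B - 1ℤ)) B²≡n ⟩
      + n * δ i j + - B * T i j + (B - 1ℤ) ∎
      where
      identity : ∀ k b u d x → k * (b * (u * d - x) + u) ≡
        b * (1ℤ + k * u) * d + - b * (d + k * x) + (1ℤ + k * u - 1ℤ)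
      identity = solve-∀

    R² : ∀ i j → (R ⊗ R) i j ≡ + K * + n * R i j
    R² i j = begin
      (R ⊗ R) i j
        ≡⟨ combination² (+ n) (- B) (B - 1ℤ) i j ⟩
      + n * + n * δ i j + + 2 * + n * - B * T i j + - B * - B * (T ⊗ T) i j + rest (+ n)
        ≡⟨ cong (λ w → + n * + n * δ i j + + 2 * + n * - B * T i j + - B * - B * w + rest (+ n)) (T⊗T i j) ⟩
      expanded (+ n)
        -- Replacing n by B² throughout leaves a polynomial identity in B, l and the entries of I
        -- and T.
        ≡⟨ cong expanded (sym B²≡n) ⟩
      expanded (B * B)
        ≡⟨ identity B l (δ i j) (T i j) ⟩
      + K * (B * B) * (B * B * δ i j + - B * T i j + (B - 1ℤ))
        ≡⟨ cong (λ n → + K * n * (n * δ i j + - B * T i j + (B - 1ℤ))) B²≡n ⟩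
      + K * + n * R i j ∎
      where
      rest expanded : ℤ → ℤ
      rest n = + 2 * n * (B - 1ℤ) + + 2 * - B * (B - 1ℤ) * n + n * ((B - 1ℤ) * (B - 1ℤ))
      expanded n = n * n * δ i j + + 2 * n * - B * T i j + - B * - B * ((B - 1ℤ) * (B + + L) - l * B * T i j + + L * n * δ i j) + rest n
      identity : ∀ b l d t →
        b * b * (b * b) * d + + 2 * (b * b) * - b * t + - b * - b * ((b - 1ℤ) * (b + (1ℤ + l)) - l * b * t + (1ℤ + l) * (b * b) * d)
          + (+ 2 * (b * b) * (b - 1ℤ) + + 2 * - b * (b - 1ℤ) * (b * b) + b * b * ((b - 1ℤ) * (b - 1ℤ)))
        ≡ (+ 2 + l) * (b * b) * (b * b * d + - b * t + (b - 1ℤ))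
      identity = solve-∀

    N²≡nN : N ⊗ N ≑ (+ n) *ₛ N
    N²≡nN i j = *-cancelˡ (+ K) (λ ()) (*-cancelˡ (+ K) (λ ()) (begin
      + K * (+ K * (N ⊗ N) i j)
        ≡⟨ cong (+ K *_) (*-distribˡ-sum (+ K) (λ k → N i k * N k j)) ⟩
      + K * sum (λ k → + K * (N i k * N k j))
        ≡⟨ *-distribˡ-sum (+ K) (λ k → + K * (N i k * N k j)) ⟩
      sum (λ k → + K * (+ K * (N i k * N k j)))
        ≡⟨ sum-cong-≗ (λ k → trans (regroup (+ K) (N i k) (N k j)) (cong₂ _*_ (K*N≡R i k) (K*N≡R k j))) ⟩
      (R ⊗ R) i j
        ≡⟨ R² i j ⟩
      + K * + n * R i j
        ≡⟨ cong (+ K * + n *_) (K*N≡R i j) ⟨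
      + K * + n * (+ K * N i j)
        ≡⟨ regroup′ (+ K) (+ n) (N i j) ⟩
      + K * (+ K * (+ n * N i j)) ∎))
      where
      regroup : ∀ k x y → k * (k * (x * y)) ≡ k * x * (k * y)
      regroup = solve-∀
      regroup′ : ∀ k n x → k * n * (k * x) ≡ k * (k * (n * x))
      regroup′ = solve-∀

    NJ≡0 : ∀ i j → (N ⊗ J) i j ≡ 0ℤ
    NJ≡0 i j = *-cancelˡ (+ K) (λ ()) (begin
      + K * sum (λ k → N i k * 1ℤ)
        ≡⟨ *-distribˡ-sum (+ K) (λ k → N i k * 1ℤ) ⟩
      sum (λ k → + K * (N i k * 1ℤ))
        ≡⟨ sum-cong-≗ (λ k → trans (cong (+ K *_) (*-identityʳ (N i k))) (trans (K*N≡R i k) (regroup (+ n) (- B) (B - 1ℤ) (δ i k) (T i k)))) ⟩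
      sum (λ k → δ i k * + n + (- B * T i k + (B - 1ℤ)))
        ≡⟨ trans (∑-distrib-+ (λ k → δ i k * + n) (λ k → - B * T i k + (B - 1ℤ)))
             (cong (_+_ (sum (λ k → δ i k * + n))) (∑-distrib-+ (λ k → - B * T i k) (λ _ → B - 1ℤ))) ⟩
      sum (λ k → δ i k * + n) + (sum (λ k → - B * T i k) + sum {n} (λ _ → B - 1ℤ))
        ≡⟨ cong₂ _+_ (sum-δˡ i (λ _ → + n)) (cong₂ _+_ (trans (sym (*-distribˡ-sum (- B) (λ k → T i k))) (cong (- B *_) (T-row i))) (sum-replicate-ℤ n (B - 1ℤ))) ⟩
      + n + (- B * + n + + n * (B - 1ℤ))
        ≡⟨ vanish (+ n) B ⟩
      0ℤ
        ≡⟨ *-zeroʳ (+ K) ⟨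
      + K * 0ℤ ∎)
      where
      regroup : ∀ a b c d t → a * d + b * t + c ≡ d * a + (b * t + c)
      regroup = solve-∀
      vanish : ∀ n b → n + (- b * n + n * (b - 1ℤ)) ≡ 0ℤ
      vanish = solve-∀

    trace-N : trace N ≡ k * + n
    trace-N = begin
      sum (λ i → N i i)         ≡⟨ sum-cong-≗ diagonal ⟩
      sum {n} (λ _ → k)         ≡⟨ sum-replicate-ℤ n k ⟩
      + n * k                   ≡⟨ *-comm (+ n) k ⟩
      k * + n                   ∎
      where
      adj-diagonal : ∀ i → adj i i ≡ 0ℤ
      adj-diagonal i = cong +_ (𝟙-no (isPower? (i 𝔽.+ 𝔽.- i))
        λ { (x , x≢0 , eq) → 𝔽.x^m≢0 K x≢0 (trans (sym eq) (𝔽.-‿inverseʳ i)) })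
      collect : ∀ b u → b * (u * 1ℤ - 0ℤ) + u ≡ u + b * u
      collect = solve-∀
      diagonal : ∀ i → N i i ≡ k
      diagonal i = trans (cong₂ (λ d x → B * (υ * d - x) + υ) (δ-refl i) (adj-diagonal i)) (trans (collect B υ) (sym k≡υ+Bυ))

    adj-charPoly : charPoly n adj ≈P (lin (+ M) *P (lin υ ^P (L ℕ.* M))) *P (lin (υ - B) ^P M)
    adj-charPoly = charPoly-factors adj B υ M L (trans H.n≡1+KM (sym (ℕₚ.+-suc M (L ℕ.* M)))) B²≡n k≡υ+Bυ N²≡nN NJ≡0 trace-N

  charPoly-cong : ∀ n {A A′ : Matrix n} → A ≑ A′ → charPoly n A ≈P charPoly n A′
  charPoly-cong n {A} {A′} A≑A′ = eventually-equal 0 (charPoly n A) (charPoly n A′) λ j → begin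
    eval (charPoly n A) (+ suc j)                  ≡⟨ eval-charPoly n A (+ suc j) ⟩
    det n (λ x y → + suc j * δ x y - A x y)        ≡⟨ det-cong n (λ x y → cong (λ a → + suc j * δ x y - a) (A≑A′ x y)) ⟩
    det n (λ x y → + suc j * δ x y - A′ x y)       ≡⟨ eval-charPoly n A′ (+ suc j) ⟨
    eval (charPoly n A′) (+ suc j)                 ∎

  -- The entries of `A` are prescribed by implications, so that a matrix defined through any
  -- decision procedure fits. The numbers k and υ are returned with equations characterising them,
  -- since closed formulas would divide by L + 1.
  cayley-spectrum : ∀ {n} (𝔽 : FieldOn n) (let open FieldTheory 𝔽 using (0#) renaming (_-_ to _⊝_; _^_ to _↑_)) L s →
    1 ℕ.< L → 0 ℕ.< s → n ≡ L ℕ.^ (s ℕ.+ s) → IsAdditivePower 𝔽 L → (A : Matrix n) →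
    (∀ i j → (∃ λ x → x ≢ 0# × j ⊝ i ≡ x ↑ suc L) → A i j ≡ 1ℤ) →
    (∀ i j → ¬ (∃ λ x → x ≢ 0# × j ⊝ i ≡ x ↑ suc L) → A i j ≡ 0ℤ) →
    ∃₂ λ k υ → n ≡ suc (suc L ℕ.* k) × 0 ℕ.< k × signedPower L s ≡ 1ℤ + + suc L * υ × + k ≡ υ + signedPower L s * υ ×
      charPoly n A ≈P (lin (+ k) *P (lin υ ^P (L ℕ.* k))) *P (lin (υ - signedPower L s) ^P k)
  cayley-spectrum {n} 𝔽 (suc (suc L″)) (suc s′) _ _ n≡ frob-+ A A≡1 A≡0 =
    H.M , υ 𝔽 L″ s′ n≡ frob-+ , H.n≡1+KM , H.0<M , B≡1+Kυ 𝔽 L″ s′ n≡ frob-+ , k≡υ+Bυ 𝔽 L″ s′ n≡ frob-+ ,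
    trans (charPoly-cong n same) (adj-charPoly 𝔽 L″ s′ n≡ frob-+)
    where
    module H = Hermitian 𝔽 (suc L″) s′ (ℕ.s≤s ℕ.z≤n) n≡ frob-+
    same : A ≑ adj 𝔽 L″ s′ n≡ frob-+
    same i j = by-cases (H.isPower? (FieldTheory._-_ 𝔽 j i))
      where
      by-cases : (d : Dec (H.IsPower (FieldTheory._-_ 𝔽 j i))) → A i j ≡ + 𝟙 d
      by-cases (yes P) = A≡1 i j P
      by-cases (no ¬P) = A≡0 i j ¬P
  cayley-spectrum 𝔽 (suc zero) _ (ℕ.s≤s ())

-- Transport of the given field and its adjacency matrix to the index set.

module FieldTransport where

  open FiniteFields using (FieldOn; module FieldTheory; IsAdditivePower)
  open import Defs using (FiniteField; adjacency; inS?)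
  open import Data.Nat as ℕ using (ℕ; zero; suc)
  import Data.Nat.Properties as ℕₚ
  open import Data.Nat.Primality using (Prime)
  open import Data.Integer using (ℤ; +_; 0ℤ; 1ℤ)
  open import Data.Bool using (if_then_else_)
  open import Data.Fin using (Fin)
  open import Data.Product using (∃; _×_; _,_; proj₁; proj₂)
  open import Relation.Nullary using (Dec; yes; no; ¬_; ⌊_⌋; contradiction)
  open import Relation.Binary.PropositionalEquality
  open import Algebra.Bundles using (CommutativeRing; RawRing)
  open import Algebra.Morphism.Structures using (IsRingMonomorphism)
  import Algebra.Morphism.RingMonomorphism as RingMonomorphism

  -- Transporting the operations to the index set replaces the setoid equality by ≡.
  module _ {c ℓ} (F : FiniteField c ℓ) where

    open FiniteField F using (Carrier; _≈_; commRing; size; enum; enum-inj; enum-surj; pow)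
      renaming (_+_ to _⊕_; _*_ to _⊗_; -_ to ⊝_; 0# to 𝟘; 1# to 𝟙′)
    private
      module F = FiniteField F

    index : Carrier → Fin size
    index x = proj₁ (enum-surj x)

    enum-index : ∀ x → enum (index x) ≈ x
    enum-index x = proj₂ (enum-surj x)

    indexRawRing : RawRing _ _
    indexRawRing = record
      { Carrier = Fin size
      ; _≈_     = _≡_
      ; _+_     = λ i j → index (enum i ⊕ enum j)
      ; _*_     = λ i j → index (enum i ⊗ enum j)
      ; -_      = λ i → index (⊝ enum i)
      ; 0#      = index 𝟘
      ; 1#      = index 𝟙′
      }

    enum-isRingMonomorphism : IsRingMonomorphism indexRawRing (CommutativeRing.rawRing commRing) enum
    enum-isRingMonomorphism = record
      { isRingHomomorphism = record
        { isSemiringHomomorphism = record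
          { isNearSemiringHomomorphism = record
            { +-isMonoidHomomorphism = record
              { isMagmaHomomorphism = record
                { isRelHomomorphism = record { cong = λ { refl → F.refl } }
                ; homo = λ i j → enum-index (enum i ⊕ enum j)
                }
              ; ε-homo = enum-index 𝟘
              }
            ; *-homo = λ i j → enum-index (enum i ⊗ enum j)
            }
          ; 1#-homo = enum-index 𝟙′
          }
        ; -‿homo = λ i → enum-index (⊝ enum i)
        }
      ; injective = λ {i} {j} → enum-inj i j
      }

    indexField : FieldOn size
    indexField = record
      { _+_ = RawRing._+_ indexRawRing
      ; _*_ = RawRing._*_ indexRawRing
      ; -_  = RawRing.-_ indexRawRing
      ; 0#  = index 𝟘
      ; 1#  = index 𝟙′
      ; isCommutativeRing = RingMonomorphism.isCommutativeRing enum-isRingMonomorphism (CommutativeRing.isCommutativeRing commRing)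
      ; 1≢0 = λ eq → F.0≉1 (F.trans (F.sym (enum-index 𝟘)) (F.trans (F.reflexive (cong enum (sym eq))) (enum-index 𝟙′)))
      ; inverse = λ i i≢0 →
          let y , xy≈1 = F.inverse (enum i) (λ i≈0 → i≢0 (enum-inj i (index 𝟘) (F.trans i≈0 (F.sym (enum-index 𝟘)))))
          in index y , enum-inj _ _ (F.trans (enum-index _) (F.trans (F.*-congˡ (enum-index y)) (F.trans xy≈1 (F.sym (enum-index 𝟙′)))))
      }

    private
      module 𝔽 = FieldTheory indexField

    enum-^ : ∀ i k → enum (i 𝔽.^ k) ≈ pow (enum i) k
    enum-^ i zero    = enum-index 𝟙′
    enum-^ i (suc k) = F.trans (enum-index (enum i ⊗ enum (i 𝔽.^ k))) (F.*-congˡ (enum-^ i k))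

    enum-difference : ∀ i j → enum (j 𝔽.- i) ≈ enum j ⊕ ⊝ enum i
    enum-difference i j = F.trans (enum-index (enum j ⊕ enum (𝔽.- i))) (F.+-congˡ (enum-index (⊝ enum i)))

    enum-≢0⇒≉0 : ∀ {i} → i ≢ 𝔽.0# → ¬ (enum i ≈ 𝟘)
    enum-≢0⇒≉0 {i} i≢0 i≈0 = i≢0 (enum-inj i 𝔽.0# (F.trans i≈0 (F.sym (enum-index 𝟘))))

    enum-≉0⇒≢0 : ∀ {i} → ¬ (enum i ≈ 𝟘) → i ≢ 𝔽.0#
    enum-≉0⇒≢0 i≉0 refl = i≉0 (enum-index 𝟘)

    module _ (q l : ℕ) where

      private
        L : ℕ
        L = q ℕ.^ l

      adjacency-dec : ∀ {P : Set ℓ} (d : Dec P) → P → (if ⌊ d ⌋ then + 1 else + 0) ≡ 1ℤ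
      adjacency-dec (yes _) _ = refl
      adjacency-dec (no ¬p) p = contradiction p ¬p

      nonadjacency-dec : ∀ {P : Set ℓ} (d : Dec P) → ¬ P → (if ⌊ d ⌋ then + 1 else + 0) ≡ 0ℤ
      nonadjacency-dec (yes p) ¬p = contradiction p ¬p
      nonadjacency-dec (no _)  _  = refl

      adjacency≡1 : ∀ i j → (∃ λ x → x ≢ 𝔽.0# × j 𝔽.- i ≡ x 𝔽.^ suc L) → adjacency F q l i j ≡ 1ℤ
      adjacency≡1 i j (x , x≢0 , eq) = adjacency-dec (inS? F q l (enum j ⊕ ⊝ enum i))
        (x , enum-≢0⇒≉0 x≢0 , F.trans (F.sym (enum-difference i j)) (F.trans (F.reflexive (cong enum eq))
          (F.trans (enum-^ x (suc L)) (F.reflexive (cong (pow (enum x)) (ℕₚ.+-comm 1 L))))))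

      adjacency≡0 : ∀ i j → ¬ (∃ λ x → x ≢ 𝔽.0# × j 𝔽.- i ≡ x 𝔽.^ suc L) → adjacency F q l i j ≡ 0ℤ
      adjacency≡0 i j ¬P = nonadjacency-dec (inS? F q l (enum j ⊕ ⊝ enum i)) λ { (x , x≉0 , eq) → ¬P
        (x , enum-≉0⇒≢0 x≉0 , enum-inj _ _ (F.trans (enum-difference i j) (F.trans eq
          (F.trans (F.reflexive (cong (pow (enum x)) (ℕₚ.+-comm L 1))) (F.sym (enum-^ x (suc L))))))) }

  frobenius-power : ∀ {n} (𝔽 : FieldOn n) {p} e m l → Prime p → n ≡ (p ℕ.^ e) ℕ.^ m → IsAdditivePower 𝔽 ((p ℕ.^ e) ℕ.^ l)
  frobenius-power {n} 𝔽 {p} e m l pr n≡ = subst (IsAdditivePower 𝔽) (sym (ℕₚ.^-*-assoc p e l))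
    (FieldTheory.frobenius 𝔽 {p} {e ℕ.* m} pr (trans n≡ (ℕₚ.^-*-assoc p e m)) (e ℕ.* l))

-- The eigenvalues: defining equations, distinctness, and coincidence at s = 1.

module EigenvalueArithmetic where

  open IntegerPolynomials
  open PowerCayleyGraph using (signedPower; signedPower²; signedPower-suc)
  open import Defs using (lin; _*P_; _^P_; _≈P_)
  open import Data.Nat as ℕ using (ℕ; zero; suc)
  import Data.Nat.Properties as ℕₚ
  open import Data.Integer hiding (suc)
  open import Data.Integer.Properties hiding (*-cancelˡ-≡)
  open import Data.Integer.Tactic.RingSolver using (solve-∀)
  open import Data.Sum using (_⊎_; inj₁; inj₂)
  open import Relation.Nullary using (¬_; contradiction)
  open import Relation.Binary.PropositionalEquality
  open ≡-Reasoning

  module _ (L s k : ℕ) (υ : ℤ) (1<L : 1 ℕ.< L) (0<k : 0 ℕ.< k)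
    (B≡ : signedPower L s ≡ 1ℤ + + suc L * υ) (k≡ : + k ≡ υ + signedPower L s * υ) where

    private
      B : ℤ
      B = signedPower L s
      instance
        L≢0 : ℕ.NonZero L
        L≢0 = ℕ.>-nonZero (ℕₚ.<-trans ℕ.z<s 1<L)

    B≢0 : B ≢ 0ℤ
    B≢0 B≡0 = contradiction (+-injective (trans (sym (signedPower² L s)) (cong (_* B) B≡0))) (ℕ.≢-nonZero⁻¹ _ {{ℕₚ.m^n≢0 L (s ℕ.+ s)}})

    υ-equation : υ * + suc L ≡ B - 1ℤ
    υ-equation = trans (regroup (+ suc L) υ) (cong (_- 1ℤ) (sym B≡))
      where
      regroup : ∀ k u → u * k ≡ 1ℤ + k * u - 1ℤ
      regroup = solve-∀

    μ-equation : (υ - B) * + suc L ≡ - (+ L * B) - 1ℤ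
    μ-equation = trans (regroup (+ L) υ B) (trans (cong (λ x → x - B - + L * B - 1ℤ) (sym B≡)) (cancel (+ L) B))
      where
      regroup : ∀ l u b → (u - b) * (1ℤ + l) ≡ 1ℤ + (1ℤ + l) * u - b - l * b - 1ℤ
      regroup = solve-∀
      cancel : ∀ l b → b - b - l * b - 1ℤ ≡ - (l * b) - 1ℤ
      cancel = solve-∀

    -- Equality would give Bυ = 0, hence υ = 0 and then k = 0.
    k≢υ : + k ≢ υ
    k≢υ k≡υ = ℕₚ.<⇒≢ 0<k (sym (+-injective (trans k≡ (trans (cong (λ x → x + B * x) υ≡0) (vanish B)))))
      where
      vanish : ∀ b → 0ℤ + b * 0ℤ ≡ 0ℤ
      vanish = solve-∀
      Bυ≡0 : B * υ ≡ 0ℤ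
      Bυ≡0 = trans (regroup υ (B * υ)) (i≡j⇒i-j≡0 (trans (sym k≡) k≡υ))
        where
        regroup : ∀ u x → x ≡ u + x - u
        regroup = solve-∀
      υ≡0 : υ ≡ 0ℤ
      υ≡0 = *-cancelˡ B B≢0 (trans Bυ≡0 (sym (*-zeroʳ B)))

    υ≢μ : υ ≢ υ - B
    υ≢μ eq = B≢0 (trans (regroup υ B) (i≡j⇒i-j≡0 eq))
      where
      regroup : ∀ u b → b ≡ u - (u - b)
      regroup = solve-∀

    -- If k = μ then B(υ + 1) = 0, so B = -L and L² = L^(2s).
    k≢μ : s ≢ 1 → + k ≢ υ - B
    k≢μ s≢1 k≡μ = s≢1 (exponent-one s (trans (sym (signedPower² L s)) (trans (cong (λ x → x * x) B≡-L) (square L))))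
      where
      B[υ+1]≡0 : B * (υ + 1ℤ) ≡ 0ℤ
      B[υ+1]≡0 = trans (regroup B υ) (i≡j⇒i-j≡0 (trans (sym k≡) k≡μ))
        where
        regroup : ∀ b u → b * (u + 1ℤ) ≡ u + b * u - (u - b)
        regroup = solve-∀
      υ+1≡0 : υ + 1ℤ ≡ 0ℤ
      υ+1≡0 = *-cancelˡ B B≢0 (trans B[υ+1]≡0 (sym (*-zeroʳ B)))
      B≡-L : B ≡ - + L
      B≡-L = trans B≡ (trans (regroup (+ L) υ) (trans (cong (λ x → (1ℤ + + L) * x - + L) υ+1≡0) (vanish (+ L))))
        where
        regroup : ∀ l u → 1ℤ + (1ℤ + l) * u ≡ (1ℤ + l) * (u + 1ℤ) - l
        regroup = solve-∀
        vanish : ∀ l → (1ℤ + l) * 0ℤ - l ≡ - l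
        vanish = solve-∀
      square : ∀ l → - + l * - + l ≡ + (l ℕ.* l)
      square l = trans (neg² (+ l)) (sym (pos-* l l))
        where
        neg² : ∀ x → - x * - x ≡ x * x
        neg² = solve-∀
      exponent-one : ∀ s → + (L ℕ.^ (s ℕ.+ s)) ≡ + (L ℕ.* L) → s ≡ 1
      exponent-one zero eq = contradiction (ℕₚ.m*n≡1⇒m≡1 L L (sym (+-injective eq))) (λ L≡1 → ℕₚ.<⇒≢ 1<L (sym L≡1))
      exponent-one (suc s) eq = cong suc (exponent-zero s (ℕₚ.m^n≡1⇒n≡0∨m≡1 L (s ℕ.+ s)
        (ℕₚ.*-cancelˡ-≡ (L ℕ.^ (s ℕ.+ s)) 1 L (ℕₚ.*-cancelˡ-≡ (L ℕ.* L ℕ.^ (s ℕ.+ s)) (L ℕ.* 1) L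
          (trans (cong (λ j → L ℕ.* L ℕ.^ j) (sym (ℕₚ.+-suc s s))) (trans (+-injective eq) (cong (L ℕ.*_) (sym (ℕₚ.*-identityʳ L)))))))))
        where
        exponent-zero : ∀ s → s ℕ.+ s ≡ 0 ⊎ L ≡ 1 → s ≡ 0
        exponent-zero s (inj₁ s+s≡0) = ℕₚ.m+n≡0⇒m≡0 s s+s≡0
        exponent-zero s (inj₂ L≡1)   = contradiction (sym L≡1) (ℕₚ.<⇒≢ 1<L)

    -- Here B = -L, υ = -1 and μ = k = L - 1, the eigenvalues of a disjoint union of L complete
    -- graphs on L vertices.
    module _ (s≡1 : s ≡ 1) where

      B≡-L : B ≡ - + L
      B≡-L = trans (cong (signedPower L) s≡1) (trans (signedPower-suc L 0) (cong -_ (*-identityʳ (+ L))))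

      υ≡-1 : υ ≡ -1ℤ
      υ≡-1 = *-cancelˡ (+ suc L) (λ ()) (trans (regroup (+ L) υ) (trans (cong (_- 1ℤ) (trans (sym B≡) B≡-L)) (collect (+ L))))
        where
        regroup : ∀ l u → (1ℤ + l) * u ≡ 1ℤ + (1ℤ + l) * u - 1ℤ
        regroup = solve-∀
        collect : ∀ l → - l - 1ℤ ≡ (1ℤ + l) * -1ℤ
        collect = solve-∀

      1+k≡L : suc k ≡ L
      1+k≡L = +-injective (trans (cong (_+_ 1ℤ) (trans k≡ (cong₂ (λ u b → u + b * u) υ≡-1 B≡-L))) (collect (+ L)))
        where
        collect : ∀ l → 1ℤ + (-1ℤ + - l * -1ℤ) ≡ l
        collect = solve-∀

      μ≡k : υ - B ≡ + k
      μ≡k = sym (trans k≡ (trans (cong (λ u → u + B * u) υ≡-1) (trans (collect B) (cong (_- B) (sym υ≡-1)))))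
        where
        collect : ∀ b → -1ℤ + b * -1ℤ ≡ -1ℤ - b
        collect = solve-∀

  merge-factors : ∀ p a b k e → p ≈P (lin a *P (lin b ^P e)) *P (lin a ^P k) → p ≈P (lin a ^P suc k) *P (lin b ^P e)
  merge-factors p a b k e p≈ = trans p≈ (eventually-equal 0 ((lin a *P (lin b ^P e)) *P (lin a ^P k)) ((lin a ^P suc k) *P (lin b ^P e)) λ j →
    let z = + suc j in begin
    eval ((lin a *P (lin b ^P e)) *P (lin a ^P k)) z
      ≡⟨ trans (eval-*P (lin a *P (lin b ^P e)) (lin a ^P k) z) (cong (_* eval (lin a ^P k) z) (eval-*P (lin a) (lin b ^P e) z)) ⟩
    eval (lin a) z * eval (lin b ^P e) z * eval (lin a ^P k) z
      ≡⟨ swap (eval (lin a) z) (eval (lin b ^P e) z) (eval (lin a ^P k) z) ⟩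
    eval (lin a) z * eval (lin a ^P k) z * eval (lin b ^P e) z
      ≡⟨ trans (eval-*P (lin a ^P suc k) (lin b ^P e) z) (cong (_* eval (lin b ^P e) z) (eval-*P (lin a) (lin a ^P k) z)) ⟨
    eval ((lin a ^P suc k) *P (lin b ^P e)) z ∎)
    where
    swap : ∀ x y w → x * y * w ≡ x * w * y
    swap = solve-∀

-- The exponents m = 2sℓ and L = q^ℓ, and the two cases of the theorem.

open import Defs
open import Level using (Level)
open import Data.Nat using (ℕ; _+_; _*_; _∸_; _^_; _≤_; ⌊_/2⌋)
open import Data.Nat.Divisibility using (_∣_)
open import Data.Integer as ℤ using (ℤ; +_; -[1+_])
open import Data.Product using (Σ; _×_)
open import Relation.Nullary using (¬_)
open import Relation.Binary.PropositionalEquality using (_≡_)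

module HalfExponents (q m ℓ t s : ℕ) (tℓ≡m : t * ℓ ≡ m) (t≡s*2 : t ≡ s * 2) where

  open PowerCayleyGraph using (signedPower)
  open import Data.Nat.Properties
  import Data.Integer.Properties as ℤₚ
  open import Relation.Binary.PropositionalEquality
  open ≡-Reasoning

  double : ∀ a → a * 2 ≡ a + a
  double a = trans (*-comm a 2) (cong (_+_ a) (+-identityʳ a))

  half-t : ⌊ t /2⌋ ≡ s
  half-t = trans (cong ⌊_/2⌋ (trans t≡s*2 (double s))) (sym (n≡⌊n+n/2⌋ s))

  m≡ : m ≡ (s + s) * ℓ
  m≡ = trans (sym tℓ≡m) (cong (_* ℓ) (trans t≡s*2 (double s)))

  half-m : ⌊ m /2⌋ ≡ s * ℓ
  half-m = trans (cong ⌊_/2⌋ (trans m≡ (*-distribʳ-+ ℓ s s))) (sym (n≡⌊n+n/2⌋ (s * ℓ)))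

  q^m≡ : q ^ m ≡ (q ^ ℓ) ^ (s + s)
  q^m≡ = trans (cong (q ^_) (trans m≡ (*-comm (s + s) ℓ))) (sym (^-*-assoc q ℓ (s + s)))

  q^⌊m/2⌋≡ : q ^ ⌊ m /2⌋ ≡ (q ^ ℓ) ^ s
  q^⌊m/2⌋≡ = trans (cong (q ^_) (trans half-m (*-comm s ℓ))) (sym (^-*-assoc q ℓ s))

  signed-q^⌊m/2⌋ : (-[1+ 0 ] ℤ.^ ⌊ t /2⌋) ℤ.* (+ (q ^ ⌊ m /2⌋)) ≡ signedPower (q ^ ℓ) s
  signed-q^⌊m/2⌋ = cong₂ (λ i a → (-[1+ 0 ] ℤ.^ i) ℤ.* (+ a)) half-t q^⌊m/2⌋≡

  signed-q^[⌊m/2⌋+ℓ] : (-[1+ 0 ] ℤ.^ ⌊ t /2⌋) ℤ.* (+ (q ^ (⌊ m /2⌋ + ℓ))) ≡ + (q ^ ℓ) ℤ.* signedPower (q ^ ℓ) s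
  signed-q^[⌊m/2⌋+ℓ] = begin
    e ℤ.* + (q ^ (⌊ m /2⌋ + ℓ))               ≡⟨ cong (λ a → e ℤ.* + a) (^-distribˡ-+-* q ⌊ m /2⌋ ℓ) ⟩
    e ℤ.* + (q ^ ⌊ m /2⌋ * q ^ ℓ)             ≡⟨ cong (e ℤ.*_) (ℤₚ.pos-* (q ^ ⌊ m /2⌋) (q ^ ℓ)) ⟩
    e ℤ.* (+ (q ^ ⌊ m /2⌋) ℤ.* + (q ^ ℓ))     ≡⟨ ℤₚ.*-assoc e (+ (q ^ ⌊ m /2⌋)) (+ (q ^ ℓ)) ⟨
    e ℤ.* + (q ^ ⌊ m /2⌋) ℤ.* + (q ^ ℓ)       ≡⟨ ℤₚ.*-comm (e ℤ.* + (q ^ ⌊ m /2⌋)) (+ (q ^ ℓ)) ⟩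
    + (q ^ ℓ) ℤ.* (e ℤ.* + (q ^ ⌊ m /2⌋))     ≡⟨ cong (+ (q ^ ℓ) ℤ.*_) signed-q^⌊m/2⌋ ⟩
    + (q ^ ℓ) ℤ.* signedPower (q ^ ℓ) s       ∎
    where
    e : ℤ
    e = -[1+ 0 ] ℤ.^ ⌊ t /2⌋

open import Data.Nat as ℕ using (suc; _<_)
import Data.Nat.Properties as ℕₚ
open import Data.Nat.Divisibility using (divides)
open import Data.Nat.Primality using (prime⇒nonTrivial)
open import Data.Product using (_,_; proj₁; proj₂)
open import Relation.Binary.PropositionalEquality using (refl; sym; trans; cong; cong₂; subst)

theorem3p5 : ∀ {c ℓ' : Level} (q m ℓ t : ℕ) →
    IsPrimePower q → 2 ≤ m → 1 ≤ ℓ →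
    -- t = m / ℓ, i.e. ℓ ∣ m, and m / ℓ is even
    t * ℓ ≡ m → 2 ∣ t →
    -- F is a (the) finite field of order q^m
    (F : FiniteField c ℓ') → FiniteField.size F ≡ q ^ m →
    -- (a) ℓ ≠ m/2
    ((¬ ℓ ≡ ⌊ m /2⌋) →
      Σ ℕ λ k → Σ ℤ λ υ → Σ ℤ λ μ →
        (k * (q ^ ℓ + 1) ≡ q ^ m ∸ 1)
        × (υ ℤ.* (+ (q ^ ℓ + 1)) ≡ ((-[1+ 0 ] ℤ.^ ⌊ t /2⌋) ℤ.* (+ (q ^ ⌊ m /2⌋))) ℤ.- + 1)
        × (μ ℤ.* (+ (q ^ ℓ + 1)) ≡ (ℤ.- ((-[1+ 0 ] ℤ.^ ⌊ t /2⌋) ℤ.* (+ (q ^ (⌊ m /2⌋ + ℓ))))) ℤ.- + 1)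
        × (¬ (+ k) ≡ υ) × (¬ (+ k) ≡ μ) × (¬ υ ≡ μ)
        × (charPoly (FiniteField.size F) (adjacency F q ℓ)
             ≈P (lin (+ k) *P (lin υ ^P (q ^ ℓ * k))) *P (lin μ ^P k)))
    ×
    -- (b) ℓ = m/2
    (ℓ ≡ ⌊ m /2⌋ →
      (¬ (+ (q ^ ⌊ m /2⌋ ∸ 1)) ≡ -[1+ 0 ])
      × (charPoly (FiniteField.size F) (adjacency F q ℓ)
           ≈P (lin (+ (q ^ ⌊ m /2⌋ ∸ 1)) ^P (q ^ ⌊ m /2⌋))
              *P (lin -[1+ 0 ] ^P (q ^ ⌊ m /2⌋ * (q ^ ⌊ m /2⌋ ∸ 1)))))
theorem3p5 q m ℓ t (p , e , pr , 1≤e , refl) 2≤m 1≤ℓ tℓ≡m (divides s t≡s*2) F size≡q^m =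
  (λ ℓ≢m/2 → k , υ , υ ℤ.- B
    , k-equation
    , trans (cong (λ a → υ ℤ.* + a) (ℕₚ.+-comm L 1)) (trans (υ-equation L s k υ 1<L 0<k B≡ k≡) (cong (ℤ._- + 1) (sym signed-q^⌊m/2⌋)))
    , trans (cong (λ a → (υ ℤ.- B) ℤ.* + a) (ℕₚ.+-comm L 1)) (trans (μ-equation L s k υ 1<L 0<k B≡ k≡) (cong (λ a → ℤ.- a ℤ.- + 1) (sym signed-q^[⌊m/2⌋+ℓ])))
    , k≢υ L s k υ 1<L 0<k B≡ k≡
    , k≢μ L s k υ 1<L 0<k B≡ k≡ (λ s≡1 → ℓ≢m/2 (sym (trans half-m (trans (cong (_* ℓ) s≡1) (ℕₚ.*-identityˡ ℓ)))))
    , υ≢μ L s k υ 1<L 0<k B≡ k≡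
    , charPoly≈) ,
  λ ℓ≡m/2 → (λ ()) , complete-graphs (s≡1 ℓ≡m/2)
  where
  open HalfExponents (p ^ e) m ℓ t s tℓ≡m t≡s*2
  open FieldTransport
  open EigenvalueArithmetic
  open PowerCayleyGraph using (signedPower; cayley-spectrum)
  L : ℕ
  L = q ^ ℓ
  B : ℤ
  B = signedPower L s

  1<q : 1 < q
  1<q = ℕₚ.^-monoʳ-< p (ℕ.nonTrivial⇒n>1 p {{prime⇒nonTrivial pr}}) 1≤e
  1<L : 1 < L
  1<L = ℕₚ.^-monoʳ-< q 1<q 1≤ℓ

  0<s : 0 < s
  0<s = ℕₚ.n≢0⇒n>0 λ s≡0 → ℕₚ.<⇒≢ (ℕₚ.<-≤-trans ℕ.z<s 2≤m) (sym (trans m≡ (cong (λ s → (s + s) * ℓ) s≡0)))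

  spectrum : _
  spectrum = cayley-spectrum (indexField F) L s 1<L 0<s (trans size≡q^m q^m≡)
    (frobenius-power (indexField F) {p} e m ℓ pr size≡q^m)
    (adjacency F q ℓ) (adjacency≡1 F q ℓ) (adjacency≡0 F q ℓ)

  k : ℕ
  k = proj₁ spectrum
  υ : ℤ
  υ = proj₁ (proj₂ spectrum)

  n≡1+Kk : FiniteField.size F ≡ suc (suc L * k)
  n≡1+Kk = proj₁ (proj₂ (proj₂ spectrum))
  0<k : 0 < k
  0<k = proj₁ (proj₂ (proj₂ (proj₂ spectrum)))
  B≡ : B ≡ + 1 ℤ.+ + suc L ℤ.* υ
  B≡ = proj₁ (proj₂ (proj₂ (proj₂ (proj₂ spectrum))))
  k≡ : + k ≡ υ ℤ.+ B ℤ.* υ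
  k≡ = proj₁ (proj₂ (proj₂ (proj₂ (proj₂ (proj₂ spectrum)))))
  charPoly≈ : charPoly (FiniteField.size F) (adjacency F q ℓ) ≈P (lin (+ k) *P (lin υ ^P (L * k))) *P (lin (υ ℤ.- B) ^P k)
  charPoly≈ = proj₂ (proj₂ (proj₂ (proj₂ (proj₂ (proj₂ spectrum)))))

  k-equation : k * (L + 1) ≡ q ^ m ∸ 1
  k-equation = trans (cong (k *_) (ℕₚ.+-comm L 1)) (trans (ℕₚ.*-comm k (suc L))
    (cong (_∸ 1) (trans (sym n≡1+Kk) size≡q^m)))

  s≡1 : ℓ ≡ ⌊ m /2⌋ → s ≡ 1
  s≡1 ℓ≡m/2 = ℕₚ.*-cancelʳ-≡ s 1 ℓ {{ℕ.>-nonZero 1≤ℓ}} (trans (sym half-m) (trans (sym ℓ≡m/2) (sym (ℕₚ.*-identityˡ ℓ))))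

  complete-graphs : s ≡ 1 → charPoly (FiniteField.size F) (adjacency F q ℓ)
    ≈P (lin (+ (q ^ ⌊ m /2⌋ ∸ 1)) ^P (q ^ ⌊ m /2⌋)) *P (lin -[1+ 0 ] ^P (q ^ ⌊ m /2⌋ * (q ^ ⌊ m /2⌋ ∸ 1)))
  -- Writing q^(m/2) as 1 + k makes the truncated subtraction compute to k. Of the 1 + k equal
  -- factors, one comes from the valency and k from μ.
  complete-graphs s≡1 = subst (λ a → P ≈P (lin (+ (a ∸ 1)) ^P a) *P (lin -[1+ 0 ] ^P (a * (a ∸ 1)))) (sym half≡1+k)
    (merge-factors P (+ k) -[1+ 0 ] k (suc k * k)
      (trans charPoly≈ (cong normalize (cong₂ _*P_
        (cong (lin (+ k) *P_) (cong₂ (λ b l → lin b ^P (l * k)) (υ≡-1 L s k υ 1<L 0<k B≡ k≡ s≡1) (sym 1+k≡L′)))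
        (cong (λ b → lin b ^P k) (μ≡k L s k υ 1<L 0<k B≡ k≡ s≡1))))))
    where
    P : Poly
    P = charPoly (FiniteField.size F) (adjacency F q ℓ)
    1+k≡L′ : suc k ≡ L
    1+k≡L′ = 1+k≡L L s k υ 1<L 0<k B≡ k≡ s≡1
    half≡1+k : q ^ ⌊ m /2⌋ ≡ suc k
    half≡1+k = trans q^⌊m/2⌋≡ (trans (cong (L ^_) s≡1) (trans (ℕₚ.*-identityʳ L) (sym 1+k≡L′)))
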